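{- Suppose that $h$ is a connected, fully commutative permutation whose heap contains at least two entries in each internal column, and let $g$ be the diamond reduction of $h$. If $$G(x)=\sum_{n\ge 0}\bigl|S_{n+1}^{\{[321]\}}(g)\bigr|\,x^n,\qquad G_c(x)=\sum_{n\ge 0}\bigl|\{p\in S_{n+1}^{\{[321]\}}(g): p\text{ is connected}\}\bigr|\,x^n,\qquad F(x)=\sum_{n\ge 0}\bigl|S_{n+1}^{\{[321]\}}(h)\bigr|\,x^n,$$ with $G(0)=1=F(0)$ and $G_c(0)=0$, then the generating functions are rationally related according to $$F(x)=\frac{1-x-xG_c(x)}{1-3x+x^2+(x^2-x)G_c(x)}=\frac{1}{1-2x-x^2G(x)} .$$
   Context: The symmetric group $S_n$ is generated by the adjacent transpositions $s_1,\dots,s_{n-1}$, with $s_i=(i\;\,i+1)$. Reduced expressions for $w$ are words in the $s_i$ of minimal length representing $w$; $\mathrm{supp}(w)$ is the set of generators occurring in any (equivalently every) reduced expression of $w$. A permutation $w\in S_n$ is connected if the subscripts of the generators in $\mathrm{supp}(w)$ form a nonempty interval in $\{1,\dots,n-1\}$. Two reduced expressions of $w$ lie in the same commutativity class if they differ by a sequence of moves $s_is_j\mapsto s_js_i$ with $|i-j|\ge 2$; $w$ is fully commutative if it has exactly one commutativity class. Heaps: for a reduced expression $\mathsf w=\mathsf w_1\cdots\mathsf w_k$, the heap of $\mathsf w$ is the poset on $\{1,\dots,k\}$ given by the transitive closure of: $a\prec b$ if $a<b$ and $\mathsf w_a$ does not commute with $\mathsf w_b$, with element $a$ labeled by $\mathsf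 w_a$. Up to labeled isomorphism it depends only on the commutativity class; a fully commutative permutation has a unique heap. Entries labeled $s_i$ form column $i$. If $w$ is fully commutative and connected with $\mathrm{supp}(w)=\{s_i,s_{i+1},\dots,s_j\}$, then columns $i+1,\dots,j-1$ are the internal columns of the heap of $w$. Diamond reduction: a minimal pair is a pair of entries in the same column of a heap with no other entry of that column between them. In the heap of a fully commutative permutation every minimal pair $x,y$ in column $i$ has a distinct resolution: two entries lying strictly between $x$ and $y$ in the heap, one in column $i-1$ and one in column $i+1$. For $h$ connected and fully commutative with at least two entries in each internal column, every minimal pair together with the entries of its distinct resolution forms a minimal diamond in the heap of $h$. The diamond reduction of $h$ is given by the new heap whose entries correspond to the minimal diamonds, with poset structure inherited from the minimal diamonds in the heap of $h$ by taking the transitive closure of the relation that two minimal diamonds are related if they share an edge (of the Hasse diagram). Pictorially, one adds an entry at the center of each minimal diamond and then erases the heap of $h$; the number of columns decreases by two. For example, the diamond reduction of $s_5s_6s_7s_3s_4s_5s_6s_2s_3s_4s_5s_1s_2s_3$ is $s_4s_5s_2s_3s_4s_1s_2$. Heap containment: an orientation preserving Coxeter embedding $f:\{s_1,\dots,s_{k-1}\}\to\{s_1,\dots,s_{n-1}\}$ is an injective map such that for each $m\in\{2,3\}$, $(s_is_j)^m=1$ if and only if $(f(s_i)f(s_j))^m=1$, and such that the subscript of $f(s_i)$ is less than that of $f(s_j)$ whenever $i<j$; it is applied letterwise to words. A permutation $w\in S_n$ heap-contains $q\in S_k$ if there are commutativity classes of $w$ and $q$, represented by reduced expressions $\mathsf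 w$ and $\mathsf q$, and such an $f$ for which the heap of $f(\mathsf q)$ is contained as a convex labeled subposet of the heap of $\mathsf w$ (a subposet $Q$ of $P$ is convex if $x<y<z$ in $P$ with $x,z\in Q$ implies $y\in Q$). Otherwise $w$ heap-avoids $q$. $S_{n}^{\{[321]\}}(q)$ denotes the set of $w\in S_{n}$ that avoid $[321]$ as a classical permutation pattern (equivalently, are fully commutative) and heap-avoid $q$.
   Formalization: "Connected" is taken to mean that the support is all of {s_1,…,s_{n-1}}, both for h and in the definition of G_c; with supports that are proper intervals the stated identities are false (e.g. h = s_2s_1s_3s_2 regarded in S_5). -}

module Defs where

open import Data.Nat.Base as ℕ using (ℕ; zero; suc; _∸_; ∣_-_∣)
open import Data.Integer.Base as ℤ using (ℤ; +_; 0ℤ; 1ℤ)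
open import Data.Integer.Properties using (+-0-commutativeMonoid)
open import Data.Fin.Base using (Fin; zero; suc; toℕ; inject₁; _<_; _>_)
open import Data.Fin.Permutation
  using (Permutation′; _⟨$⟩ʳ_; _≈_; _∘ₚ_; id; transpose)
open import Data.List.Base using (List; []; _∷_; _++_; map; foldr; length; lookup)
open import Data.List.Membership.Propositional using (_∈_)
open import Data.Product.Base using (Σ; ∃; ∃-syntax; _×_; proj₁)
open import Data.Sum.Base using (_⊎_)
open import Function.Bundles using (Inverse; _⇔_)
open import Function.Definitions using (Injective)
open import Relation.Binary.Bundles using (Setoid)
open import Relation.Binary.Core using (Rel)
open import Relation.Binary.Construct.Closure.ReflexiveTransitive using (Star)
open import Relation.Binary.Construct.Closure.Transitive using (TransClosure)
import Relation.Binary.Construct.On as On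
open import Relation.Binary.PropositionalEquality
  using (_≡_; _≢_; setoid; _→-setoid_)
open import Relation.Nullary.Negation using (¬_)
open import Level using (0ℓ)

open import Algebra.Properties.CommutativeMonoid.Sum +-0-commutativeMonoid
  using (sum⁺-syntax)

-- Perm n is the symmetric group S_{n+1}.  It is indexed by its number n of
-- adjacent transpositions, so that generators and heap columns live in Fin n;
-- `s i` is the transposition usually written s_{toℕ i + 1}.

Perm : ℕ → Set
Perm n = Permutation′ (suc n)

s : ∀ {n} → Fin n → Perm n
s i = transpose (inject₁ i) (suc i)

-- The product of functions composed right to left: (π · ρ)(x) = π (ρ (x)).
-- (`_∘ₚ_` applies its left argument first.)

infixl 7 _·_
_·_ : ∀ {n} → Perm n → Perm n → Perm n
π · ρ = ρ ∘ₚ π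

pow : ∀ {n} → Perm n → ℕ → Perm n
pow π zero    = id
pow π (suc m) = π · pow π m

------------------------------------------------------------------------
-- Reduced expressions

Word : ℕ → Set
Word n = List (Fin n)

eval : ∀ {n} → Word n → Perm n
eval = foldr (λ i π → s i · π) id

record IsReducedFor {n} (w : Perm n) (𝕨 : Word n) : Set where
  field
    represents : eval 𝕨 ≈ w
    minimal    : ∀ 𝕧 → eval 𝕧 ≈ w → length 𝕨 ℕ.≤ length 𝕧

_∈supp_ : ∀ {n} → Fin n → Perm n → Set
i ∈supp w = ∃[ 𝕨 ] IsReducedFor w 𝕨 × i ∈ 𝕨

-- Connectedness is relative to the ambient group: w ∈ S_{n+1} is connected if
-- the subscripts of supp(w) form the whole interval {1,…,n}, and n ≥ 1.  The
-- weaker condition that they form some subinterval would not do: the power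
-- series identities fail both when connected elements of proper support are
-- counted in S_{n+1} and when the pattern h does not use all generators of its
-- own symmetric group.

Connected : ∀ {n} → Perm n → Set
Connected {n} w = (1 ℕ.≤ n) × (∀ i → i ∈supp w)

data CommutationMove {n} : Rel (Word n) 0ℓ where
  swap : ∀ 𝕦 𝕧 i j → 2 ℕ.≤ ∣ toℕ i - toℕ j ∣ →
         CommutationMove (𝕦 ++ i ∷ j ∷ 𝕧) (𝕦 ++ j ∷ i ∷ 𝕧)

-- Moves are invertible, so their reflexive transitive closure is already an
-- equivalence relation.

_∼_ : ∀ {n} → Rel (Word n) 0ℓ
_∼_ = Star CommutationMove

FullyCommutative : ∀ {n} → Perm n → Set
FullyCommutative w =
  ∃[ 𝕨 ] IsReducedFor w 𝕨 × (∀ 𝕧 → IsReducedFor w 𝕧 → 𝕨 ∼ 𝕧)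

------------------------------------------------------------------------
-- Heaps

Entry : ∀ {n} → Word n → Set
Entry 𝕨 = Fin (length 𝕨)

column : ∀ {n} (𝕨 : Word n) → Entry 𝕨 → Fin n
column = lookup

Precedes : ∀ {n} (𝕨 : Word n) → Rel (Entry 𝕨) 0ℓ
Precedes 𝕨 a b = a < b × ¬ (s i · s j ≈ s j · s i)
  where
  i = column 𝕨 a
  j = column 𝕨 b

Heap : ∀ {n} (𝕨 : Word n) → Rel (Entry 𝕨) 0ℓ
Heap 𝕨 = TransClosure (Precedes 𝕨)

-- For w in S_{k+3} with all k+2 generators in its support, the internal
-- columns are all columns but the first and the last.

internal : ∀ {k} → Fin k → Fin (2 ℕ.+ k)
internal c = suc (inject₁ c)

-- The heap of a fully commutative permutation does not depend on the reduced
-- expression chosen.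

TwoEntriesInEachInternalColumn : ∀ {k} → Perm (2 ℕ.+ k) → Set
TwoEntriesInEachInternalColumn {k} h =
  ∃[ 𝕙 ] IsReducedFor h 𝕙 ×
    (∀ (c : Fin k) → ∃[ a ] ∃[ b ]
       a ≢ b × column 𝕙 a ≡ internal c × column 𝕙 b ≡ internal c)

------------------------------------------------------------------------
-- Diamond reduction

module _ {n} (𝕨 : Word n) where

  private
    _≺_ : Rel (Entry 𝕨) 0ℓ
    _≺_ = Heap 𝕨

  IsMinimalPair : Rel (Entry 𝕨) 0ℓ
  IsMinimalPair x y =
    column 𝕨 x ≡ column 𝕨 y × x ≺ y ×
    (∀ z → column 𝕨 z ≡ column 𝕨 x → ¬ (x ≺ z × z ≺ y))

  HasseEdge : Rel (Entry 𝕨) 0ℓ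
  HasseEdge a b = a ≺ b × (∀ c → ¬ (a ≺ c × c ≺ b))

  record Quadruple : Set where
    constructor quadruple
    field
      bottom top left right : Entry 𝕨

  open Quadruple

  record IsMinimalDiamond (d : Quadruple) : Set where
    field
      minimalPair  : IsMinimalPair (bottom d) (top d)
      leftColumn   : suc (toℕ (column 𝕨 (left d))) ≡ toℕ (column 𝕨 (bottom d))
      rightColumn  : toℕ (column 𝕨 (right d)) ≡ suc (toℕ (column 𝕨 (bottom d)))
      leftBetween  : bottom d ≺ left d × left d ≺ top d
      rightBetween : bottom d ≺ right d × right d ≺ top d

  _∈◇_ : Entry 𝕨 → Quadruple → Set
  a ∈◇ d = a ≡ bottom d ⊎ a ≡ top d ⊎ a ≡ left d ⊎ a ≡ right d

  ShareEdge : Rel Quadruple 0ℓ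
  ShareEdge d e = ∃[ a ] ∃[ b ]
    HasseEdge a b × (a ∈◇ d × b ∈◇ d) × (a ∈◇ e × b ∈◇ e)

  -- Two diamonds sharing an edge are oriented as their bottoms (equivalently
  -- their tops) are in the given heap.

  DiamondPrecedes : Rel Quadruple 0ℓ
  DiamondPrecedes d e =
    IsMinimalDiamond d × IsMinimalDiamond e × ShareEdge d e × bottom d ≺ bottom e

  DiamondHeap : Rel Quadruple 0ℓ
  DiamondHeap = TransClosure DiamondPrecedes

-- g is the diamond reduction of h: the heap of g is isomorphic to the poset of
-- minimal diamonds of the heap of h, a diamond centred in the internal column
-- `internal c` being an entry of column c.

record IsDiamondReduction {k} (h : Perm (2 ℕ.+ k)) (g : Perm k) : Set where
  field
    𝕙          : Word (2 ℕ.+ k)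
    𝕘          : Word k
    𝕙-reduced  : IsReducedFor h 𝕙
    𝕘-reduced  : IsReducedFor g 𝕘
    ◇          : Entry 𝕘 → Quadruple 𝕙
    isDiamond  : ∀ a → IsMinimalDiamond 𝕙 (◇ a)
    injective  : Injective _≡_ _≡_ ◇
    surjective : ∀ d → IsMinimalDiamond 𝕙 d → ∃[ a ] ◇ a ≡ d
    columns    : ∀ a → column 𝕙 (Quadruple.bottom (◇ a)) ≡ internal (column 𝕘 a)
    order      : ∀ a b → Heap 𝕘 a b ⇔ DiamondHeap 𝕙 (◇ a) (◇ b)

------------------------------------------------------------------------
-- Heap containment

record IsCoxeterEmbedding {k n} (f : Fin k → Fin n) : Set where
  field
    injective  : Injective _≡_ _≡_ f
    order2     : ∀ i j → pow (s i · s j) 2 ≈ id ⇔ pow (s (f i) · s (f j)) 2 ≈ id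
    order3     : ∀ i j → pow (s i · s j) 3 ≈ id ⇔ pow (s (f i) · s (f j)) 3 ≈ id
    increasing : ∀ i j → i < j → f i < f j

record IsConvexSubheap {n} (𝕢 𝕨 : Word n) (ι : Entry 𝕢 → Entry 𝕨) : Set where
  field
    injective : Injective _≡_ _≡_ ι
    columns   : ∀ a → column 𝕨 (ι a) ≡ column 𝕢 a
    order     : ∀ a b → Heap 𝕢 a b ⇔ Heap 𝕨 (ι a) (ι b)
    convex    : ∀ a y b → Heap 𝕨 (ι a) y → Heap 𝕨 y (ι b) → ∃[ c ] ι c ≡ y

record HeapContains {n k} (w : Perm n) (q : Perm k) : Set where
  field
    𝕨           : Word n
    𝕢           : Word k
    𝕨-reduced   : IsReducedFor w 𝕨
    𝕢-reduced   : IsReducedFor q 𝕢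
    f           : Fin k → Fin n
    f-embedding : IsCoxeterEmbedding f
    ι           : Entry (map f 𝕢) → Entry 𝕨
    ι-convex    : IsConvexSubheap (map f 𝕢) 𝕨 ι

HeapAvoids : ∀ {n k} → Perm n → Perm k → Set
HeapAvoids w q = ¬ HeapContains w q

Avoids321 : ∀ {n} → Perm n → Set
Avoids321 w = ∀ i j k → i < j → j < k →
  ¬ (w ⟨$⟩ʳ i > w ⟨$⟩ʳ j × w ⟨$⟩ʳ j > w ⟨$⟩ʳ k)

-- Membership in the set usually written S_{n+1}^{[321]}(q).

S₃₂₁ : ∀ {k} → Perm k → (n : ℕ) → Perm n → Set
S₃₂₁ q n w = Avoids321 w × HeapAvoids w q

------------------------------------------------------------------------
-- Counting permutations

-- Elements are identified when they agree as functions, whatever the proofs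
-- they carry.

subset : ∀ {n} → (Perm n → Set) → Setoid 0ℓ 0ℓ
subset {n} P =
  On.setoid (Fin (suc n) →-setoid Fin (suc n)) (λ (p : Σ (Perm n) P) → proj₁ p ⟨$⟩ʳ_)

infix 4 ∣_∣≡_
∣_∣≡_ : ∀ {n} → (Perm n → Set) → ℕ → Set
∣ P ∣≡ N = Inverse (setoid (Fin N)) (subset P)

------------------------------------------------------------------------
-- Formal power series over ℤ

Series : Set
Series = ℕ → ℤ

gf : (ℕ → ℕ) → Series
gf a n = + a n

C : ℤ → Series
C c zero    = c
C c (suc _) = 0ℤ

X : Series
X zero          = 0ℤ
X (suc zero)    = 1ℤ
X (suc (suc _)) = 0ℤ

infixl 6 _+ₛ_ _-ₛ_
infixl 7 _*ₛ_

_+ₛ_ _-ₛ_ _*ₛ_ : Series → Series → Series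
(A +ₛ B) n = A n ℤ.+ B n
(A -ₛ B) n = A n ℤ.- B n
(A *ₛ B) n = ∑[ i ≤ n ] (A (toℕ i) ℤ.* B (n ∸ toℕ i))

-- F = A / B in ℤ[[x]]: a series B with constant term 1 is invertible, so the
-- equation F B = A then determines F.

infix 4 _≐_÷_
_≐_÷_ : Series → Series → Series → Set
F ≐ A ÷ B = B 0 ≡ 1ℤ × (∀ n → (F *ₛ B) n ≡ A n)

module Submission where

-- The heap of a 321-avoiding permutation in S_{n+1} is determined by the heights
-- of its columns together with the way in which neighbouring columns
-- interleave, that is, by a path of n + 1 steps from height 0 to height 0 with
-- steps up and down and two kinds of level steps, only one of which is allowed at
-- height 0.  (The letters of a reduced word are read as hops of particles; the
-- steps record the initial and the final content of the sites, and words with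
-- the same hops represent the same permutation.)
--
-- A connected pattern occurs as a convex subheap iff its path, moved up
-- suitably, fits between the boundaries of a segment of the larger heap, and
-- diamond reduction lowers the path of h by one: it is an up step, the raised
-- path of g, and a down step.  A nonempty path starts with a level step, or else
-- it consists of an up step, a path raised by one, and a path in which the first
-- step has been lifted; h occurs in the latter iff g occurs in the raised part or
-- h in the rest.  Hence F_{n+2} = 2 F_{n+1} + Σ G_i F_{n-i}.  Cutting at the first
-- return to 0 gives G_{n+1} = G_n + Gc_{n+1} + Σ Gc_i G_{n-i}, and the two
-- relations follow by elimination.

-- The definitions quantify over all reduced words, and arguing modulo commutation moves would mean
-- comparing heaps up to isomorphism everywhere. Hops avoid this. Each hop lowers the sum of the
-- positions of the particles by one and no letter lowers it by more, so a word made of hops has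
-- minimal length; and particles never overtake particles, nor holes holes, so the letter counts fix
-- the permutation. Hence all reduced words of such a permutation run on the same configuration with
-- the same counts, and the heap can be read off: the letters on the two sides of a site alternate,
-- one bringing a particle and one taking it away, and the initial content of the site tells which
-- comes first.
--
-- To show that a pattern is contained, one has to exhibit a reduced word with a copy of it. Words
-- are therefore constructed from prescribed heights, separately for the parts below and above the
-- pattern.
--
-- Avoiding 321 yields a configuration at once. For `h` only full commutativity is given, and a
-- configuration is built letter by letter; the only input is that commutations preserve letter
-- counts whereas braid moves do not.

open import Defs
open import Level using (0ℓ)
open import Algebra.Bundles using (CommutativeRing)
import Algebra.Solver.Ring.NaturalCoefficients.Default as SemiringSolver
open import Data.Bool.Base using (Bool; true; false; not)
open import Data.Empty using (⊥)
open import Data.Fin.Base using (Fin; zero; suc; toℕ; fromℕ; fromℕ<; inject₁)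
open import Data.Fin.Induction using (<-weakInduction; >-weakInduction)
import Data.Fin.Permutation as Perm
open Perm using (_⟨$⟩ʳ_; _⟨$⟩ˡ_; _≈_; inverseˡ; inverseʳ)
import Data.Fin.Properties as Fin
open import Data.Integer.Base as ℤ using (ℤ; +_; 0ℤ; 1ℤ)
import Data.Integer.Properties as ℤ
import Data.Integer.Tactic.RingSolver as ℤR
open import Data.List.Base using (List; []; _∷_; _++_; length; map; lookup; filter)
open import Data.List.Membership.Propositional using (_∈_)
import Data.List.Membership.Propositional.Properties as ∈
import Data.List.Properties as List
import Data.List.Relation.Unary.All as All
import Data.List.Relation.Unary.AllPairs as AllPairs
open import Data.List.Relation.Unary.Any using (here; there; index)
open import Data.List.Relation.Unary.Any.Properties using (lookup-index)
open import Data.List.Relation.Unary.Unique.Propositional using (Unique)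
import Data.List.Relation.Unary.Unique.Propositional.Properties as Unique
open import Data.Nat.Base using (ℕ; zero; suc; _+_; _*_; _∸_; _≤_; _<_; z≤n; s≤s; s≤s⁻¹)
open import Data.Nat.Induction using (<-rec)
import Data.Nat.Properties as ℕ
import Data.Nat.Tactic.RingSolver as ℕR
open import Data.Product.Base using (Σ; ∃; ∃-syntax; _×_; _,_; proj₁; proj₂)
open import Data.Sum.Base using (_⊎_; inj₁; inj₂; [_,_]′)
open import Data.Unit.Base using (⊤; tt)
open import Function.Base using (_∘_; case_of_)
open import Function.Bundles using (Inverse; _⇔_; mk⇔; Equivalence)
open import Relation.Binary.Construct.Closure.ReflexiveTransitive using (ε; _◅_)
open import Relation.Binary.Construct.Closure.Transitive using ([_]; _∷_)
open import Relation.Binary.Definitions using (tri<; tri≈; tri>)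
open import Relation.Binary.PropositionalEquality
open import Relation.Nullary using (¬_; Dec; yes; no; does; contradiction)
open import Relation.Nullary.Decidable using (map′; dec-true; dec-false; _×-dec_; _⊎-dec_; ¬?)
open Equivalence using (to; from)

-- Formal power series

infix 4 _≑_
_≑_ : Series → Series → Set
A ≑ B = ∀ n → A n ≡ B n

private
  tail : Series → Series
  tail A n = A (suc n)

  scale : ℤ → Series → Series
  scale a B n = a ℤ.* B n

*ₛ-cong : ∀ {A A′ B B′} → A ≑ A′ → B ≑ B′ → A *ₛ B ≑ A′ *ₛ B′
*ₛ-cong p q zero = cong₂ (λ a b → a ℤ.* b ℤ.+ 0ℤ) (p 0) (q 0)
*ₛ-cong p q (suc n) = cong₂ ℤ._+_ (cong₂ ℤ._*_ (p 0) (q (suc n))) (*ₛ-cong (λ m → p (suc m)) q n)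

*ₛ-distribʳ : ∀ C A B → (A +ₛ B) *ₛ C ≑ (A *ₛ C) +ₛ (B *ₛ C)
*ₛ-distribʳ C A B zero = ℤ-solve (A 0) (B 0) (C 0)
  where
  ℤ-solve : ∀ a b c → (a ℤ.+ b) ℤ.* c ℤ.+ 0ℤ ≡ (a ℤ.* c ℤ.+ 0ℤ) ℤ.+ (b ℤ.* c ℤ.+ 0ℤ)
  ℤ-solve = ℤR.solve-∀
*ₛ-distribʳ C A B (suc n) = trans
  (cong (λ z → ((A 0 ℤ.+ B 0) ℤ.* C (suc n)) ℤ.+ z) (*ₛ-distribʳ C (tail A) (tail B) n))
  (rearrange (A 0) (B 0) (C (suc n)) ((tail A *ₛ C) n) ((tail B *ₛ C) n))
  where
  rearrange : ∀ a b c x y →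
    (a ℤ.+ b) ℤ.* c ℤ.+ (x ℤ.+ y) ≡ (a ℤ.* c ℤ.+ x) ℤ.+ (b ℤ.* c ℤ.+ y)
  rearrange = ℤR.solve-∀

scale-*ₛ : ∀ a A B → scale a A *ₛ B ≑ scale a (A *ₛ B)
scale-*ₛ a A B zero = lemma a (A 0) (B 0)
  where
  lemma : ∀ a x y → (a ℤ.* x) ℤ.* y ℤ.+ 0ℤ ≡ a ℤ.* (x ℤ.* y ℤ.+ 0ℤ)
  lemma = ℤR.solve-∀
scale-*ₛ a A B (suc n) = trans
  (cong (λ z → (a ℤ.* A 0) ℤ.* B (suc n) ℤ.+ z) (scale-*ₛ a (tail A) B n))
  (lemma a (A 0) (B (suc n)) ((tail A *ₛ B) n))
  where
  lemma : ∀ a x y z → (a ℤ.* x) ℤ.* y ℤ.+ a ℤ.* z ≡ a ℤ.* (x ℤ.* y ℤ.+ z)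
  lemma = ℤR.solve-∀

*ₛ-assoc : ∀ A B C → (A *ₛ B) *ₛ C ≑ A *ₛ (B *ₛ C)
*ₛ-assoc A B C zero = lemma (A 0) (B 0) (C 0)
  where
  lemma : ∀ a b c → (a ℤ.* b ℤ.+ 0ℤ) ℤ.* c ℤ.+ 0ℤ ≡ a ℤ.* (b ℤ.* c ℤ.+ 0ℤ) ℤ.+ 0ℤ
  lemma = ℤR.solve-∀
*ₛ-assoc A B C (suc n) = begin
  (A *ₛ B) 0 ℤ.* C (suc n) ℤ.+ ((scale (A 0) (tail B) +ₛ (tail A *ₛ B)) *ₛ C) n
    ≡⟨ cong (λ z → ab ℤ.* C (suc n) ℤ.+ z) (*ₛ-distribʳ C (scale (A 0) (tail B)) (tail A *ₛ B) n) ⟩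
  ab ℤ.* C (suc n) ℤ.+ ((scale (A 0) (tail B) *ₛ C) n ℤ.+ ((tail A *ₛ B) *ₛ C) n)
    ≡⟨ cong₂ (λ x y → ab ℤ.* C (suc n) ℤ.+ (x ℤ.+ y))
         (scale-*ₛ (A 0) (tail B) C n) (*ₛ-assoc (tail A) B C n) ⟩
  ab ℤ.* C (suc n) ℤ.+ (A 0 ℤ.* (tail B *ₛ C) n ℤ.+ (tail A *ₛ (B *ₛ C)) n)
    ≡⟨ lemma (A 0) (B 0) (C (suc n)) ((tail B *ₛ C) n) ((tail A *ₛ (B *ₛ C)) n) ⟩
  A 0 ℤ.* (B 0 ℤ.* C (suc n) ℤ.+ (tail B *ₛ C) n) ℤ.+ (tail A *ₛ (B *ₛ C)) n ∎
  where
  open ≡-Reasoning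
  ab = (A *ₛ B) 0
  lemma : ∀ a b c x y →
    (a ℤ.* b ℤ.+ 0ℤ) ℤ.* c ℤ.+ (a ℤ.* x ℤ.+ y) ≡ a ℤ.* (b ℤ.* c ℤ.+ x) ℤ.+ y
  lemma = ℤR.solve-∀

-- The product unfolds by its first summand; commutativity needs the last one split off instead.
*ₛ-suc : ∀ A B n → (A *ₛ B) (suc n) ≡ (A *ₛ tail B) n ℤ.+ A (suc n) ℤ.* B 0
*ₛ-suc A B zero = lemma (A 0) (B 1) (A 1) (B 0)
  where
  lemma : ∀ a b c d → a ℤ.* b ℤ.+ (c ℤ.* d ℤ.+ 0ℤ) ≡ (a ℤ.* b ℤ.+ 0ℤ) ℤ.+ c ℤ.* d
  lemma = ℤR.solve-∀
*ₛ-suc A B (suc n) = trans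
  (cong (λ z → A 0 ℤ.* B (2 + n) ℤ.+ z) (*ₛ-suc (tail A) B n))
  (sym (ℤ.+-assoc (A 0 ℤ.* B (2 + n)) ((tail A *ₛ tail B) n) (A (2 + n) ℤ.* B 0)))

*ₛ-comm : ∀ A B → A *ₛ B ≑ B *ₛ A
*ₛ-comm A B zero = cong (ℤ._+ 0ℤ) (ℤ.*-comm (A 0) (B 0))
*ₛ-comm A B (suc n) = begin
  A 0 ℤ.* B (suc n) ℤ.+ (tail A *ₛ B) n
    ≡⟨ cong₂ ℤ._+_ (ℤ.*-comm (A 0) (B (suc n))) (*ₛ-comm (tail A) B n) ⟩
  B (suc n) ℤ.* A 0 ℤ.+ (B *ₛ tail A) n
    ≡⟨ ℤ.+-comm (B (suc n) ℤ.* A 0) ((B *ₛ tail A) n) ⟩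
  (B *ₛ tail A) n ℤ.+ B (suc n) ℤ.* A 0
    ≡⟨ *ₛ-suc B A n ⟨
  (B *ₛ A) (suc n) ∎
  where open ≡-Reasoning

*ₛ-zeroˡ : ∀ A → C 0ℤ *ₛ A ≑ C 0ℤ
*ₛ-zeroˡ A n = trans (*ₛ-cong {B = A} C0 (λ _ → refl) n) (trans (scale-*ₛ 0ℤ (C 0ℤ) A n) (sym (C0 n)))
  where
  C0 : C 0ℤ ≑ scale 0ℤ (C 0ℤ)
  C0 zero = refl
  C0 (suc n) = refl

*ₛ-identityˡ : ∀ A → C 1ℤ *ₛ A ≑ A
*ₛ-identityˡ A zero = trans (ℤ.+-identityʳ _) (ℤ.*-identityˡ (A 0))
*ₛ-identityˡ A (suc n) = begin
  1ℤ ℤ.* A (suc n) ℤ.+ (tail (C 1ℤ) *ₛ A) n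
    ≡⟨ cong₂ ℤ._+_ (ℤ.*-identityˡ (A (suc n)))
         (trans (*ₛ-cong {B = A} tail-C (λ _ → refl) n) (*ₛ-zeroˡ A n)) ⟩
  A (suc n) ℤ.+ C 0ℤ n
    ≡⟨ cong (λ z → A (suc n) ℤ.+ z) (sym (tail-C n)) ⟩
  A (suc n) ℤ.+ 0ℤ
    ≡⟨ ℤ.+-identityʳ (A (suc n)) ⟩
  A (suc n) ∎
  where
  open ≡-Reasoning
  tail-C : (λ _ → 0ℤ) ≑ C 0ℤ
  tail-C zero = refl
  tail-C (suc _) = refl

seriesRing : CommutativeRing 0ℓ 0ℓ
seriesRing = record
  { Carrier = Series
  ; _≈_ = _≑_
  ; _+_ = _+ₛ_
  ; _*_ = _*ₛ_
  ; -_ = λ A n → ℤ.- A n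
  ; 0# = C 0ℤ
  ; 1# = C 1ℤ
  ; isCommutativeRing = record
    { isRing = record
      { +-isAbelianGroup = record
        { isGroup = record
          { isMonoid = record
            { isSemigroup = record
              { isMagma = record
                { isEquivalence = record
                  { refl = λ _ → refl
                  ; sym = λ p n → sym (p n)
                  ; trans = λ p q n → trans (p n) (q n) }
                ; ∙-cong = λ p q n → cong₂ ℤ._+_ (p n) (q n) }
              ; assoc = λ A B C n → ℤ.+-assoc (A n) (B n) (C n) }
            ; identity = (λ A n → trans (cong (ℤ._+ A n) (C0 n)) (ℤ.+-identityˡ (A n)))
                       , (λ A n → trans (cong (λ z → A n ℤ.+ z) (C0 n)) (ℤ.+-identityʳ (A n))) }
          ; inverse = (λ A n → trans (ℤ.+-inverseˡ (A n)) (sym (C0 n)))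
                    , (λ A n → trans (ℤ.+-inverseʳ (A n)) (sym (C0 n)))
          ; ⁻¹-cong = λ p n → cong ℤ.-_ (p n) }
        ; comm = λ A B n → ℤ.+-comm (A n) (B n) }
      ; *-cong = *ₛ-cong
      ; *-assoc = *ₛ-assoc
      ; *-identity = *ₛ-identityˡ
                   , (λ A n → trans (*ₛ-comm A (C 1ℤ) n) (*ₛ-identityˡ A n))
      ; distrib = (λ A B C n → trans (*ₛ-comm A (B +ₛ C) n)
                    (trans (*ₛ-distribʳ A B C n)
                      (cong₂ ℤ._+_ (*ₛ-comm B A n) (*ₛ-comm C A n))))
                , *ₛ-distribʳ }
    ; *-comm = *ₛ-comm } }
  where
  C0 : ∀ n → C 0ℤ n ≡ 0ℤ
  C0 zero = refl
  C0 (suc _) = refl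

X*-suc : ∀ A n → (X *ₛ A) (suc n) ≡ A n
X*-suc A n = trans (cong₂ ℤ._+_ {0ℤ ℤ.* A (suc n)} refl
                     (*ₛ-cong {B = A} tail-X (λ _ → refl) n))
                   (trans (ℤ.+-identityˡ _) (*ₛ-identityˡ A n))
  where
  tail-X : tail X ≑ C 1ℤ
  tail-X zero = refl
  tail-X (suc zero) = refl
  tail-X (suc (suc _)) = refl

conv : (ℕ → ℕ) → (ℕ → ℕ) → ℕ → ℕ
conv a b zero = a 0 * b 0
conv a b (suc n) = a 0 * b (suc n) + conv (a ∘ suc) b n

gf-conv : ∀ a b n → (gf a *ₛ gf b) n ≡ + conv a b n
gf-conv a b zero = trans (ℤ.+-identityʳ _) (sym (ℤ.pos-* (a 0) (b 0)))
gf-conv a b (suc n) = cong₂ ℤ._+_ (sym (ℤ.pos-* (a 0) (b (suc n)))) (gf-conv (a ∘ suc) b n)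

-- Elimination in an abstract commutative ring

private
  module Elimination (R : CommutativeRing 0ℓ 0ℓ) where
    open CommutativeRing R renaming (_≈_ to _≋_; _+_ to _⊞_; _*_ to _⊠_; -_ to ⊟_; refl to ≈-refl; sym to ≈-sym; trans to ≈-trans; setoid to ≈-setoid; zero to ⊠-zero)
    open import Algebra.Properties.Ring ring using (-‿distribˡ-*; -‿distribʳ-*; -‿involutive; -‿+-comm; +-cancelʳ)
    open import Relation.Binary.Reasoning.Setoid ≈-setoid
    open SemiringSolver commutativeSemiring using (solve; _:=_; _:+_; _:*_; con)

    transpose-sub : ∀ {a b d} → a ≋ b ⊞ d → a ⊞ ⊟ d ≋ b
    transpose-sub {a} {b} {d} p = begin
      a ⊞ ⊟ d ≈⟨ +-congʳ p ⟩
      (b ⊞ d) ⊞ ⊟ d ≈⟨ +-assoc b d (⊟ d) ⟩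
      b ⊞ (d ⊞ ⊟ d) ≈⟨ +-congˡ (-‿inverseʳ d) ⟩
      b ⊞ 0# ≈⟨ +-identityʳ b ⟩
      b ∎

    module _ (x g c f : Carrier)
      (F-eq : f ≋ (1# ⊞ x ⊠ (f ⊞ f)) ⊞ x ⊠ (x ⊠ (g ⊠ f)))
      (G-eq : g ≋ (1# ⊞ c) ⊞ x ⊠ (g ⊞ c ⊠ g)) where

      A₁ B₁ B₂ : Carrier
      A₁ = (1# ⊞ ⊟ x) ⊞ ⊟ (x ⊠ c)
      B₁ = ((1# ⊞ ⊟ (((1# ⊞ 1#) ⊞ 1#) ⊠ x)) ⊞ x ⊠ x) ⊞ (x ⊠ x ⊞ ⊟ x) ⊠ c
      B₂ = (1# ⊞ ⊟ ((1# ⊞ 1#) ⊠ x)) ⊞ ⊟ ((x ⊠ x) ⊠ g)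

      private
        -- The semiring solver sees the negative of `x` as an indeterminate; its relations to `x`
        -- are supplied separately.
        n = ⊟ x

        n*n : n ⊠ n ≋ x ⊠ x
        n*n = ≈-trans (≈-sym (-‿distribˡ-* x n))
          (≈-trans (-‿cong (≈-sym (-‿distribʳ-* x x))) (-‿involutive _))

        A₁′ : A₁ ≋ (1# ⊞ n) ⊞ n ⊠ c
        A₁′ = +-congˡ (-‿distribˡ-* x c)

        two : (1# ⊞ ⊟ ((1# ⊞ 1#) ⊠ x)) ≋ 1# ⊞ (1# ⊞ 1#) ⊠ n
        two = +-congˡ (-‿distribʳ-* (1# ⊞ 1#) x)

      f⊠B₂ : f ⊠ B₂ ≋ 1#
      f⊠B₂ = begin
        f ⊠ B₂
          ≈⟨ distribˡ f _ _ ⟩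
        f ⊠ (1# ⊞ ⊟ ((1# ⊞ 1#) ⊠ x)) ⊞ f ⊠ ⊟ ((x ⊠ x) ⊠ g)
          ≈⟨ +-cong (distribˡ f _ _) (≈-sym (-‿distribʳ-* f _)) ⟩
        (f ⊠ 1# ⊞ f ⊠ ⊟ ((1# ⊞ 1#) ⊠ x)) ⊞ ⊟ (f ⊠ ((x ⊠ x) ⊠ g))
          ≈⟨ +-congʳ (+-cong (*-identityʳ f) (≈-sym (-‿distribʳ-* f _))) ⟩
        (f ⊞ ⊟ (f ⊠ ((1# ⊞ 1#) ⊠ x))) ⊞ ⊟ (f ⊠ ((x ⊠ x) ⊠ g))
          ≈⟨ +-assoc f _ _ ⟩
        f ⊞ (⊟ (f ⊠ ((1# ⊞ 1#) ⊠ x)) ⊞ ⊟ (f ⊠ ((x ⊠ x) ⊠ g)))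
          ≈⟨ +-congˡ (-‿+-comm _ _) ⟩
        f ⊞ ⊟ (f ⊠ ((1# ⊞ 1#) ⊠ x) ⊞ f ⊠ ((x ⊠ x) ⊠ g))
          ≈⟨ transpose-sub (≈-trans F-eq
               (solve 3 (λ f x g → (con 1 :+ x :* (f :+ f)) :+ x :* (x :* (g :* f))
                  := con 1 :+ (f :* ((con 1 :+ con 1) :* x) :+ f :* ((x :* x) :* g))) ≈-refl f x g)) ⟩
        1# ∎

      g⊠A₁ : g ⊠ A₁ ≋ 1# ⊞ c
      g⊠A₁ = begin
        g ⊠ A₁ ≈⟨ *-congˡ A₁′ ⟩
        g ⊠ ((1# ⊞ n) ⊞ n ⊠ c)
          ≈⟨ solve 3 (λ g n c → g :* ((con 1 :+ n) :+ n :* c) := g :+ n :* (g :+ c :* g)) ≈-refl g n c ⟩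
        g ⊞ n ⊠ (g ⊞ c ⊠ g) ≈⟨ +-congˡ (-‿distribˡ-* x _) ⟨
        g ⊞ ⊟ (x ⊠ (g ⊞ c ⊠ g)) ≈⟨ transpose-sub G-eq ⟩
        1# ⊞ c ∎

      -- `g` enters `B₂` only through x²g, and `g⊠A₁` turns x²gA₁ into x²(1 + c). The first relation
      -- is thus the second one multiplied by `A₁`.
      B₁-factor : B₁ ≋ B₂ ⊠ A₁
      B₁-factor = ≈-sym (begin
        B₂ ⊠ A₁
          ≈⟨ distribʳ A₁ _ _ ⟩
        (1# ⊞ ⊟ ((1# ⊞ 1#) ⊠ x)) ⊠ A₁ ⊞ ⊟ ((x ⊠ x) ⊠ g) ⊠ A₁
          ≈⟨ +-cong (*-cong two A₁′) (≈-sym (-‿distribˡ-* _ A₁)) ⟩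
        (1# ⊞ (1# ⊞ 1#) ⊠ n) ⊠ ((1# ⊞ n) ⊞ n ⊠ c) ⊞ ⊟ (((x ⊠ x) ⊠ g) ⊠ A₁)
          ≈⟨ +-congˡ (-‿cong (≈-trans (*-assoc (x ⊠ x) g A₁) (*-cong (≈-sym n*n) g⊠A₁))) ⟩
        (1# ⊞ (1# ⊞ 1#) ⊠ n) ⊠ ((1# ⊞ n) ⊞ n ⊠ c) ⊞ ⊟ ((n ⊠ n) ⊠ (1# ⊞ c))
          ≈⟨ transpose-sub (solve 2 (λ n c →
               (con 1 :+ (con 1 :+ con 1) :* n) :* ((con 1 :+ n) :+ n :* c)
               := (((con 1 :+ ((con 1 :+ con 1) :+ con 1) :* n) :+ n :* n) :+ (n :* n :+ n) :* c)
                  :+ (n :* n) :* (con 1 :+ c)) ≈-refl n c) ⟩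
        ((1# ⊞ ((1# ⊞ 1#) ⊞ 1#) ⊠ n) ⊞ n ⊠ n) ⊞ (n ⊠ n ⊞ n) ⊠ c
          ≈⟨ +-cong (+-cong (+-congˡ (≈-sym (-‿distribʳ-* _ x))) n*n) (*-congʳ (+-congʳ n*n)) ⟩
        B₁ ∎)

      f⊠B₁ : f ⊠ B₁ ≋ A₁
      f⊠B₁ = begin
        f ⊠ B₁ ≈⟨ *-congˡ B₁-factor ⟩
        f ⊠ (B₂ ⊠ A₁) ≈⟨ *-assoc f B₂ A₁ ⟨
        (f ⊠ B₂) ⊠ A₁ ≈⟨ *-congʳ f⊠B₂ ⟩
        1# ⊠ A₁ ≈⟨ *-identityˡ A₁ ⟩
        A₁ ∎

module _ (G Gc F : ℕ → ℕ)
  (G0 : G 0 ≡ 1) (F0 : F 0 ≡ 1) (Gc0 : Gc 0 ≡ 0) (F1 : F 1 ≡ 2)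
  (F-rec : ∀ n → F (2 + n) ≡ F (1 + n) + F (1 + n) + conv G F n)
  (G1 : G 1 ≡ G 0 + Gc 1)
  (G-rec : ∀ n → G (2 + n) ≡ G (1 + n) + Gc (2 + n) + conv Gc G (1 + n))
  where

  private
    module S = CommutativeRing seriesRing
    one = C 1ℤ
    g = gf G
    c = gf Gc
    f = gf F

    F-series : f ≑ one +ₛ X *ₛ (f +ₛ f) +ₛ X *ₛ (X *ₛ (g *ₛ f))
    F-series zero = cong +_ F0
    F-series (suc zero) = begin
      + F 1 ≡⟨ cong +_ F1 ⟩
      + 2 ≡⟨ cong₂ (λ a b → + a ℤ.+ + b) (sym F0) (sym F0) ⟩
      f 0 ℤ.+ f 0 ≡⟨ ℤ.+-identityˡ (f 0 ℤ.+ f 0) ⟨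
      0ℤ ℤ.+ (f 0 ℤ.+ f 0) ≡⟨ ℤ.+-identityʳ _ ⟨
      (0ℤ ℤ.+ (f 0 ℤ.+ f 0)) ℤ.+ 0ℤ
        ≡⟨ cong₂ (λ a b → (0ℤ ℤ.+ a) ℤ.+ b) (X*-suc (f +ₛ f) 0) (X*-suc (X *ₛ (g *ₛ f)) 0) ⟨
      (one +ₛ X *ₛ (f +ₛ f) +ₛ X *ₛ (X *ₛ (g *ₛ f))) 1 ∎
      where open ≡-Reasoning
    F-series (suc (suc n)) = begin
      + F (2 + n) ≡⟨ cong +_ (F-rec n) ⟩
      (f (1 + n) ℤ.+ f (1 + n)) ℤ.+ + conv G F n
        ≡⟨ cong₂ (λ a b → a ℤ.+ b) (ℤ.+-identityˡ (f (1 + n) ℤ.+ f (1 + n))) (gf-conv G F n) ⟨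
      (0ℤ ℤ.+ (f (1 + n) ℤ.+ f (1 + n))) ℤ.+ (g *ₛ f) n
        ≡⟨ cong₂ (λ a b → (0ℤ ℤ.+ a) ℤ.+ b) (X*-suc (f +ₛ f) (suc n))
             (trans (X*-suc (X *ₛ (g *ₛ f)) (suc n)) (X*-suc (g *ₛ f) n)) ⟨
      (one +ₛ X *ₛ (f +ₛ f) +ₛ X *ₛ (X *ₛ (g *ₛ f))) (2 + n) ∎
      where open ≡-Reasoning

    G-series : g ≑ (one +ₛ c) +ₛ X *ₛ (g +ₛ c *ₛ g)
    G-series zero = trans (cong +_ G0) (cong (λ z → (1ℤ ℤ.+ + z) ℤ.+ 0ℤ) (sym Gc0))
    G-series (suc zero) = begin
      + G 1 ≡⟨ cong +_ G1 ⟩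
      g 0 ℤ.+ c 1 ≡⟨ lemma (g 0) (c 1) ⟩
      (0ℤ ℤ.+ c 1) ℤ.+ (g 0 ℤ.+ 0ℤ)
        ≡⟨ cong (λ z → (0ℤ ℤ.+ c 1) ℤ.+ (g 0 ℤ.+ (+ z ℤ.* g 0 ℤ.+ 0ℤ))) (sym Gc0) ⟩
      (0ℤ ℤ.+ c 1) ℤ.+ (g 0 ℤ.+ (c *ₛ g) 0)
        ≡⟨ cong (λ z → (0ℤ ℤ.+ c 1) ℤ.+ z) (X*-suc (g +ₛ c *ₛ g) 0) ⟨
      ((one +ₛ c) +ₛ X *ₛ (g +ₛ c *ₛ g)) 1 ∎
      where
      open ≡-Reasoning
      lemma : ∀ a b → a ℤ.+ b ≡ (0ℤ ℤ.+ b) ℤ.+ (a ℤ.+ 0ℤ)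
      lemma = ℤR.solve-∀
    G-series (suc (suc n)) = begin
      + G (2 + n) ≡⟨ cong +_ (G-rec n) ⟩
      (g (1 + n) ℤ.+ c (2 + n)) ℤ.+ + conv Gc G (1 + n)
        ≡⟨ cong (λ z → (g (1 + n) ℤ.+ c (2 + n)) ℤ.+ z) (gf-conv Gc G (1 + n)) ⟨
      (g (1 + n) ℤ.+ c (2 + n)) ℤ.+ (c *ₛ g) (1 + n)
        ≡⟨ lemma (g (1 + n)) (c (2 + n)) ((c *ₛ g) (1 + n)) ⟩
      (0ℤ ℤ.+ c (2 + n)) ℤ.+ (g (1 + n) ℤ.+ (c *ₛ g) (1 + n))
        ≡⟨ cong (λ z → (0ℤ ℤ.+ c (2 + n)) ℤ.+ z) (X*-suc (g +ₛ c *ₛ g) (suc n)) ⟨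
      ((one +ₛ c) +ₛ X *ₛ (g +ₛ c *ₛ g)) (2 + n) ∎
      where
      open ≡-Reasoning
      lemma : ∀ a b d → (a ℤ.+ b) ℤ.+ d ≡ (0ℤ ℤ.+ b) ℤ.+ (a ℤ.+ d)
      lemma = ℤR.solve-∀

    C2 : C (+ 2) ≑ one +ₛ one
    C2 zero = refl
    C2 (suc _) = refl

    C3 : C (+ 3) ≑ one +ₛ one +ₛ one
    C3 zero = refl
    C3 (suc _) = refl

    B₁ B₂ : Series → Series
    B₁ k = one -ₛ k *ₛ X +ₛ X *ₛ X +ₛ (X *ₛ X -ₛ X) *ₛ c
    B₂ k = one -ₛ k *ₛ X -ₛ X *ₛ X *ₛ g

    module E = Elimination seriesRing

    swap-B₁ : B₁ (C (+ 3)) ≑ B₁ (one +ₛ one +ₛ one)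
    swap-B₁ = S.+-congʳ (S.+-congʳ (S.+-congˡ {one} (S.-‿cong (S.*-congʳ {X} C3))))

    swap-B₂ : B₂ (C (+ 2)) ≑ B₂ (one +ₛ one)
    swap-B₂ = S.+-congʳ (S.+-congˡ {one} (S.-‿cong (S.*-congʳ {X} C2)))

  rational-relations :
    (gf F ≐ C 1ℤ -ₛ X -ₛ X *ₛ gf Gc
          ÷ C 1ℤ -ₛ C (+ 3) *ₛ X +ₛ X *ₛ X +ₛ (X *ₛ X -ₛ X) *ₛ gf Gc)
    × (gf F ≐ C 1ℤ
            ÷ C 1ℤ -ₛ C (+ 2) *ₛ X -ₛ X *ₛ X *ₛ gf G)
  rational-relations =
      (refl , S.trans (S.*-congˡ {f} swap-B₁) (E.f⊠B₁ X g c f F-series G-series))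
    , (refl , S.trans (S.*-congˡ {f} swap-B₂) (E.f⊠B₂ X g c f F-series G-series))

-- Paths

-- A level step at height 0 belongs to a site that no letter touches. Its content is immaterial, and
-- leaving out `hi` there makes the path unique.
data Step : ℕ → ℕ → Set where
  up   : ∀ {a} → Step a (suc a)
  down : ∀ {a} → Step (suc a) a
  lo   : ∀ {a} → Step a a
  hi   : ∀ {a} → Step (suc a) (suc a)

infixr 5 _∷ₚ_

data Path : ℕ → ℕ → Set where
  []   : Path 0 0
  _∷ₚ_ : ∀ {a b l} → Step a b → Path b l → Path a (suc l)

Weight : ℕ → Set
Weight a = ∀ {l} → Path a l → ℕ

total : ∀ a l → (Path a l → ℕ) → ℕ
total zero zero f = f []
total (suc a) zero f = 0
total zero (suc l) f = total 1 l (f ∘ (up ∷ₚ_)) + total 0 l (f ∘ (lo ∷ₚ_))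
total (suc a) (suc l) f =
  (total (2 + a) l (f ∘ (up ∷ₚ_)) + total (suc a) l (f ∘ (lo ∷ₚ_))) +
  (total a l (f ∘ (down ∷ₚ_)) + total (suc a) l (f ∘ (hi ∷ₚ_)))

total-cong : ∀ a l {f g : Path a l → ℕ} → (∀ p → f p ≡ g p) → total a l f ≡ total a l g
total-cong zero zero e = e []
total-cong (suc a) zero e = refl
total-cong zero (suc l) e =
  cong₂ _+_ (total-cong 1 l (e ∘ (up ∷ₚ_))) (total-cong 0 l (e ∘ (lo ∷ₚ_)))
total-cong (suc a) (suc l) e = cong₂ _+_
  (cong₂ _+_ (total-cong (2 + a) l (e ∘ (up ∷ₚ_))) (total-cong (suc a) l (e ∘ (lo ∷ₚ_))))
  (cong₂ _+_ (total-cong a l (e ∘ (down ∷ₚ_))) (total-cong (suc a) l (e ∘ (hi ∷ₚ_))))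

total-scale : ∀ a l c (f : Path a l → ℕ) → total a l (λ p → c * f p) ≡ c * total a l f
total-scale zero zero c f = refl
total-scale (suc a) zero c f = sym (ℕ.*-zeroʳ c)
total-scale zero (suc l) c f =
  trans (cong₂ _+_ (total-scale 1 l c _) (total-scale 0 l c _)) (sym (ℕ.*-distribˡ-+ c _ _))
total-scale (suc a) (suc l) c f =
  trans (cong₂ _+_
      (trans (cong₂ _+_ (total-scale (2 + a) l c _) (total-scale (suc a) l c _))
        (sym (ℕ.*-distribˡ-+ c _ _)))
      (trans (cong₂ _+_ (total-scale a l c _) (total-scale (suc a) l c _))
        (sym (ℕ.*-distribˡ-+ c _ _))))
    (sym (ℕ.*-distribˡ-+ c _ _))

total-0 : ∀ a l {f : Path a l → ℕ} → (∀ p → f p ≡ 0) → total a l f ≡ 0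
total-0 a l e = trans (total-cong a l e) (total-scale a l 0 (λ _ → 0))

-- Enumeration of paths and counting by indicators

enum : ∀ a l → List (Path a l)
enum zero zero = [] ∷ []
enum (suc a) zero = []
enum zero (suc l) = map (up ∷ₚ_) (enum 1 l) ++ map (lo ∷ₚ_) (enum 0 l)
enum (suc a) (suc l) =
  (map (up ∷ₚ_) (enum (2 + a) l) ++ map (lo ∷ₚ_) (enum (suc a) l)) ++
  (map (down ∷ₚ_) (enum a l) ++ map (hi ∷ₚ_) (enum (suc a) l))

∷ₚ-injective : ∀ {a b l} {s : Step a b} {p q : Path b l} → s ∷ₚ p ≡ s ∷ₚ q → p ≡ q
∷ₚ-injective refl = refl

enum-complete : ∀ {a l} (p : Path a l) → p ∈ enum a l
enum-complete [] = here refl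
enum-complete {zero} (up ∷ₚ p) = ∈.∈-++⁺ˡ (∈.∈-map⁺ (up ∷ₚ_) (enum-complete p))
enum-complete {suc a} (up ∷ₚ p) =
  ∈.∈-++⁺ˡ (∈.∈-++⁺ˡ (∈.∈-map⁺ (up ∷ₚ_) (enum-complete p)))
enum-complete {suc a} {suc l} (down ∷ₚ p) = ∈.∈-++⁺ʳ
  (map (up ∷ₚ_) (enum (2 + a) l) ++ map (lo ∷ₚ_) (enum (suc a) l))
  (∈.∈-++⁺ˡ (∈.∈-map⁺ (down ∷ₚ_) (enum-complete p)))
enum-complete {zero} {suc l} (lo ∷ₚ p) =
  ∈.∈-++⁺ʳ (map (up ∷ₚ_) (enum 1 l)) (∈.∈-map⁺ (lo ∷ₚ_) (enum-complete p))
enum-complete {suc a} {suc l} (lo ∷ₚ p) = ∈.∈-++⁺ˡ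
  (∈.∈-++⁺ʳ (map (up ∷ₚ_) (enum (2 + a) l)) (∈.∈-map⁺ (lo ∷ₚ_) (enum-complete p)))
enum-complete {suc a} {suc l} (hi ∷ₚ p) = ∈.∈-++⁺ʳ
  (map (up ∷ₚ_) (enum (2 + a) l) ++ map (lo ∷ₚ_) (enum (suc a) l))
  (∈.∈-++⁺ʳ (map (down ∷ₚ_) (enum a l)) (∈.∈-map⁺ (hi ∷ₚ_) (enum-complete p)))

private
  ∷ₚ-disjoint : ∀ {a b c l} {s : Step a b} {t : Step a c} {xs : List (Path b l)} {ys : List (Path c l)} →
    (∀ {p q} → s ∷ₚ p ≢ t ∷ₚ q) → ∀ {v} → ¬ (v ∈ map (s ∷ₚ_) xs × v ∈ map (t ∷ₚ_) ys)
  ∷ₚ-disjoint ne (i , j) with ∈.∈-map⁻ _ i | ∈.∈-map⁻ _ j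
  ... | _ , _ , e | _ , _ , e′ = ne (trans (sym e) e′)

  enum-++-disjoint : ∀ {A : Set} (ws xs ys zs : List A) →
    (∀ {v} → ¬ (v ∈ ws × v ∈ ys)) → (∀ {v} → ¬ (v ∈ ws × v ∈ zs)) →
    (∀ {v} → ¬ (v ∈ xs × v ∈ ys)) → (∀ {v} → ¬ (v ∈ xs × v ∈ zs)) →
    ∀ {v} → ¬ (v ∈ ws ++ xs × v ∈ ys ++ zs)
  enum-++-disjoint ws xs ys zs a b c d (i , j) with ∈.∈-++⁻ ws i | ∈.∈-++⁻ ys j
  ... | inj₁ p | inj₁ q = a (p , q)
  ... | inj₁ p | inj₂ q = b (p , q)
  ... | inj₂ p | inj₁ q = c (p , q)
  ... | inj₂ p | inj₂ q = d (p , q)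

enum-unique : ∀ a l → Unique (enum a l)
enum-unique zero zero = All.[] AllPairs.∷ AllPairs.[]
enum-unique (suc a) zero = AllPairs.[]
enum-unique zero (suc l) = Unique.++⁺
  (Unique.map⁺ ∷ₚ-injective (enum-unique 1 l)) (Unique.map⁺ ∷ₚ-injective (enum-unique 0 l))
  (∷ₚ-disjoint (λ ()))
enum-unique (suc a) (suc l) = Unique.++⁺
  (Unique.++⁺ (Unique.map⁺ ∷ₚ-injective (enum-unique (2 + a) l))
    (Unique.map⁺ ∷ₚ-injective (enum-unique (suc a) l)) (∷ₚ-disjoint (λ ())))
  (Unique.++⁺ (Unique.map⁺ ∷ₚ-injective (enum-unique a l))
    (Unique.map⁺ ∷ₚ-injective (enum-unique (suc a) l)) (∷ₚ-disjoint (λ ())))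
  (enum-++-disjoint (map (up ∷ₚ_) (enum (2 + a) l)) (map (lo ∷ₚ_) (enum (suc a) l))
    (map (down ∷ₚ_) (enum a l)) (map (hi ∷ₚ_) (enum (suc a) l))
    (∷ₚ-disjoint (λ ())) (∷ₚ-disjoint (λ ())) (∷ₚ-disjoint (λ ())) (∷ₚ-disjoint (λ ())))

χ : ∀ {A : Set} → Dec A → ℕ
χ (yes _) = 1
χ (no _) = 0

χ-cong : ∀ {A B : Set} (x : Dec A) (y : Dec B) → (A → B) → (B → A) → χ x ≡ χ y
χ-cong (yes _) (yes _) f g = refl
χ-cong (yes a) (no ¬b) f g = contradiction (f a) ¬b
χ-cong (no ¬a) (yes b) f g = contradiction (g b) ¬a
χ-cong (no _) (no _) f g = refl

module _ where
  private
    length-filter-map : ∀ {A B : Set} {P : B → Set} (P? : ∀ b → Dec (P b)) (f : A → B) xs →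
      length (filter P? (map f xs)) ≡ length (filter (P? ∘ f) xs)
    length-filter-map P? f [] = refl
    length-filter-map P? f (x ∷ xs) with P? (f x)
    ... | yes _ = cong suc (length-filter-map P? f xs)
    ... | no _ = length-filter-map P? f xs

    length-filter-++ : ∀ {A : Set} {P : A → Set} (P? : ∀ b → Dec (P b)) xs ys →
      length (filter P? (xs ++ ys)) ≡ length (filter P? xs) + length (filter P? ys)
    length-filter-++ P? xs ys =
      trans (cong length (List.filter-++ P? xs ys)) (List.length-++ (filter P? xs))

    branch : ∀ {a b c l m n} {P : Path a (suc l) → Set} (P? : ∀ p → Dec (P p))
      (s : Step a b) (t : Step a c) (xs : List (Path b l)) (ys : List (Path c l)) →
      length (filter (P? ∘ (s ∷ₚ_)) xs) ≡ m → length (filter (P? ∘ (t ∷ₚ_)) ys) ≡ n →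
      length (filter P? (map (s ∷ₚ_) xs ++ map (t ∷ₚ_) ys)) ≡ m + n
    branch P? s t xs ys p q = trans (length-filter-++ P? (map (s ∷ₚ_) xs) _)
      (cong₂ _+_ (trans (length-filter-map P? (s ∷ₚ_) xs) p)
                 (trans (length-filter-map P? (t ∷ₚ_) ys) q))

  length-filter-enum : ∀ a l {P : Path a l → Set} (P? : ∀ p → Dec (P p)) →
    length (filter P? (enum a l)) ≡ total a l (χ ∘ P?)
  length-filter-enum zero zero P? with P? []
  ... | yes _ = refl
  ... | no _ = refl
  length-filter-enum (suc a) zero P? = refl
  length-filter-enum zero (suc l) P? = branch P? up lo (enum 1 l) (enum 0 l)
    (length-filter-enum 1 l (P? ∘ (up ∷ₚ_))) (length-filter-enum 0 l (P? ∘ (lo ∷ₚ_)))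
  length-filter-enum (suc a) (suc l) P? =
    trans (length-filter-++ P? (map (up ∷ₚ_) (enum (2 + a) l) ++ map (lo ∷ₚ_) (enum (suc a) l))
      (map (down ∷ₚ_) (enum a l) ++ map (hi ∷ₚ_) (enum (suc a) l)))
    (cong₂ _+_
      (branch P? up lo (enum (2 + a) l) (enum (suc a) l) (length-filter-enum (2 + a) l (P? ∘ (up ∷ₚ_)))
                       (length-filter-enum (suc a) l (P? ∘ (lo ∷ₚ_))))
      (branch P? down hi (enum a l) (enum (suc a) l) (length-filter-enum a l (P? ∘ (down ∷ₚ_)))
                         (length-filter-enum (suc a) l (P? ∘ (hi ∷ₚ_)))))

lookup-injective : ∀ {A : Set} {xs : List A} → Unique xs →
  ∀ i j → lookup xs i ≡ lookup xs j → i ≡ j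
lookup-injective (x AllPairs.∷ u) zero zero e = refl
lookup-injective (x AllPairs.∷ u) zero (suc j) e = contradiction e (All.lookup x (∈.∈-lookup j))
lookup-injective (x AllPairs.∷ u) (suc i) zero e = contradiction (sym e) (All.lookup x (∈.∈-lookup i))
lookup-injective (x AllPairs.∷ u) (suc i) (suc j) e = cong suc (lookup-injective u i j e)

-- Injections in both directions between `Fin N` and the list of paths satisfying `P` are enough; no
-- inverse laws have to be checked.
total-unique : ∀ {a l N} {P : Path a l → Set} (P? : ∀ p → Dec (P p))
  (to : Fin N → Path a l) (from : ∀ p → P p → Fin N) →
  (∀ i → P (to i)) → (∀ {i j} → to i ≡ to j → i ≡ j) →
  (∀ {p q} (x : P p) (y : P q) → from p x ≡ from q y → p ≡ q) →
  N ≡ total a l (χ ∘ P?)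
total-unique {a} {l} {N} {P} P? to from sound to-inj from-inj =
  trans (ℕ.≤-antisym (Fin.injective⇒≤ {f = idx} idx-inj) (Fin.injective⇒≤ {f = val} val-inj))
        (length-filter-enum a l P?)
  where
  xs = filter P? (enum a l)
  mem : ∀ i → to i ∈ xs
  mem i = ∈.∈-filter⁺ P? (enum-complete (to i)) (sound i)
  idx : Fin N → Fin (length xs)
  idx i = index (mem i)
  idx-inj : ∀ {i j} → idx i ≡ idx j → i ≡ j
  idx-inj {i} {j} e = to-inj (trans (lookup-index (mem i))
    (trans (cong (lookup xs) e) (sym (lookup-index (mem j)))))
  P-lookup : ∀ i → P (lookup xs i)
  P-lookup i = proj₂ (∈.∈-filter⁻ P? {xs = enum a l} (∈.∈-lookup {xs = xs} i))
  val : Fin (length xs) → Fin N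
  val i = from (lookup xs i) (P-lookup i)
  val-inj : ∀ {i j} → val i ≡ val j → i ≡ j
  val-inj {i} {j} e = lookup-injective (Unique.filter⁺ P? (enum-unique a l)) i j
    (from-inj {lookup xs i} {lookup xs j} (P-lookup i) (P-lookup j) e)

-- Convolutions and decompositions of paths

private
  conv-+ : ∀ a a′ b n → conv (λ i → a i + a′ i) b n ≡ conv a b n + conv a′ b n
  conv-+ a a′ b zero = ℕ.*-distribʳ-+ (b 0) (a 0) (a′ 0)
  conv-+ a a′ b (suc n) = trans
    (cong₂ _+_ (ℕ.*-distribʳ-+ (b (suc n)) (a 0) (a′ 0)) (conv-+ (a ∘ suc) (a′ ∘ suc) b n))
    (lemma (a 0 * b (suc n)) (a′ 0 * b (suc n)) _ _)
    where
    lemma : ∀ w x y z → (w + x) + (y + z) ≡ (w + y) + (x + z)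
    lemma = ℕR.solve-∀

  conv-0 : ∀ a b n → (∀ i → a i ≡ 0) → conv a b n ≡ 0
  conv-0 a b zero e = cong (_* b 0) (e 0)
  conv-0 a b (suc n) e = cong₂ _+_ (cong (_* b (suc n)) (e 0)) (conv-0 (a ∘ suc) b n (e ∘ suc))

conv-suc : ∀ a b n → conv a b (suc n) ≡ conv a (b ∘ suc) n + a (suc n) * b 0
conv-suc a b zero = refl
conv-suc a b (suc n) = trans (cong (λ z → a 0 * b (2 + n) + z) (conv-suc (a ∘ suc) b n))
  (sym (ℕ.+-assoc (a 0 * b (2 + n)) (conv (a ∘ suc) (b ∘ suc) n) _))

raise : ∀ {a b} → Step a b → Step (suc a) (suc b)
raise up = up
raise down = down
raise lo = lo
raise hi = hi

-- Only the initial height is lifted: the first step keeps its target and its `top`.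
cap : ∀ {l} → Path 0 (suc l) → Path 1 (suc l)
cap (up ∷ₚ p) = hi ∷ₚ p
cap (lo ∷ₚ p) = down ∷ₚ p

-- The excursions starting with `up` are the paths `up ∷ₚ glue p q`: after the
-- first step the path runs along p, raised by one, until it takes a step `hi`
-- or `down` at height 1.

glue : ∀ {a l m} → Path a l → Path 0 (suc m) → Path (suc a) (l + suc m)
glue [] q = cap q
glue (s ∷ₚ p) q = raise s ∷ₚ glue p q

infixr 5 _++ₚ_
_++ₚ_ : ∀ {a l m} → Path a l → Path 0 m → Path a (l + m)
[] ++ₚ q = q
(s ∷ₚ p) ++ₚ q = s ∷ₚ (p ++ₚ q)

totals : ∀ a → Weight a → ℕ → ℕ
totals a f l = total a l f

-- The second argument of `glue` has at least one step, hence the coefficient 0 at index 0.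
totals⁺ : Weight 0 → ℕ → ℕ
totals⁺ h zero = 0
totals⁺ h (suc l) = total 0 (suc l) h

-- The decomposition is unique. At `b` = 0 the steps `up` and `lo` prolong the raised part, while
-- `down` and `hi` end it and are the two possible first steps of `cap q`; at larger `b` all four
-- steps prolong it.
total-glue : ∀ b l (f : Weight (suc b)) (g : Weight b) (h : Weight 0) →
  (∀ {i j} (p : Path b i) (q : Path 0 (suc j)) → f (glue p q) ≡ g p * h q) →
  total (suc b) l f ≡ conv (totals b g) (totals⁺ h) l
total-glue b zero f g h e = sym (ℕ.*-zeroʳ (totals b g 0))
total-glue zero (suc l) f g h e = begin
  (total 2 l (f ∘ (up ∷ₚ_)) + total 1 l (f ∘ (lo ∷ₚ_))) +
    (total 0 l (f ∘ (down ∷ₚ_)) + total 1 l (f ∘ (hi ∷ₚ_)))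
    ≡⟨ cong₂ _+_ (cong₂ _+_
        (total-glue 1 l (f ∘ (up ∷ₚ_)) (g ∘ (up ∷ₚ_)) h (λ p q → e (up ∷ₚ p) q))
        (total-glue 0 l (f ∘ (lo ∷ₚ_)) (g ∘ (lo ∷ₚ_)) h (λ p q → e (lo ∷ₚ p) q)))
        (cong₂ _+_
          (trans (total-cong 0 l (λ p → e [] (lo ∷ₚ p))) (total-scale 0 l (g []) _))
          (trans (total-cong 1 l (λ p → e [] (up ∷ₚ p))) (total-scale 1 l (g []) _))) ⟩
  (conv (totals 1 (g ∘ (up ∷ₚ_))) (totals⁺ h) l + conv (totals 0 (g ∘ (lo ∷ₚ_))) (totals⁺ h) l) +
    (g [] * total 0 l (h ∘ (lo ∷ₚ_)) + g [] * total 1 l (h ∘ (up ∷ₚ_)))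
    ≡⟨ cong (λ z → z + (g [] * total 0 l (h ∘ (lo ∷ₚ_)) + g [] * total 1 l (h ∘ (up ∷ₚ_)))) (sym (conv-+ (totals 1 (g ∘ (up ∷ₚ_))) (totals 0 (g ∘ (lo ∷ₚ_))) (totals⁺ h) l)) ⟩
  conv (totals 0 g ∘ suc) (totals⁺ h) l +
    (g [] * total 0 l (h ∘ (lo ∷ₚ_)) + g [] * total 1 l (h ∘ (up ∷ₚ_)))
    ≡⟨ lemma (conv (totals 0 g ∘ suc) (totals⁺ h) l) (g []) _ _ ⟩
  g [] * (total 1 l (h ∘ (up ∷ₚ_)) + total 0 l (h ∘ (lo ∷ₚ_))) + conv (totals 0 g ∘ suc) (totals⁺ h) l ∎
  where
  open ≡-Reasoning
  lemma : ∀ c g x y → c + (g * x + g * y) ≡ g * (y + x) + c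
  lemma = ℕR.solve-∀
total-glue (suc b) (suc l) f g h e = begin
  (total (3 + b) l (f ∘ (up ∷ₚ_)) + total (2 + b) l (f ∘ (lo ∷ₚ_))) +
    (total (suc b) l (f ∘ (down ∷ₚ_)) + total (2 + b) l (f ∘ (hi ∷ₚ_)))
    ≡⟨ cong₂ _+_ (cong₂ _+_
        (total-glue (2 + b) l (f ∘ (up ∷ₚ_)) (g ∘ (up ∷ₚ_)) h (λ p q → e (up ∷ₚ p) q))
        (total-glue (suc b) l (f ∘ (lo ∷ₚ_)) (g ∘ (lo ∷ₚ_)) h (λ p q → e (lo ∷ₚ p) q)))
        (cong₂ _+_
        (total-glue b l (f ∘ (down ∷ₚ_)) (g ∘ (down ∷ₚ_)) h (λ p q → e (down ∷ₚ p) q))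
        (total-glue (suc b) l (f ∘ (hi ∷ₚ_)) (g ∘ (hi ∷ₚ_)) h (λ p q → e (hi ∷ₚ p) q))) ⟩
  (conv U H l + conv L H l) + (conv D H l + conv I H l)
    ≡⟨ cong₂ _+_ (conv-+ U L H l) (conv-+ D I H l) ⟨
  conv (λ i → U i + L i) H l + conv (λ i → D i + I i) H l
    ≡⟨ conv-+ (λ i → U i + L i) (λ i → D i + I i) H l ⟨
  conv (totals (suc b) g ∘ suc) H l ∎
  where
  open ≡-Reasoning
  H = totals⁺ h
  U = totals (2 + b) (g ∘ (up ∷ₚ_))
  L = totals (suc b) (g ∘ (lo ∷ₚ_))
  D = totals b (g ∘ (down ∷ₚ_))
  I = totals (suc b) (g ∘ (hi ∷ₚ_))

Positive : ∀ {a l} → Path a l → Set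
Positive [] = ⊤
Positive {a} (s ∷ₚ p) = 1 ≤ a × Positive p

-- Every path from a positive height splits uniquely at its first arrival at 0. The weight `e`
-- vanishes on paths that are not positive, so it may be summed over all paths.
total-++ₚ : ∀ a l (f : Weight (suc a)) (e : Weight (suc a)) (h : Weight 0) →
  (∀ {i j} (p : Path (suc a) i) (q : Path 0 j) → Positive p → f (p ++ₚ q) ≡ e p * h q) →
  (∀ {i} (p : Path (suc a) i) → ¬ Positive p → e p ≡ 0) →
  total (suc a) l f ≡ conv (totals (suc a) e) (totals 0 h) l
total-++ₚ a zero f e h split vanish = refl
total-++ₚ a (suc l) f e h split vanish = begin
  (total (2 + a) l (f ∘ (up ∷ₚ_)) + total (suc a) l (f ∘ (lo ∷ₚ_))) +
    (total a l (f ∘ (down ∷ₚ_)) + total (suc a) l (f ∘ (hi ∷ₚ_)))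
    ≡⟨ cong₂ _+_ (cong₂ _+_
        (total-++ₚ (suc a) l (f ∘ (up ∷ₚ_)) (e ∘ (up ∷ₚ_)) h (split⁺ up) (vanish⁺ up))
        (total-++ₚ a l (f ∘ (lo ∷ₚ_)) (e ∘ (lo ∷ₚ_)) h (split⁺ lo) (vanish⁺ lo)))
        (cong₂ _+_ (descend a f e split vanish)
        (total-++ₚ a l (f ∘ (hi ∷ₚ_)) (e ∘ (hi ∷ₚ_)) h (split⁺ hi) (vanish⁺ hi))) ⟩
  (conv U H l + conv L H l) + (conv D H l + conv I H l)
    ≡⟨ cong₂ _+_ (conv-+ U L H l) (conv-+ D I H l) ⟨
  conv (λ i → U i + L i) H l + conv (λ i → D i + I i) H l
    ≡⟨ conv-+ (λ i → U i + L i) (λ i → D i + I i) H l ⟨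
  conv (totals (suc a) e ∘ suc) H l ∎
  where
  open ≡-Reasoning
  H = totals 0 h
  U = totals (2 + a) (e ∘ (up ∷ₚ_))
  L = totals (suc a) (e ∘ (lo ∷ₚ_))
  D = totals a (e ∘ (down ∷ₚ_))
  I = totals (suc a) (e ∘ (hi ∷ₚ_))
  split⁺ : ∀ {b} (s : Step (suc a) b) {i j} (p : Path b i) (q : Path 0 j) → Positive p →
    f (s ∷ₚ (p ++ₚ q)) ≡ e (s ∷ₚ p) * h q
  split⁺ s p q pos = split (s ∷ₚ p) q (s≤s z≤n , pos)
  vanish⁺ : ∀ {b} (s : Step (suc a) b) {i} (p : Path b i) → ¬ Positive p → e (s ∷ₚ p) ≡ 0
  vanish⁺ s p ¬pos = vanish (s ∷ₚ p) (¬pos ∘ proj₂)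
  descend : ∀ a (f : Weight (suc a)) (e : Weight (suc a)) →
    (∀ {i j} (p : Path (suc a) i) (q : Path 0 j) → Positive p → f (p ++ₚ q) ≡ e p * h q) →
    (∀ {i} (p : Path (suc a) i) → ¬ Positive p → e p ≡ 0) →
    total a l (f ∘ (down ∷ₚ_)) ≡ conv (totals a (e ∘ (down ∷ₚ_))) H l
  descend (suc a) f e split vanish = total-++ₚ a l (f ∘ (down ∷ₚ_)) (e ∘ (down ∷ₚ_)) h
    (λ p q pos → split (down ∷ₚ p) q (s≤s z≤n , pos))
    (λ p ¬pos → vanish (down ∷ₚ p) (¬pos ∘ proj₂))
  -- The positive part ends here, so only its empty continuation carries weight and the convolution
  -- reduces to one term.
  descend zero f e split vanish = trans
    (trans (total-cong 0 l (λ q → split (down ∷ₚ []) q (s≤s z≤n , tt)))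
           (total-scale 0 l (e (down ∷ₚ [])) h))
    (sym (only-empty l))
    where
    later : ∀ i → total 0 (suc i) (e ∘ (down ∷ₚ_)) ≡ 0
    later i = total-0 0 (suc i) {e ∘ (down ∷ₚ_)} λ { (s ∷ₚ p) → vanish (down ∷ₚ s ∷ₚ p) λ { (_ , () , _) } }
    only-empty : ∀ l → conv (totals 0 (e ∘ (down ∷ₚ_))) H l ≡ e (down ∷ₚ []) * H l
    only-empty zero = refl
    only-empty (suc l) = trans (cong (λ z → e (down ∷ₚ []) * H (suc l) + z)
      (conv-0 _ H l later)) (ℕ.+-identityʳ _)

-- Occurrences of a path in a path

≡≤ : ∀ {a b c : ℕ} → a ≡ b → b ≤ c → a ≤ c
≡≤ refl p = p

⟦_⟧ : Bool → ℕ
⟦ false ⟧ = 0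
⟦ true ⟧ = 1

⟦⟧≤1 : ∀ b → ⟦ b ⟧ ≤ 1
⟦⟧≤1 false = z≤n
⟦⟧≤1 true = s≤s z≤n

⟦⟧-injective : ∀ {a b} → ⟦ a ⟧ ≡ ⟦ b ⟧ → a ≡ b
⟦⟧-injective {false} {false} _ = refl
⟦⟧-injective {true} {true} _ = refl

bot top : ∀ {a b} → Step a b → Bool
bot up = false
bot down = true
bot lo = false
bot hi = true
top up = true
top down = false
top lo = false
top hi = true

step-height : ∀ {a b} (s : Step a b) → b + ⟦ bot s ⟧ ≡ a + ⟦ top s ⟧
step-height {a} up = trans (ℕ.+-identityʳ (suc a)) (ℕ.+-comm 1 a)
step-height {suc a} down = trans (ℕ.+-comm a 1) (sym (ℕ.+-identityʳ (suc a)))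
step-height lo = refl
step-height hi = refl

-- A column of height a of q, placed D entries above the bottom of a column of
-- height b of p, has to fit into it.  The offsets D and D′ in adjacent columns
-- are related so that the lower boundaries of q and p have the same relative
-- position on both sides.

Match : ∀ {a b l m} → ℕ → Path a l → Path b m → Set
Match {b = b} D [] p = D ≤ b
Match D (_ ∷ₚ _) [] = ⊥
Match {a} {b} D (t ∷ₚ q) (s ∷ₚ p) =
  D + a ≤ b × ∃[ D′ ] D′ + ⟦ bot s ⟧ ≡ D + ⟦ bot t ⟧ × Match D′ q p

Occurs : ∀ {a b l m} → Path a l → Path b m → Set
Occurs q [] = ∃[ D ] Match D q []
Occurs q (s ∷ₚ p) = (∃[ D ] Match D q (s ∷ₚ p)) ⊎ Occurs q p

Match-bound : ∀ {a b l m} D (q : Path a l) (p : Path b m) → Match D q p → D + a ≤ b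
Match-bound D [] p m = ≡≤ (ℕ.+-identityʳ D) m
Match-bound D (_ ∷ₚ _) (_ ∷ₚ _) (m , _) = m

abstract
  Match? : ∀ {a b l m} D (q : Path a l) (p : Path b m) → Dec (Match D q p)
  Match? {b = b} D [] p = D ℕ.≤? b
  Match? D (_ ∷ₚ _) [] = no λ ()
  Match? {a} {b} D (t ∷ₚ q) (s ∷ₚ p) = (D + a ℕ.≤? b) ×-dec
    map′ (λ (m , e) → D₀ , e , m)
         (λ (D′ , e , m) → subst (λ d → Match d q p) (unique D′ e) m
                         , subst (λ d → d + ⟦ bot s ⟧ ≡ D + ⟦ bot t ⟧) (unique D′ e) e)
         (Match? D₀ q p ×-dec (D₀ + ⟦ bot s ⟧ ℕ.≟ D + ⟦ bot t ⟧))
    where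
    -- A subtraction cut off at 0 does no harm: the equation tested along with the match rejects
    -- such a candidate.
    D₀ : ℕ
    D₀ = (D + ⟦ bot t ⟧) ∸ ⟦ bot s ⟧
    unique : ∀ D′ → D′ + ⟦ bot s ⟧ ≡ D + ⟦ bot t ⟧ → D′ ≡ D₀
    unique D′ e = trans (sym (ℕ.m+n∸n≡m D′ ⟦ bot s ⟧)) (cong (_∸ ⟦ bot s ⟧) e)

  ∃Match? : ∀ {a b l m} (q : Path a l) (p : Path b m) → Dec (∃[ D ] Match D q p)
  ∃Match? {a} {b} q p = map′ (λ (D , _ , m) → D , m)
    (λ (D , m) → D , s≤s (ℕ.≤-trans (ℕ.m≤m+n D a) (Match-bound D q p m)) , m)
    (ℕ.anyUpTo? (λ D → Match? D q p) (suc b))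

  Occurs? : ∀ {a b l m} (q : Path a l) (p : Path b m) → Dec (Occurs q p)
  Occurs? q [] = ∃Match? q []
  Occurs? q (s ∷ₚ p) = ∃Match? q (s ∷ₚ p) ⊎-dec Occurs? q p

Positive? : ∀ {a l} (p : Path a l) → Dec (Positive p)
Positive? [] = yes tt
Positive? {a} (s ∷ₚ p) = (1 ℕ.≤? a) ×-dec Positive? p

-- The empty column before an initial `up` takes its offset from the next column. It stays within
-- height `b` because the next column already has room for an entry.
Match-up : ∀ {b c l m} (q : Path 1 (suc l)) (s : Step b c) (p : Path c m) →
  (∃[ D ] Match D q p) → ∃[ D ] Match D (up ∷ₚ q) (s ∷ₚ p)
Match-up {b} {c} q s p (D , m) = D + ⟦ bot s ⟧ , ℕ.+-cancelʳ-≤ 1 _ _ fits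
  , D , sym (ℕ.+-identityʳ _) , m
  where
  fits : (D + ⟦ bot s ⟧ + 0) + 1 ≤ b + 1
  fits = begin
    (D + ⟦ bot s ⟧ + 0) + 1 ≡⟨ lemma D ⟦ bot s ⟧ ⟩
    (D + 1) + ⟦ bot s ⟧ ≤⟨ ℕ.+-monoˡ-≤ ⟦ bot s ⟧ (Match-bound D q p m) ⟩
    c + ⟦ bot s ⟧ ≡⟨ step-height s ⟩
    b + ⟦ top s ⟧ ≤⟨ ℕ.+-monoʳ-≤ b (⟦⟧≤1 (top s)) ⟩
    b + 1 ∎
    where
    open ℕ.≤-Reasoning
    lemma : ∀ d t → (d + t + 0) + 1 ≡ (d + 1) + t
    lemma = ℕR.solve-∀

Occurs-up : ∀ {b c l m} (q : Path 1 (suc l)) (s : Step b c) (p : Path c m) →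
  Occurs (up ∷ₚ q) (s ∷ₚ p) ⇔ Occurs q p
Occurs-up q s p = mk⇔ (fwd s p) (bwd s p)
  where
  fwd : ∀ {b c m} (s : Step b c) (p : Path c m) → Occurs (up ∷ₚ q) (s ∷ₚ p) → Occurs q p
  fwd s [] (inj₁ (_ , _ , D′ , _ , m)) = D′ , m
  fwd s (_ ∷ₚ _) (inj₁ (_ , _ , D′ , _ , m)) = inj₁ (D′ , m)
  fwd s (t ∷ₚ p) (inj₂ o) = inj₂ (fwd t p o)
  bwd : ∀ {b c m} (s : Step b c) (p : Path c m) → Occurs q p → Occurs (up ∷ₚ q) (s ∷ₚ p)
  bwd s [] o = inj₁ (Match-up q s [] o)
  bwd s (t ∷ₚ p) (inj₁ o) = inj₁ (Match-up q s (t ∷ₚ p) o)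
  bwd s (t ∷ₚ p) (inj₂ o) = inj₂ (bwd t p o)

bot-raise : ∀ {a b} (s : Step a b) → bot (raise s) ≡ bot s
bot-raise up = refl
bot-raise down = refl
bot-raise lo = refl
bot-raise hi = refl

-- Dually to `Match-up`, the empty column after the final `down` imposes nothing once the last entry
-- fits.
Match-final : ∀ {b c m} D (s : Step b c) (p : Path c m) → suc D ≤ b →
  Match D (down {0} ∷ₚ []) (s ∷ₚ p)
Match-final {c = c} D up p d = ≡≤ (ℕ.+-comm D 1) d , suc D
  , trans (ℕ.+-identityʳ _) (ℕ.+-comm 1 D) , ℕ.≤-trans d (ℕ.n≤1+n _)
Match-final D down p (s≤s d) = ≡≤ (ℕ.+-comm D 1) (s≤s d) , D , refl , d
Match-final D lo p d = ≡≤ (ℕ.+-comm D 1) d , suc D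
  , trans (ℕ.+-identityʳ _) (ℕ.+-comm 1 D) , d
Match-final D hi p d = ≡≤ (ℕ.+-comm D 1) d , D , refl , ℕ.≤-trans (ℕ.n≤1+n D) d

raised : ∀ {a l} → Path a l → Path (suc a) (l + 1)
raised q = glue q (lo ∷ₚ [])

module _ where
  private
    final : ∀ {b l m} D (p : Path b l) (r : Path 0 (suc m)) → D ≤ b →
      Match D (down {0} ∷ₚ []) (glue p r)
    final D [] (up ∷ₚ r) d = Match-final D hi r (s≤s d)
    final D [] (lo ∷ₚ r) d = Match-final D down r (s≤s d)
    final D (s ∷ₚ p) r d = Match-final D (raise s) (glue p r) (s≤s d)

    unfinal : ∀ {b l m} D (p : Path b l) (r : Path 0 (suc m)) →
      Match D (down {0} ∷ₚ []) (glue p r) → D ≤ b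
    unfinal D p r m = s≤s⁻¹ (≡≤ (ℕ.+-comm 1 D) (Match-bound D (down ∷ₚ []) (glue p r) m))

    too-low : ∀ {a l m} D (q : Path (suc a) l) (r : Path 0 (suc m)) → ¬ Match D (raised q) (cap r)
    too-low D q r m = contradiction
      (ℕ.≤-trans (ℕ.m≤n+m _ D) (Match-bound D (raised q) (cap r) m)) λ { (s≤s ()) }

    shift : ∀ D {a b} → D + suc a ≤ suc b → D + a ≤ b
    shift D {a} {b} d = s≤s⁻¹ (subst (_≤ suc b) (ℕ.+-suc D a) d)

    unshift : ∀ D {a b} → D + a ≤ b → D + suc a ≤ suc b
    unshift D {a} {b} d = subst (_≤ suc b) (sym (ℕ.+-suc D a)) (s≤s d)

  -- Raising both paths adds one to both sides of every comparison of heights and leaves `bot`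
  -- alone. The match cannot run on beyond `p`: there the larger path has come down to height 1,
  -- while before its final `down` the raised pattern has height at least 2.
  Match-raised : ∀ {a b l n m} D (q : Path a l) → Positive q → (p : Path b n) (r : Path 0 (suc m)) →
    Match D (raised q) (glue p r) ⇔ Match D q p
  Match-raised D [] _ p r = mk⇔ (unfinal D p r) (final D p r)
  Match-raised {suc a} D q@(_ ∷ₚ _) _ [] r = mk⇔ (too-low D q r) λ ()
  Match-raised {suc a} {b} D (t ∷ₚ q) (_ , pos) (s ∷ₚ p) r = mk⇔
    (λ (d , D′ , e , m) → shift D d , D′
      , subst₂ (λ x y → D′ + ⟦ x ⟧ ≡ D + ⟦ y ⟧) (bot-raise s) (bot-raise t) e
      , to (Match-raised D′ q pos p r) m)
    (λ (d , D′ , e , m) → unshift D d , D′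
      , subst₂ (λ x y → D′ + ⟦ x ⟧ ≡ D + ⟦ y ⟧) (sym (bot-raise s)) (sym (bot-raise t)) e
      , from (Match-raised D′ q pos p r) m)

  -- Inside, the raised pattern has height at least 2, which the columns of height at most 1 at the
  -- joint do not allow. An occurrence lies before the joint, where `Match-raised` removes the lift,
  -- or after it.
  Occurs-glue : ∀ {b c l n m} (q : Path 1 l) → Positive q → (p : Path b n) (t : Step 0 c) (r : Path c m) →
    Occurs (raised (up ∷ₚ q)) (glue p (t ∷ₚ r)) ⇔
    (Occurs (up ∷ₚ q) p ⊎ Occurs (raised (up ∷ₚ q)) r)
  Occurs-glue q pos [] up r = mk⇔
    (λ { (inj₁ (_ , _ , D , _ , m)) → contradiction
           (ℕ.≤-trans (ℕ.m≤n+m _ D) (Match-bound D (raised q) r m)) λ { (s≤s ()) }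
       ; (inj₂ o) → inj₂ o })
    (λ { (inj₂ o) → inj₂ o })
  Occurs-glue q pos [] lo r = mk⇔
    (λ { (inj₁ (_ , _ , D , _ , m)) → contradiction
           (ℕ.≤-trans (ℕ.m≤n+m _ D) (Match-bound D (raised q) r m)) λ ()
       ; (inj₂ o) → inj₂ o })
    (λ { (inj₂ o) → inj₂ o })
  Occurs-glue q pos (s ∷ₚ p) t r = mk⇔
    (λ { (inj₁ (D , d , D′ , e , m)) → inj₁ (inj₁ (D , shift D d , D′
           , subst (λ x → D′ + ⟦ x ⟧ ≡ D + 0) (bot-raise s) e
           , to (Match-raised D′ q pos p (t ∷ₚ r)) m))
       ; (inj₂ o) → case to (Occurs-glue q pos p t r) o of λ
           { (inj₁ o′) → inj₁ (inj₂ o′) ; (inj₂ o′) → inj₂ o′ } })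
    (λ { (inj₁ (inj₁ (D , d , D′ , e , m))) → inj₁ (D , unshift D d , D′
           , subst (λ x → D′ + ⟦ x ⟧ ≡ D + 0) (sym (bot-raise s)) e
           , from (Match-raised D′ q pos p (t ∷ₚ r)) m)
       ; (inj₁ (inj₂ o)) → inj₂ (from (Occurs-glue q pos p t r) (inj₁ o))
       ; (inj₂ o) → inj₂ (from (Occurs-glue q pos p t r) (inj₂ o)) })

Match-++ₚ : ∀ {a b l n m} D (q : Path a l) → Positive q → (p : Path b n) (r : Path 0 m) →
  Match D q (p ++ₚ r) ⇔ Match D q p
Match-++ₚ D [] _ p r = mk⇔ (λ d → d) (λ d → d)
Match-++ₚ {suc a} D q@(_ ∷ₚ _) _ [] r = mk⇔
  (λ m → contradiction (ℕ.≤-trans (ℕ.m≤n+m (suc a) D) (Match-bound D q r m)) λ ()) (λ ())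
Match-++ₚ D (t ∷ₚ q) (_ , pos) (s ∷ₚ p) r = mk⇔
  (λ (d , D′ , e , m) → d , D′ , e , to (Match-++ₚ D′ q pos p r) m)
  (λ (d , D′ , e , m) → d , D′ , e , from (Match-++ₚ D′ q pos p r) m)

-- A positive pattern cannot cross a column of height 0.
Occurs-++ₚ : ∀ {b l n m} (q : Path 1 l) → Positive q → (p : Path b n) (r : Path 0 m) →
  Occurs (up ∷ₚ q) (p ++ₚ r) ⇔ (Occurs (up ∷ₚ q) p ⊎ Occurs (up ∷ₚ q) r)
Occurs-++ₚ q pos [] r = mk⇔ inj₂ [ (λ ()) , (λ o → o) ]′
Occurs-++ₚ q pos (s ∷ₚ p) r = mk⇔
  (λ { (inj₁ (D , d , D′ , e , m)) → inj₁ (inj₁ (D , d , D′ , e , to (Match-++ₚ D′ q pos p r) m))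
     ; (inj₂ o) → case to (Occurs-++ₚ q pos p r) o of λ
         { (inj₁ o′) → inj₁ (inj₂ o′) ; (inj₂ o′) → inj₂ o′ } })
  (λ { (inj₁ (inj₁ (D , d , D′ , e , m))) → inj₁ (D , d , D′ , e , from (Match-++ₚ D′ q pos p r) m)
     ; (inj₁ (inj₂ o)) → inj₂ (from (Occurs-++ₚ q pos p r) (inj₁ o))
     ; (inj₂ o) → inj₂ (from (Occurs-++ₚ q pos p r) (inj₂ o)) })

-- Recurrences for the numbers of avoiding paths

ConnectedPath : ∀ {n} → Path 0 (suc n) → Set
ConnectedPath {n} (_ ∷ₚ p) = 1 ≤ n × Positive p

ConnectedPath? : ∀ {n} (p : Path 0 (suc n)) → Dec (ConnectedPath p)
ConnectedPath? {n} (_ ∷ₚ p) = (1 ℕ.≤? n) ×-dec Positive? p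

χ-¬⊎ : ∀ {A B C : Set} (x : Dec C) (a : Dec A) (b : Dec B) → C ⇔ (A ⊎ B) →
  χ (¬? x) ≡ χ (¬? a) * χ (¬? b)
χ-¬⊎ (yes c) (yes a) b e = refl
χ-¬⊎ (yes c) (no ¬a) (yes b) e = refl
χ-¬⊎ (yes c) (no ¬a) (no ¬b) e = contradiction (to e c) [ ¬a , ¬b ]′
χ-¬⊎ (no ¬c) (yes a) b e = contradiction (from e (inj₁ a)) ¬c
χ-¬⊎ (no ¬c) (no ¬a) (yes b) e = contradiction (from e (inj₂ b)) ¬c
χ-¬⊎ (no ¬c) (no ¬a) (no ¬b) e = refl

χ-no : ∀ {A : Set} (x : Dec A) → ¬ A → χ x ≡ 0
χ-no (yes a) ¬a = contradiction a ¬a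
χ-no (no _) _ = refl

χ-yes : ∀ {A : Set} (x : Dec A) → A → χ x ≡ 1
χ-yes (yes _) _ = refl
χ-yes (no ¬a) a = contradiction a ¬a

avoiding : ∀ {a k} → Path a k → Weight 0
avoiding q p = χ (¬? (Occurs? q p))

module AvoidingCounts {k} (q : Path 1 (suc k)) (pos : Positive q) (G Gc F : ℕ → ℕ)
  (G-total : ∀ n → G n ≡ total 0 (suc n) (avoiding (up ∷ₚ q)))
  (Gc-total : ∀ n → Gc n ≡ total 0 (suc n)
    (λ p → χ (¬? (Occurs? (up ∷ₚ q) p) ×-dec ConnectedPath? p)))
  (F-total : ∀ n → F n ≡ total 0 (suc n) (avoiding (up ∷ₚ raised (up ∷ₚ q))))
  (G0 : G 0 ≡ 1) (F0 : F 0 ≡ 1) (Gc0 : Gc 0 ≡ 0)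
  where

  private
    g h : Weight 0
    g = avoiding (up ∷ₚ q)
    h = avoiding (up ∷ₚ raised (up ∷ₚ q))

    e : Weight 1
    e p = χ (¬? (Occurs? (up ∷ₚ q) (up ∷ₚ p)) ×-dec Positive? p)

    g[] : g [] ≡ 1
    g[] = χ-yes (¬? (Occurs? (up ∷ₚ q) [])) λ ()

    h-glue : ∀ {i j} (p : Path 0 i) (r : Path 0 (suc j)) → h (up ∷ₚ glue p r) ≡ g p * h r
    h-glue p r@(t ∷ₚ r′) = χ-¬⊎ (Occurs? (up ∷ₚ raised (up ∷ₚ q)) (up ∷ₚ glue p r)) (Occurs? (up ∷ₚ q) p)
        (Occurs? (up ∷ₚ raised (up ∷ₚ q)) r) (mk⇔
      (λ o → case to (Occurs-glue q pos p t r′) (to (Occurs-up _ up (glue p r)) o) of λ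
        { (inj₁ o′) → inj₁ o′ ; (inj₂ o′) → inj₂ (from (Occurs-up _ t r′) o′) })
      (λ o → from (Occurs-up _ up (glue p r)) (from (Occurs-glue q pos p t r′)
        ([ inj₁ , (λ o′ → inj₂ (to (Occurs-up _ t r′) o′)) ]′ o))))

    g-++ₚ : ∀ {i j} (p : Path 1 i) (r : Path 0 j) → Positive p → g (up ∷ₚ (p ++ₚ r)) ≡ e p * g r
    g-++ₚ p r pos-p = trans (χ-¬⊎ (Occurs? (up ∷ₚ q) (up ∷ₚ (p ++ₚ r))) (Occurs? (up ∷ₚ q) (up ∷ₚ p)) (Occurs? (up ∷ₚ q) r) (Occurs-++ₚ q pos (up ∷ₚ p) r))
      (cong (_* g r) (χ-cong (¬? (Occurs? (up ∷ₚ q) (up ∷ₚ p))) (¬? (Occurs? (up ∷ₚ q) (up ∷ₚ p)) ×-dec Positive? p)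
        (λ o → o , pos-p) proj₁))

    conv-congˡ : ∀ {a a′ b} n → (∀ i → a i ≡ a′ i) → conv a b n ≡ conv a′ b n
    conv-congˡ zero p = cong (_* _) (p 0)
    conv-congˡ (suc n) p = cong₂ _+_ (cong (_* _) (p 0)) (conv-congˡ n (p ∘ suc))

    conv-congʳ : ∀ {a b b′} n → (∀ i → b i ≡ b′ i) → conv a b n ≡ conv a b′ n
    conv-congʳ {a} zero p = cong (a 0 *_) (p 0)
    conv-congʳ {a} (suc n) p = cong₂ _+_ (cong (a 0 *_) (p (suc n))) (conv-congʳ n p)

    -- The first summand is the case of an empty raised part, whose weight `g []` is 1; the last one
    -- comes from an initial `lo`. Together they are the origin of the term 2x in the denominator.
    F-step : ∀ n → F (suc n) ≡ (1 * totals⁺ h (suc n) + conv G (totals⁺ h) n) + F n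
    F-step n = trans (F-total (suc n)) (cong₂ _+_
      (trans (total-glue 0 (suc n) (h ∘ (up ∷ₚ_)) g h h-glue)
        (cong₂ _+_ (cong (_* totals⁺ h (suc n)) g[]) (conv-congˡ n (λ i → sym (G-total i)))))
      (trans (total-cong 0 (suc n) h-lo) (sym (F-total n))))
      where
      h-lo : ∀ {l} (p : Path 0 (suc l)) → h (lo ∷ₚ p) ≡ h p
      h-lo (s ∷ₚ p) = χ-cong (¬? (Occurs? (up ∷ₚ raised (up ∷ₚ q)) (lo ∷ₚ s ∷ₚ p)))
        (¬? (Occurs? (up ∷ₚ raised (up ∷ₚ q)) (s ∷ₚ p)))
        (λ ¬o o → ¬o (inj₂ o))
        (λ ¬o o → case to (Occurs-up _ lo (s ∷ₚ p)) o of λ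
          { (inj₁ (D , m)) → contradiction (ℕ.≤-trans (ℕ.m≤n+m 1 D) (Match-bound D (raised (up ∷ₚ q)) (s ∷ₚ p) m)) λ ()
          ; (inj₂ o′) → ¬o (from (Occurs-up _ s p) o′) })

    -- A connected path of `n` + 1 steps consists of `up` and a positive path of `n` steps from
    -- height 1. For `n` = 0 there is no such path, in accordance with `Gc0`.
    Gc-e : ∀ n → total 1 n e ≡ Gc n
    Gc-e zero = sym Gc0
    Gc-e (suc n) = sym (trans (Gc-total (suc n)) (trans (cong₂ _+_
      (total-cong 1 (suc n) {g = e} (λ p → χ-cong (¬? (Occurs? (up ∷ₚ q) (up ∷ₚ p)) ×-dec ConnectedPath? (up ∷ₚ p))
          (¬? (Occurs? (up ∷ₚ q) (up ∷ₚ p)) ×-dec Positive? p)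
        (λ (o , _ , c) → o , c) (λ (o , c) → o , s≤s z≤n , c)))
      (total-0 0 (suc n) {λ p → χ (¬? (Occurs? (up ∷ₚ q) (lo ∷ₚ p)) ×-dec ConnectedPath? (lo ∷ₚ p))} (λ { (s ∷ₚ p) → χ-no (¬? (Occurs? (up ∷ₚ q) (lo ∷ₚ s ∷ₚ p)) ×-dec ConnectedPath? (lo ∷ₚ s ∷ₚ p)) λ { (_ , _ , () , _) } })))
      (ℕ.+-identityʳ _)))

    G-step : ∀ n → G (suc n) ≡ conv Gc (totals 0 g) (suc n) + G n
    G-step n = trans (G-total (suc n)) (cong₂ _+_
      (trans (total-++ₚ 0 (suc n) (g ∘ (up ∷ₚ_)) e g g-++ₚ
          (λ p ¬pos → χ-no (¬? (Occurs? (up ∷ₚ q) (up ∷ₚ p)) ×-dec Positive? p) (¬pos ∘ proj₂)))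
        (conv-congˡ (suc n) Gc-e))
      (trans (total-cong 0 (suc n) g-lo) (sym (G-total n))))
      where
      g-lo : ∀ {l} (p : Path 0 (suc l)) → g (lo ∷ₚ p) ≡ g p
      g-lo (s ∷ₚ p) = χ-cong (¬? (Occurs? (up ∷ₚ q) (lo ∷ₚ s ∷ₚ p))) (¬? (Occurs? (up ∷ₚ q) (s ∷ₚ p)))
        (λ ¬o o → ¬o (inj₂ o))
        (λ ¬o → λ { (inj₁ (D , d , D′ , _ , m)) → contradiction
                       (ℕ.≤-trans (ℕ.m≤n+m 1 D′) (Match-bound D′ q (s ∷ₚ p) m)) λ ()
                  ; (inj₂ o) → ¬o o })

  F-rec : ∀ n → F (2 + n) ≡ F (1 + n) + F (1 + n) + conv G F n
  F-rec n = begin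
    F (2 + n) ≡⟨ F-step (suc n) ⟩
    (1 * totals⁺ h (2 + n) + conv G (totals⁺ h) (suc n)) + F (1 + n)
      ≡⟨ cong₂ (λ x y → (1 * x + y) + F (1 + n)) (sym (F-total (suc n)))
           (trans (conv-suc G (totals⁺ h) n)
             (cong₂ _+_ (conv-congʳ n (λ i → sym (F-total i))) (ℕ.*-zeroʳ (G (suc n))))) ⟩
    (1 * F (1 + n) + (conv G F n + 0)) + F (1 + n)
      ≡⟨ lemma (F (1 + n)) (conv G F n) ⟩
    F (1 + n) + F (1 + n) + conv G F n ∎
    where
    open ≡-Reasoning
    lemma : ∀ a b → (1 * a + (b + 0)) + a ≡ a + a + b
    lemma = ℕR.solve-∀

  F-1 : F 1 ≡ 2
  F-1 = begin
    F 1 ≡⟨ F-step 0 ⟩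
    (1 * totals⁺ h 1 + G 0 * 0) + F 0
      ≡⟨ cong₂ (λ x y → (1 * x + y) + F 0) (trans (sym (F-total 0)) F0) (ℕ.*-zeroʳ (G 0)) ⟩
    1 + F 0 ≡⟨ cong suc F0 ⟩
    2 ∎
    where open ≡-Reasoning

  private
    G-conv : ∀ n → G (suc n) ≡ G n + Gc (suc n) + conv Gc G n
    G-conv n = begin
      G (suc n) ≡⟨ G-step n ⟩
      conv Gc (totals 0 g) (suc n) + G n
        ≡⟨ cong (_+ G n) (trans (conv-suc Gc (totals 0 g) n)
             (cong₂ _+_ (conv-congʳ n (λ i → sym (G-total i))) (cong (Gc (suc n) *_) g[]))) ⟩
      (conv Gc G n + Gc (suc n) * 1) + G n
        ≡⟨ lemma (conv Gc G n) (Gc (suc n)) (G n) ⟩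
      G n + Gc (suc n) + conv Gc G n ∎
      where
      open ≡-Reasoning
      lemma : ∀ a b c → (a + b * 1) + c ≡ c + b + a
      lemma = ℕR.solve-∀

  G-1 : G 1 ≡ G 0 + Gc 1
  G-1 = trans (G-conv 0) (trans (cong (λ z → G 0 + Gc 1 + z * G 0) Gc0) (ℕ.+-identityʳ _))

  relations :
    (gf F ≐ C 1ℤ -ₛ X -ₛ X *ₛ gf Gc
          ÷ C 1ℤ -ₛ C (+ 3) *ₛ X +ₛ X *ₛ X +ₛ (X *ₛ X -ₛ X) *ₛ gf Gc)
    × (gf F ≐ C 1ℤ
            ÷ C 1ℤ -ₛ C (+ 2) *ₛ X -ₛ X *ₛ X *ₛ gf G)
  relations = rational-relations G Gc F G0 F0 Gc0 F-1 F-rec G-1 (λ n → G-conv (suc n))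

-- Words as sequences of particle hops

-- Letting the generators act on all natural numbers frees the sites from bounds; `n` matters only
-- for which letters exist.
sw : ℕ → ℕ → ℕ
sw zero zero = 1
sw zero (suc zero) = 0
sw zero (suc (suc x)) = suc (suc x)
sw (suc i) zero = zero
sw (suc i) (suc x) = suc (sw i x)

sw-involutive : ∀ i x → sw i (sw i x) ≡ x
sw-involutive zero zero = refl
sw-involutive zero (suc zero) = refl
sw-involutive zero (suc (suc x)) = refl
sw-involutive (suc i) zero = refl
sw-involutive (suc i) (suc x) = cong suc (sw-involutive i x)

sw-left : ∀ i → sw i i ≡ suc i
sw-left zero = refl
sw-left (suc i) = cong suc (sw-left i)

sw-right : ∀ i → sw i (suc i) ≡ i
sw-right zero = refl
sw-right (suc i) = cong suc (sw-right i)

sw-other : ∀ i x → x ≢ i → x ≢ suc i → sw i x ≡ x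
sw-other zero zero p q = contradiction refl p
sw-other zero (suc zero) p q = contradiction refl q
sw-other zero (suc (suc x)) p q = refl
sw-other (suc i) zero p q = refl
sw-other (suc i) (suc x) p q = cong suc (sw-other i x (p ∘ cong suc) (q ∘ cong suc))

data Position (i : ℕ) : ℕ → Set where
  left  : Position i i
  right : Position i (suc i)
  other : ∀ {x} → x ≢ i → x ≢ suc i → Position i x

position : ∀ i x → Position i x
position i x with x ℕ.≟ i
... | yes refl = left
... | no p with x ℕ.≟ suc i
...   | yes refl = right
...   | no q = other p q

toℕ-s : ∀ {n} (i : Fin n) x → toℕ (s i ⟨$⟩ʳ x) ≡ sw (toℕ i) (toℕ x)
toℕ-s i x with x Fin.≟ inject₁ i
... | yes refl = sym (trans (cong (sw (toℕ i)) (Fin.toℕ-inject₁ i)) (sw-left (toℕ i)))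
... | no p with x Fin.≟ suc i
...   | yes refl = trans (Fin.toℕ-inject₁ i) (sym (sw-right (toℕ i)))
...   | no q = sym (sw-other (toℕ i) (toℕ x)
          (λ e → p (Fin.toℕ-injective (trans e (sym (Fin.toℕ-inject₁ i)))))
          (q ∘ Fin.toℕ-injective))

ev : ∀ {n} → Word n → ℕ → ℕ
ev [] x = x
ev (i ∷ w) x = sw (toℕ i) (ev w x)

toℕ-eval : ∀ {n} (w : Word n) x → toℕ (eval w ⟨$⟩ʳ x) ≡ ev w (toℕ x)
toℕ-eval [] x = refl
toℕ-eval (i ∷ w) x = trans (toℕ-s i (eval w ⟨$⟩ʳ x)) (cong (sw (toℕ i)) (toℕ-eval w x))

ev-outside : ∀ {n} (w : Word n) x → n < x → ev w x ≡ x
ev-outside [] x p = refl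
ev-outside {n} (i ∷ w) x p = trans (cong (sw (toℕ i)) (ev-outside w x p))
  (sw-other (toℕ i) x (λ { refl → ℕ.<-asym p (Fin.toℕ<n i) })
    (λ { refl → ℕ.<-irrefl refl (ℕ.<-≤-trans (Fin.toℕ<n i) (s≤s⁻¹ p)) }))

infix 4 _≗ᵉ_
_≗ᵉ_ : ∀ {n} → Word n → Word n → Set
u ≗ᵉ w = ∀ x → ev u x ≡ ev w x

≈⇒≗ᵉ : ∀ {n} {u w : Word n} → eval u ≈ eval w → u ≗ᵉ w
≈⇒≗ᵉ {n} {u} {w} e x with x ℕ.≤? n
... | yes p = trans (cong (ev u) x≡) (trans (sym (toℕ-eval u _))
    (trans (cong toℕ (e (fromℕ< (s≤s p)))) (trans (toℕ-eval w _) (cong (ev w) (sym x≡)))))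
  where x≡ = sym (Fin.toℕ-fromℕ< (s≤s p))
... | no ¬p = trans (ev-outside u x (ℕ.≰⇒> ¬p)) (sym (ev-outside w x (ℕ.≰⇒> ¬p)))

≗ᵉ⇒≈ : ∀ {n} {u w : Word n} → u ≗ᵉ w → eval u ≈ eval w
≗ᵉ⇒≈ {u = u} {w} e x = Fin.toℕ-injective
  (trans (toℕ-eval u x) (trans (e (toℕ x)) (sym (toℕ-eval w x))))

ev⁻¹ : ∀ {n} → Word n → ℕ → ℕ
ev⁻¹ [] x = x
ev⁻¹ (i ∷ w) x = ev⁻¹ w (sw (toℕ i) x)

ev-ev⁻¹ : ∀ {n} (w : Word n) x → ev w (ev⁻¹ w x) ≡ x
ev-ev⁻¹ [] x = refl
ev-ev⁻¹ (i ∷ w) x = trans (cong (sw (toℕ i)) (ev-ev⁻¹ w (sw (toℕ i) x))) (sw-involutive (toℕ i) x)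

ev-injective : ∀ {n} (w : Word n) {x y} → ev w x ≡ ev w y → x ≡ y
ev-injective [] e = e
ev-injective (i ∷ w) {x} {y} e = ev-injective w
  (trans (sym (sw-involutive (toℕ i) _)) (trans (cong (sw (toℕ i)) e) (sw-involutive (toℕ i) _)))

-- The letter s i swaps the sites i and i + 1 and has the label i + 1, so that
-- the site v lies between the columns with labels v and v + 1.

abstract
  hit : ℕ → ℕ → ℕ
  hit c i = ⟦ does (c ℕ.≟ suc i) ⟧

  hit-self : ∀ i → hit (suc i) i ≡ 1
  hit-self i = cong ⟦_⟧ (dec-true (suc i ℕ.≟ suc i) refl)

  hit-other : ∀ {c i} → c ≢ suc i → hit c i ≡ 0
  hit-other {c} {i} p = cong ⟦_⟧ (dec-false (c ℕ.≟ suc i) p)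

cnt : ∀ {n} → ℕ → Word n → ℕ
cnt c [] = 0
cnt c (i ∷ w) = hit c (toℕ i) + cnt c w

cnt-++ : ∀ {n} c (u w : Word n) → cnt c (u ++ w) ≡ cnt c u + cnt c w
cnt-++ c [] w = refl
cnt-++ c (i ∷ u) w = trans (cong (λ z → hit c (toℕ i) + z) (cnt-++ c u w))
  (sym (ℕ.+-assoc (hit c (toℕ i)) (cnt c u) (cnt c w)))

cnt-0 : ∀ {n} (w : Word n) → cnt 0 w ≡ 0
cnt-0 [] = refl
cnt-0 (i ∷ w) = cong₂ _+_ (hit-other λ ()) (cnt-0 w)

cnt-outside : ∀ {n} c (w : Word n) → n < c → cnt c w ≡ 0
cnt-outside c [] p = refl
cnt-outside c (i ∷ w) p = cong₂ _+_
  (hit-other {c} {toℕ i} λ { refl → ℕ.<-irrefl refl (ℕ.<-≤-trans (Fin.toℕ<n i) (s≤s⁻¹ p)) })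
  (cnt-outside c w p)

-- V assigns a particle or a hole to every site.  A word runs on V if, read from
-- left to right, every letter s i moves a particle from the site i + 1 to the
-- hole at the site i.

Config : Set
Config = ℕ → Bool

Run : ∀ {n} → Config → Word n → Set
Run V [] = ⊤
Run V (i ∷ w) = (V (toℕ i) ≡ false × V (suc (toℕ i)) ≡ true) × Run (V ∘ sw (toℕ i)) w

Run-cong : ∀ {n} {V V′} (w : Word n) →
  (∀ v → 0 < cnt v w + cnt (suc v) w → V v ≡ V′ v) → Run V w → Run V′ w
Run-cong [] e r = tt
Run-cong {V = V} {V′} (i ∷ w) e ((p , q) , r) =
    (trans (sym (at-left)) p , trans (sym at-right) q)
  , Run-cong w inner r
  where
  at-left : V (toℕ i) ≡ V′ (toℕ i)
  at-left = e _ (ℕ.<-≤-trans (ℕ.<-≤-trans (s≤s z≤n) (ℕ.≤-reflexive (sym (hit-self (toℕ i)))))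
    (ℕ.≤-trans (ℕ.m≤m+n (hit (suc (toℕ i)) (toℕ i)) (cnt (suc (toℕ i)) w)) (ℕ.m≤n+m _ (cnt (toℕ i) (i ∷ w)))))
  at-right : V (suc (toℕ i)) ≡ V′ (suc (toℕ i))
  at-right = e _ (ℕ.<-≤-trans (ℕ.<-≤-trans (s≤s z≤n) (ℕ.≤-reflexive (sym (hit-self (toℕ i)))))
    (ℕ.≤-trans (ℕ.m≤m+n (hit (suc (toℕ i)) (toℕ i)) (cnt (suc (toℕ i)) w)) (ℕ.m≤m+n _ (cnt (2 + toℕ i) (i ∷ w)))))
  inner : ∀ v → 0 < cnt v w + cnt (suc v) w → V (sw (toℕ i) v) ≡ V′ (sw (toℕ i) v)
  inner v t with position (toℕ i) v
  ... | left = subst (λ x → V x ≡ V′ x) (sym (sw-left (toℕ i))) at-right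
  ... | right = subst (λ x → V x ≡ V′ x) (sym (sw-right (toℕ i))) at-left
  ... | other p q = subst (λ x → V x ≡ V′ x) (sym (sw-other (toℕ i) v p q))
    (e v (ℕ.<-≤-trans t (ℕ.+-mono-≤ (ℕ.m≤n+m _ (hit v (toℕ i))) (ℕ.m≤n+m _ (hit (suc v) (toℕ i))))))

Run-≗ : ∀ {n} {V V′} (w : Word n) → (∀ v → V v ≡ V′ v) → Run V w → Run V′ w
Run-≗ w e = Run-cong w (λ v _ → e v)

Run-++ : ∀ {n} {V} (u w : Word n) → Run V u → Run (V ∘ ev u) w → Run V (u ++ w)
Run-++ [] w r r′ = r′
Run-++ (i ∷ u) w (p , r) r′ = p , Run-++ u w r r′

hop : ∀ {V : Config} i → V i ≡ false → V (suc i) ≡ true → ∀ c →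
  ⟦ V (sw i c) ⟧ + hit c i ≡ ⟦ V c ⟧ + hit (suc c) i
hop {V} i p q c with position i c
... | left = trans (cong₂ (λ x y → ⟦ x ⟧ + y) (trans (cong V (sw-left i)) q) (hit-other λ ()))
                   (sym (cong₂ (λ x y → ⟦ x ⟧ + y) p (hit-self i)))
... | right = trans (cong₂ (λ x y → ⟦ x ⟧ + y) (trans (cong V (sw-right i)) p) (hit-self i))
                   (sym (cong₂ (λ x y → ⟦ x ⟧ + y) q (hit-other λ ())))
... | other x y = cong₂ (λ x y → ⟦ V x ⟧ + y) (sw-other i c x y)
  (trans (hit-other y) (sym (hit-other (x ∘ ℕ.suc-injective))))

-- The site `c` gains a particle from every letter labelled `c` + 1 and loses one to every letter
-- labelled `c`.
conservation : ∀ {n} {V} (w : Word n) → Run V w →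
  ∀ c → ⟦ V (ev w c) ⟧ + cnt c w ≡ ⟦ V c ⟧ + cnt (suc c) w
conservation [] r c = refl
conservation {V = V} (i ∷ w) ((p , q) , r) c = begin
  ⟦ V (sw j (ev w c)) ⟧ + (hit c j + cnt c w) ≡⟨ lemma ⟦ V (sw j (ev w c)) ⟧ (hit c j) (cnt c w) ⟩
  hit c j + (⟦ V (sw j (ev w c)) ⟧ + cnt c w) ≡⟨ cong (λ z → hit c j + z) (conservation w r c) ⟩
  hit c j + (⟦ V (sw j c) ⟧ + cnt (suc c) w) ≡⟨ ℕ.+-assoc (hit c j) _ _ ⟨
  (hit c j + ⟦ V (sw j c) ⟧) + cnt (suc c) w ≡⟨ cong (_+ cnt (suc c) w) (trans (ℕ.+-comm (hit c j) _) (hop {V} j p q c)) ⟩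
  (⟦ V c ⟧ + hit (suc c) j) + cnt (suc c) w ≡⟨ ℕ.+-assoc ⟦ V c ⟧ _ _ ⟩
  ⟦ V c ⟧ + (hit (suc c) j + cnt (suc c) w) ∎
  where
  open ≡-Reasoning
  j = toℕ i
  lemma : ∀ a b c → a + (b + c) ≡ b + (a + c)
  lemma = ℕR.solve-∀

-- The moment of a configuration and minimal length

-- The sum of the positions of the particles, where the first site has position `a`.
moment : ℕ → ℕ → Config → ℕ
moment a zero V = ⟦ V 0 ⟧ * a
moment a (suc n) V = ⟦ V 0 ⟧ * a + moment (suc a) n (V ∘ suc)

moment-sw : ∀ a n (i : Fin n) V →
  moment a n V + ⟦ V (toℕ i) ⟧ ≡ moment a n (V ∘ sw (toℕ i)) + ⟦ V (suc (toℕ i)) ⟧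
moment-sw a (suc zero) zero V = lemma a ⟦ V 0 ⟧ ⟦ V 1 ⟧
  where
  lemma : ∀ a x y → (x * a + y * suc a) + x ≡ (y * a + x * suc a) + y
  lemma = ℕR.solve-∀
moment-sw a (suc (suc n)) zero V = lemma a ⟦ V 0 ⟧ ⟦ V 1 ⟧ _
  where
  lemma : ∀ a x y z → (x * a + (y * suc a + z)) + x ≡ (y * a + (x * suc a + z)) + y
  lemma = ℕR.solve-∀
moment-sw a (suc n) (suc i) V = trans (ℕ.+-assoc (⟦ V 0 ⟧ * a) _ _)
  (trans (cong (λ z → ⟦ V 0 ⟧ * a + z) (moment-sw (suc a) n i (V ∘ suc)))
    (sym (ℕ.+-assoc (⟦ V 0 ⟧ * a) _ _)))

moment-cong : ∀ a n {V V′} → (∀ v → V v ≡ V′ v) → moment a n V ≡ moment a n V′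
moment-cong a zero e = cong (λ b → ⟦ b ⟧ * a) (e 0)
moment-cong a (suc n) e = cong₂ _+_ (cong (λ b → ⟦ b ⟧ * a) (e 0)) (moment-cong (suc a) n (e ∘ suc))

moment-hop : ∀ n (i : Fin n) V → V (toℕ i) ≡ false → V (suc (toℕ i)) ≡ true →
  moment 0 n V ≡ suc (moment 0 n (V ∘ sw (toℕ i)))
moment-hop n i V p q = trans (sym (ℕ.+-identityʳ _)) (trans
  (subst₂ (λ x y → moment 0 n V + ⟦ x ⟧ ≡ moment 0 n (V ∘ sw (toℕ i)) + ⟦ y ⟧) p q (moment-sw 0 n i V))
  (ℕ.+-comm _ 1))

Run⇒moment : ∀ {n} {V} (w : Word n) → Run V w → moment 0 n V ≡ moment 0 n (V ∘ ev w) + length w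
Run⇒moment [] r = sym (ℕ.+-identityʳ _)
Run⇒moment {n} {V} (i ∷ w) ((p , q) , r) = trans (moment-hop n i V p q)
  (trans (cong suc (Run⇒moment w r)) (sym (ℕ.+-suc _ _)))

moment-bound : ∀ {n} V (w : Word n) → moment 0 n V ≤ moment 0 n (V ∘ ev w) + length w
moment-bound V [] = ℕ.m≤m+n _ _
moment-bound {n} V (i ∷ w) = begin
  moment 0 n V ≤⟨ ℕ.m≤m+n _ _ ⟩
  moment 0 n V + ⟦ V (toℕ i) ⟧ ≡⟨ moment-sw 0 n i V ⟩
  moment 0 n (V ∘ sw (toℕ i)) + ⟦ V (suc (toℕ i)) ⟧ ≤⟨ ℕ.+-mono-≤ (moment-bound (V ∘ sw (toℕ i)) w) (⟦⟧≤1 (V (suc (toℕ i)))) ⟩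
  (moment 0 n (V ∘ ev (i ∷ w)) + length w) + 1 ≡⟨ lemma _ (length w) ⟩
  moment 0 n (V ∘ ev (i ∷ w)) + suc (length w) ∎
  where
  open ℕ.≤-Reasoning
  lemma : ∀ a b → (a + b) + 1 ≡ a + suc b
  lemma = ℕR.solve-∀

-- No letter lowers the moment by more than one; if the total drop equals the length, every letter
-- has to be a hop.
moment⇒Run : ∀ {n} V (w : Word n) → moment 0 n (V ∘ ev w) + length w ≤ moment 0 n V → Run V w
moment⇒Run V [] p = tt
moment⇒Run {n} V (i ∷ w) p = bits , moment⇒Run (V ∘ sw j) w (ℕ.+-cancelʳ-≤ ⟦ V (suc j) ⟧ _ _ (begin
  (M + length w) + ⟦ V (suc j) ⟧ ≤⟨ ℕ.+-monoʳ-≤ (M + length w) (⟦⟧≤1 (V (suc j))) ⟩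
  (M + length w) + 1 ≡⟨ lemma M (length w) ⟩
  M + suc (length w) ≤⟨ p ⟩
  moment 0 n V ≤⟨ ℕ.m≤m+n _ _ ⟩
  moment 0 n V + ⟦ V j ⟧ ≡⟨ moment-sw 0 n i V ⟩
  moment 0 n (V ∘ sw j) + ⟦ V (suc j) ⟧ ∎))
  where
  open ℕ.≤-Reasoning
  j = toℕ i
  M = moment 0 n (V ∘ ev (i ∷ w))
  lemma : ∀ a b → (a + b) + 1 ≡ a + suc b
  lemma = ℕR.solve-∀
  slack : 1 + ⟦ V j ⟧ ≤ ⟦ V (suc j) ⟧
  slack = ℕ.+-cancelˡ-≤ (M + length w) _ _ (begin
    (M + length w) + (1 + ⟦ V j ⟧) ≡⟨ ℕ.+-assoc (M + length w) 1 _ ⟨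
    ((M + length w) + 1) + ⟦ V j ⟧ ≡⟨ cong (_+ ⟦ V j ⟧) (lemma M (length w)) ⟩
    (M + suc (length w)) + ⟦ V j ⟧ ≤⟨ ℕ.+-monoˡ-≤ ⟦ V j ⟧ p ⟩
    moment 0 n V + ⟦ V j ⟧ ≡⟨ moment-sw 0 n i V ⟩
    moment 0 n (V ∘ sw j) + ⟦ V (suc j) ⟧ ≤⟨ ℕ.+-monoˡ-≤ ⟦ V (suc j) ⟧ (moment-bound (V ∘ sw j) w) ⟩
    (M + length w) + ⟦ V (suc j) ⟧ ∎)
  decode : ∀ x y → 1 + ⟦ x ⟧ ≤ ⟦ y ⟧ → x ≡ false × y ≡ true
  decode false true _ = refl , refl
  decode true true (s≤s ())
  decode x false ()
  bits : V j ≡ false × V (suc j) ≡ true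
  bits = decode (V j) (V (suc j)) slack

Run-shortest : ∀ {n} {V} (w u : Word n) → Run V w → u ≗ᵉ w → length w ≤ length u
Run-shortest {n} {V} w u r e = ℕ.+-cancelˡ-≤ (moment 0 n (V ∘ ev w)) _ _ (ℕ.≤-trans
  (ℕ.≤-reflexive (sym (Run⇒moment w r)))
  (ℕ.≤-trans (moment-bound V u) (ℕ.≤-reflexive (cong (_+ length u) (moment-cong 0 n (cong V ∘ e))))))

Run-transfer : ∀ {n} {V} (w u : Word n) → Run V w → u ≗ᵉ w → length u ≤ length w → Run V u
Run-transfer {n} {V} w u r e l = moment⇒Run V u (ℕ.≤-trans
  (ℕ.+-mono-≤ (ℕ.≤-reflexive (moment-cong 0 n (cong V ∘ e))) l)
  (ℕ.≤-reflexive (sym (Run⇒moment w r))))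

-- Conservation yields the count in column `c` + 1 from the one in column `c`, starting from the
-- empty column 0.
cnt-determined : ∀ {n} {V V′} (w u : Word n) → Run V w → Run V′ u → u ≗ᵉ w →
  (∀ c → ⟦ V (ev w c) ⟧ + ⟦ V′ c ⟧ ≡ ⟦ V′ (ev w c) ⟧ + ⟦ V c ⟧) → ∀ c → cnt c w ≡ cnt c u
cnt-determined w u r r′ e b zero = trans (cnt-0 w) (sym (cnt-0 u))
cnt-determined {V = V} {V′} w u r r′ e b (suc c) = ℕ.+-cancelˡ-≡ (⟦ V c ⟧ + ⟦ V′ c ⟧) _ _ (begin
  (⟦ V c ⟧ + ⟦ V′ c ⟧) + cnt (suc c) w ≡⟨ lemma ⟦ V c ⟧ ⟦ V′ c ⟧ _ ⟩
  ⟦ V′ c ⟧ + (⟦ V c ⟧ + cnt (suc c) w) ≡⟨ cong (λ z → ⟦ V′ c ⟧ + z) (conservation w r c) ⟨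
  ⟦ V′ c ⟧ + (⟦ V (ev w c) ⟧ + cnt c w) ≡⟨ lemma′ ⟦ V (ev w c) ⟧ ⟦ V′ c ⟧ _ ⟩
  (⟦ V (ev w c) ⟧ + ⟦ V′ c ⟧) + cnt c w ≡⟨ cong₂ _+_ (b c) (cnt-determined w u r r′ e b c) ⟩
  (⟦ V′ (ev w c) ⟧ + ⟦ V c ⟧) + cnt c u ≡⟨ cong (λ x → (⟦ V′ x ⟧ + ⟦ V c ⟧) + cnt c u) (e c) ⟨
  (⟦ V′ (ev u c) ⟧ + ⟦ V c ⟧) + cnt c u ≡⟨ lemma′ ⟦ V′ (ev u c) ⟧ ⟦ V c ⟧ _ ⟨
  ⟦ V c ⟧ + (⟦ V′ (ev u c) ⟧ + cnt c u) ≡⟨ cong (λ z → ⟦ V c ⟧ + z) (conservation u r′ c) ⟩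
  ⟦ V c ⟧ + (⟦ V′ c ⟧ + cnt (suc c) u) ≡⟨ ℕ.+-assoc ⟦ V c ⟧ _ _ ⟨
  (⟦ V c ⟧ + ⟦ V′ c ⟧) + cnt (suc c) u ∎)
  where
  open ≡-Reasoning
  lemma : ∀ a b c → (a + b) + c ≡ b + (a + c)
  lemma = ℕR.solve-∀
  lemma′ : ∀ a b c → b + (a + c) ≡ (a + b) + c
  lemma′ = ℕR.solve-∀

-- Counts and configuration determine the permutation

sw-< : ∀ i {x y} → x < y → ¬ (x ≡ i × y ≡ suc i) → sw i x < sw i y
sw-< i {x} {y} p ne with position i x | position i y
... | left | left = contradiction p (ℕ.<-irrefl refl)
... | left | right = contradiction (refl , refl) ne
... | left | other a b = subst₂ _<_ (sym (sw-left i)) (sym (sw-other i y a b)) (ℕ.≤∧≢⇒< p (b ∘ sym))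
... | right | left = contradiction p (ℕ.<-asym (ℕ.n<1+n i))
... | right | right = contradiction p (ℕ.<-irrefl refl)
... | right | other a b = subst₂ _<_ (sym (sw-right i)) (sym (sw-other i y a b)) (ℕ.<-trans (ℕ.n<1+n i) p)
... | other a b | left = subst₂ _<_ (sym (sw-other i x a b)) (sym (sw-left i)) (ℕ.<-trans p (ℕ.n<1+n i))
... | other a b | right = subst₂ _<_ (sym (sw-other i x a b)) (sym (sw-right i)) (ℕ.≤∧≢⇒< (s≤s⁻¹ p) a)
... | other a b | other c d = subst₂ _<_ (sym (sw-other i x a b)) (sym (sw-other i y c d)) p

-- A hop exchanges a particle with a hole, so two sites of equal content never swap their order.
Run-monotone : ∀ {n} {V : Config} (w : Word n) → Run V w →
  ∀ {x y} → x < y → V (ev w x) ≡ V (ev w y) → ev w x < ev w y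
Run-monotone [] r p e = p
Run-monotone {V = V} (i ∷ w) ((a , b) , r) {x} {y} p e = sw-< (toℕ i) (Run-monotone w r p e)
  λ (c , d) → case trans (sym (at c (sw-left (toℕ i)) b)) (trans e (at d (sw-right (toℕ i)) a)) of λ ()
  where
  at : ∀ {u v z t} → u ≡ z → sw (toℕ i) z ≡ v → V v ≡ t → V (sw (toℕ i) u) ≡ t
  at refl refl e = e

private
  class-agreement : ∀ {n} {V : Config} (w u : Word n) → Run V w →
    (∀ c → V (ev w c) ≡ V (ev u c)) → ∀ x →
    (∀ z → z < x → ev w z ≡ ev u z) → ¬ (ev u x < ev w x)
  class-agreement {V = V} w u r b x below p with ℕ.<-cmp z x
    where z = ev⁻¹ w (ev u x)
  ... | tri< z<x _ _ = ℕ.<-irrefl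
    (ev-injective u (trans (sym (below _ z<x)) (ev-ev⁻¹ w (ev u x)))) z<x
  ... | tri≈ _ z≡x _ = ℕ.<-irrefl (trans (sym (ev-ev⁻¹ w (ev u x))) (cong (ev w) z≡x)) p
  ... | tri> _ _ x<z = ℕ.<-asym p (subst (ev w x <_) (ev-ev⁻¹ w (ev u x))
    (Run-monotone w r x<z (trans (b x) (cong V (sym (ev-ev⁻¹ w (ev u x)))))))

-- On each class of sites with the same final content, both permutations are
-- the increasing bijection onto the sites with that initial content.

Run-determined : ∀ {n} {V : Config} (w u : Word n) → Run V w → Run V u →
  (∀ c → cnt c w ≡ cnt c u) → w ≗ᵉ u
Run-determined {V = V} w u r r′ e = <-rec (λ x → ev w x ≡ ev u x) λ x below →
  case ℕ.<-cmp (ev w x) (ev u x) of λ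
    { (tri< p _ _) → contradiction p (class-agreement u w r′ (sym ∘ b) x (λ z q → sym (below q)))
    ; (tri≈ _ p _) → p
    ; (tri> _ _ p) → contradiction p (class-agreement w u r b x (λ z q → below q)) }
  where
  b : ∀ c → V (ev w c) ≡ V (ev u c)
  b c = ⟦⟧-injective (ℕ.+-cancelʳ-≡ (cnt c w) _ _
    (trans (conservation w r c) (trans (cong (λ z → ⟦ V c ⟧ + z) (e (suc c)))
      (trans (sym (conservation u r′ c)) (cong (λ z → ⟦ V (ev u c) ⟧ + z) (sym (e c)))))))

-- Flow V T h: the heights h are the numbers of letters of a word that transforms
-- the configuration V into T.

Flow : ℕ → Config → Config → (ℕ → ℕ) → Set
Flow n V T h = (∀ c → h (suc c) + ⟦ V c ⟧ ≡ h c + ⟦ T c ⟧) × h 0 ≡ 0 × (∀ c → n < c → h c ≡ 0)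

Movable : ℕ → Config → (ℕ → ℕ) → Set
Movable n V h = ∃[ i ] V (toℕ {n} i) ≡ false × V (suc (toℕ i)) ≡ true × 0 < h (suc (toℕ i))

private
  module _ {n V T h} (flow : Flow n V T h) where
    private
      step = proj₁ flow

      -- If the site to the right is a hole as well, conservation makes the column beyond it at
      -- least as high. The search therefore moves on to a nonempty column, and it ends because the
      -- heights vanish beyond `n`.
      ascend : ∀ m i → n ≤ m + i → V i ≡ false → 0 < h (suc i) → Movable n V h
      ascend m i b v p with suc i ℕ.≤? n
      ... | no ¬q = contradiction (proj₂ (proj₂ flow) (suc i) (ℕ.≰⇒> ¬q)) (ℕ.m<n⇒n≢0 p)
      ... | yes q with V (suc i) in v′
      ...   | true = fromℕ< q
                   , subst (λ x → V x ≡ false) (sym i≡) v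
                   , subst (λ x → V (suc x) ≡ true) (sym i≡) v′
                   , subst (λ x → 0 < h (suc x)) (sym i≡) p
        where i≡ = Fin.toℕ-fromℕ< q
      ascend zero i b v p | yes q | false = contradiction b (ℕ.<⇒≱ q)
      ascend (suc m) i b v p | yes q | false = ascend m (suc i) (subst (n ≤_) (sym (ℕ.+-suc m i)) b) v′
        (ℕ.≤-trans p (ℕ.≤-trans (ℕ.m≤m+n _ _) (ℕ.≤-reflexive (trans (sym (step (suc i)))
          (trans (cong (λ z → h (2 + i) + ⟦ z ⟧) v′) (ℕ.+-identityʳ _))))))

      -- The search stops at the leftmost nonempty column. The column before it is empty, so the
      -- site between them can only gain particles and starts as a hole.
      climb : ∀ m j → n ≤ m + j → (∀ c → c ≤ j → h c ≡ 0) → (∀ c → h c ≡ 0) ⊎ Movable n V h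
      climb zero j b z = inj₁ λ c → case c ℕ.≤? j of λ
        { (yes p) → z c p ; (no p) → proj₂ (proj₂ flow) c (ℕ.≤-<-trans b (ℕ.≰⇒> p)) }
      climb (suc m) j b z with h (suc j) in e
      ... | zero = climb m (suc j) (subst (n ≤_) (sym (ℕ.+-suc m j)) b) λ c p → case ℕ.m≤n⇒m<n∨m≡n p of λ
        { (inj₁ q) → z c (s≤s⁻¹ q) ; (inj₂ refl) → e }
      ... | suc x = inj₂ (ascend n j (ℕ.m≤m+n n j) (hole (V j) (T j) (subst₂ (λ a b → a + ⟦ V j ⟧ ≡ b + ⟦ T j ⟧) e (z j ℕ.≤-refl) (step j)))
                      (subst (0 <_) (sym e) (s≤s z≤n)))
        where
        hole : ∀ v t → suc x + ⟦ v ⟧ ≡ ⟦ t ⟧ → v ≡ false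
        hole false _ _ = refl
        hole true false ()
        hole true true p = contradiction (ℕ.suc-injective p) (ℕ.m<n⇒n≢0 (ℕ.≤-trans (s≤s z≤n) (ℕ.m≤n+m 1 x)))

    movable : (∀ c → h c ≡ 0) ⊎ Movable n V h
    movable = climb n 0 (ℕ.m≤m+n n 0) λ { zero z≤n → proj₁ (proj₂ flow) }

  flow-hop : ∀ {n V T h} → Flow n V T h → (m : Movable n V h) →
    ∃[ h′ ] Flow n (V ∘ sw (toℕ (proj₁ m))) T h′ × (∀ c → hit c (toℕ (proj₁ m)) + h′ c ≡ h c)
  flow-hop {n} {V} {T} {h} (st , z , o) (i , p , q , pos) = h′
    , (step′ , trans (cong (_∸ hit 0 j) z) (ℕ.0∸n≡0 (hit 0 j))
             , (λ c b → trans (cong (_∸ hit c j) (o c b)) (ℕ.0∸n≡0 (hit c j))))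
    , total-h
    where
    j = toℕ i
    h′ = λ c → h c ∸ hit c j
    hit≤ : ∀ c → hit c j ≤ h c
    hit≤ c with c ℕ.≟ suc j
    ... | yes refl = ≡≤ (hit-self j) pos
    ... | no ne = ≡≤ (hit-other ne) z≤n
    total-h : ∀ c → hit c j + h′ c ≡ h c
    total-h c = ℕ.m+[n∸m]≡n (hit≤ c)
    step′ : ∀ c → h′ (suc c) + ⟦ V (sw j c) ⟧ ≡ h′ c + ⟦ T c ⟧
    step′ c = ℕ.+-cancelˡ-≡ (hit (suc c) j + hit c j) _ _ (begin
      (hit (suc c) j + hit c j) + (h′ (suc c) + ⟦ V (sw j c) ⟧) ≡⟨ lemma (hit (suc c) j) (hit c j) (h′ (suc c)) _ ⟩
      (hit (suc c) j + h′ (suc c)) + (⟦ V (sw j c) ⟧ + hit c j) ≡⟨ cong₂ _+_ (total-h (suc c)) (hop {V} j p q c) ⟩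
      h (suc c) + (⟦ V c ⟧ + hit (suc c) j) ≡⟨ ℕ.+-assoc (h (suc c)) _ _ ⟨
      (h (suc c) + ⟦ V c ⟧) + hit (suc c) j ≡⟨ cong (_+ hit (suc c) j) (trans (st c) (cong (_+ ⟦ T c ⟧) (sym (total-h c)))) ⟩
      ((hit c j + h′ c) + ⟦ T c ⟧) + hit (suc c) j ≡⟨ lemma′ (hit (suc c) j) (hit c j) (h′ c) _ ⟩
      (hit (suc c) j + hit c j) + (h′ c + ⟦ T c ⟧) ∎)
      where
      open ≡-Reasoning
      lemma : ∀ a b c d → (a + b) + (c + d) ≡ (a + c) + (d + b)
      lemma = ℕR.solve-∀
      lemma′ : ∀ a b c d → ((b + c) + d) + a ≡ (a + b) + (c + d)
      lemma′ = ℕR.solve-∀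

-- Any movable letter may come first: what remains is again a flow, with a smaller moment.
realise : ∀ n {V T h} → Flow n V T h → ∃[ w ] Run {n} V w × (∀ c → cnt c w ≡ h c)
realise n {V} {T} {h} = go (moment 0 n V) ℕ.≤-refl
  where
  go : ∀ m {V T h} → moment 0 n V ≤ m → Flow n V T h → ∃[ w ] Run {n} V w × (∀ c → cnt c w ≡ h c)
  go m {V} b flow with movable flow
  ... | inj₁ z = [] , tt , sym ∘ z
  ... | inj₂ mv@(i , p , q , _) with m
  ...   | zero = contradiction (≡≤ (sym (moment-hop n i V p q)) b) λ ()
  ...   | suc m with flow-hop flow mv
  ...     | h′ , flow′ , e with go m (s≤s⁻¹ (≡≤ (sym (moment-hop n i V p q)) b)) flow′
  ...       | w , r , e′ = i ∷ w , ((p , q) , r) , λ c → trans (cong (λ z → hit c (toℕ i) + z) (e′ c)) (e c)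

-- Sorting a permutation by hops

Inversions : ∀ {n} → Config → Perm n → Set
Inversions V π = ∀ {x y} → toℕ x < toℕ y → toℕ (π ⟨$⟩ʳ y) < toℕ (π ⟨$⟩ʳ x) →
  V (toℕ (π ⟨$⟩ʳ x)) ≡ true × V (toℕ (π ⟨$⟩ʳ y)) ≡ false

private
  no-descent : ∀ {n} (π : Perm n) →
    (∀ i → ¬ toℕ (π ⟨$⟩ˡ suc i) < toℕ (π ⟨$⟩ˡ inject₁ i)) → ∀ x → toℕ (π ⟨$⟩ʳ x) ≡ toℕ x
  no-descent {n} π nd x = cong toℕ (trans (cong (π ⟨$⟩ʳ_) (sym (fixed x))) (inverseʳ π))
    where
    ascent : ∀ i → toℕ (π ⟨$⟩ˡ inject₁ i) < toℕ (π ⟨$⟩ˡ suc i)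
    ascent i = ℕ.≤∧≢⇒< (ℕ.≮⇒≥ (nd i)) λ e → ℕ.<-irrefl
      (trans (sym (Fin.toℕ-inject₁ i)) (cong toℕ (trans (sym (inverseʳ π))
        (trans (cong (π ⟨$⟩ʳ_) (Fin.toℕ-injective e)) (inverseʳ π)))))
      (ℕ.n<1+n (toℕ i))
    fixed : ∀ y → π ⟨$⟩ˡ y ≡ y
    fixed y = Fin.toℕ-injective (ℕ.≤-antisym
      (>-weakInduction (λ y → toℕ (π ⟨$⟩ˡ y) ≤ toℕ y)
        (ℕ.≤-trans (Fin.toℕ≤pred[n] (π ⟨$⟩ˡ fromℕ n)) (ℕ.≤-reflexive (sym (Fin.toℕ-fromℕ n))))
        (λ i p → ℕ.≤-trans (s≤s⁻¹ (ℕ.<-≤-trans (ascent i) p)) (ℕ.≤-reflexive (sym (Fin.toℕ-inject₁ i)))) y)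
      (<-weakInduction (λ y → toℕ y ≤ toℕ (π ⟨$⟩ˡ y)) z≤n
        (λ i p → ℕ.≤-<-trans (≡≤ (sym (Fin.toℕ-inject₁ i)) p) (ascent i)) y))

-- Bubble sort on the values. A value `i` + 1 standing before `i` is an inversion, so removing it is
-- a hop; the inversions that remain come from inversions of `π`, so the hypothesis persists.
sort : ∀ {n} (V : Config) (π : Perm n) → Inversions V π →
  ∃[ w ] Run {n} V w × (∀ x → toℕ (π ⟨$⟩ʳ x) ≡ ev w (toℕ x))
sort {n} V = go (moment 0 n V) V ℕ.≤-refl
  where
  go : ∀ m V → moment 0 n V ≤ m → (π : Perm n) → Inversions V π →
    ∃[ w ] Run {n} V w × (∀ x → toℕ (π ⟨$⟩ʳ x) ≡ ev w (toℕ x))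
  go m V b π inv with Fin.any? (λ i → toℕ (π ⟨$⟩ˡ suc i) ℕ.<? toℕ (π ⟨$⟩ˡ inject₁ i))
  ... | no nd = [] , tt , no-descent π λ i p → nd (i , p)
  ... | yes (i , p) = continue m b
    where
    j = toℕ i
    at-i : toℕ (π ⟨$⟩ʳ (π ⟨$⟩ˡ inject₁ i)) ≡ j
    at-i = trans (cong toℕ (inverseʳ π)) (Fin.toℕ-inject₁ i)
    at-suc-i : toℕ (π ⟨$⟩ʳ (π ⟨$⟩ˡ suc i)) ≡ suc j
    at-suc-i = cong toℕ (inverseʳ π)
    bits = inv p (subst₂ _<_ (sym at-i) (sym at-suc-i) (ℕ.n<1+n j))
    Vi : V j ≡ false
    Vi = trans (cong V (sym at-i)) (proj₂ bits)
    Vsi : V (suc j) ≡ true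
    Vsi = trans (cong V (sym at-suc-i)) (proj₁ bits)
    π′ = s i · π
    unsw : ∀ x → toℕ (π ⟨$⟩ʳ x) ≡ sw j (toℕ (π′ ⟨$⟩ʳ x))
    unsw x = sym (trans (cong (sw j) (toℕ-s i (π ⟨$⟩ʳ x))) (sw-involutive j _))
    inv′ : Inversions (V ∘ sw j) π′
    inv′ {x} {y} x<y q = trans (cong V (sym (unsw x))) (proj₁ bits′) , trans (cong V (sym (unsw y))) (proj₂ bits′)
      where
      bits′ = inv x<y (case ℕ.<-cmp (toℕ (π ⟨$⟩ʳ x)) (toℕ (π ⟨$⟩ʳ y)) of λ
        { (tri> _ _ r) → r
        ; (tri≈ _ r _) → contradiction q (ℕ.<-irrefl (trans (toℕ-s i _) (trans (cong (sw j) (sym r)) (sym (toℕ-s i _)))))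
        ; (tri< r _ _) → contradiction q (ℕ.<-asym (subst₂ _<_ (sym (toℕ-s i _)) (sym (toℕ-s i _))
            (sw-< j r λ (ex , ey) → ℕ.<-asym p (subst₂ _<_
              (cong toℕ (preimage x (inject₁ i) (trans ex (sym (Fin.toℕ-inject₁ i)))))
              (cong toℕ (preimage y (suc i) ey)) x<y)))) })
        where
        preimage : ∀ x z → toℕ (π ⟨$⟩ʳ x) ≡ toℕ z → x ≡ π ⟨$⟩ˡ z
        preimage x z e = trans (sym (inverseˡ π)) (cong (π ⟨$⟩ˡ_) (Fin.toℕ-injective e))
    continue : ∀ m → moment 0 n V ≤ m → ∃[ w ] Run {n} V w × (∀ x → toℕ (π ⟨$⟩ʳ x) ≡ ev w (toℕ x))
    continue zero b = contradiction (≡≤ (sym (moment-hop n i V Vi Vsi)) b) λ ()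
    continue (suc m) b with go m (V ∘ sw j) (s≤s⁻¹ (≡≤ (sym (moment-hop n i V Vi Vsi)) b)) π′ inv′
    ... | w , r , e = i ∷ w , ((Vi , Vsi) , r) , λ x → trans (unsw x) (cong (sw j) (e x))

-- The particles are the values that are the larger element of an inversion;
-- without 321 no such value is also the smaller element of one.

avoids⇒run : ∀ {n} (π : Perm n) → Avoids321 π →
  ∃[ V ] ∃[ w ] Run {n} V w × (∀ x → toℕ (π ⟨$⟩ʳ x) ≡ ev w (toℕ x))
avoids⇒run {n} π av = V , sort V π inv
  where
  Larger : ℕ → Set
  Larger v = ∃[ x ] ∃[ y ] toℕ (π ⟨$⟩ʳ x) ≡ v × toℕ x < toℕ y × toℕ (π ⟨$⟩ʳ y) < toℕ (π ⟨$⟩ʳ x)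
  larger? : ∀ v → Dec (Larger v)
  larger? v = Fin.any? λ x → Fin.any? λ y → (toℕ (π ⟨$⟩ʳ x) ℕ.≟ v) ×-dec (toℕ x ℕ.<? toℕ y) ×-dec
    (toℕ (π ⟨$⟩ʳ y) ℕ.<? toℕ (π ⟨$⟩ʳ x))
  V : Config
  V v = does (larger? v)
  inv : Inversions V π
  inv {x} {y} p q = dec-true (larger? _) (x , y , refl , p , q)
    , dec-false (larger? _) λ { (y′ , z , e , r , t) → av x y z p
        (subst (λ u → toℕ u < toℕ z) (same e) r)
        (q , subst (λ u → toℕ (π ⟨$⟩ʳ z) < toℕ (π ⟨$⟩ʳ u)) (same e) t) }
    where
    same : ∀ {y′} → toℕ (π ⟨$⟩ʳ y′) ≡ toℕ (π ⟨$⟩ʳ y) → y′ ≡ y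
    same e = trans (sym (inverseˡ π)) (trans (cong (π ⟨$⟩ˡ_) (Fin.toℕ-injective e)) (inverseˡ π))

-- The path of a 321-avoiding permutation

hgt : ∀ {a l} → Path a l → ℕ → ℕ
hgt [] c = 0
hgt {a} (s ∷ₚ p) zero = a
hgt (s ∷ₚ p) (suc c) = hgt p c

bots tops : ∀ {a l} → Path a l → Config
bots [] c = false
bots (s ∷ₚ p) zero = bot s
bots (s ∷ₚ p) (suc c) = bots p c
tops [] c = false
tops (s ∷ₚ p) zero = top s
tops (s ∷ₚ p) (suc c) = tops p c

hgt-start : ∀ {a l} (p : Path a l) → hgt p 0 ≡ a
hgt-start [] = refl
hgt-start (s ∷ₚ p) = refl

hgt-outside : ∀ {a l} (p : Path a l) c → l ≤ c → hgt p c ≡ 0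
hgt-outside [] c b = refl
hgt-outside (s ∷ₚ p) (suc c) (s≤s b) = hgt-outside p c b

path-step : ∀ {a l} (p : Path a l) c → hgt p (suc c) + ⟦ bots p c ⟧ ≡ hgt p c + ⟦ tops p c ⟧
path-step [] c = refl
path-step (s ∷ₚ p) zero = trans (cong (_+ ⟦ bot s ⟧) (hgt-start p)) (step-height s)
path-step (s ∷ₚ p) (suc c) = path-step p c

path-flow : ∀ {n} (p : Path 0 (suc n)) → Flow n (bots p) (tops p) (hgt p)
path-flow p = path-step p , hgt-start p , hgt-outside p

private
  stepOf : ∀ a b v t → b + ⟦ v ⟧ ≡ a + ⟦ t ⟧ → Σ (Step a b) λ s → v ≡ bot s ⊎ (a ≡ 0 × b ≡ 0)
  stepOf a b false false e with trans (sym (ℕ.+-identityʳ b)) (trans e (ℕ.+-identityʳ a))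
  ... | refl = lo , inj₁ refl
  stepOf a b false true e with trans (sym (ℕ.+-identityʳ b)) (trans e (ℕ.+-comm a 1))
  ... | refl = up , inj₁ refl
  stepOf a b true false e with trans (ℕ.+-comm 1 b) (trans e (ℕ.+-identityʳ a))
  ... | refl = down , inj₁ refl
  -- An untouched site may hold a particle. The path records a hole instead, and this is the one
  -- case in which `bot` may differ from the given content.
  stepOf zero zero true true e = lo , inj₂ (refl , refl)
  stepOf (suc a) b true true e with ℕ.+-cancelʳ-≡ 1 b (suc a) e
  ... | refl = hi , inj₁ refl
  stepOf zero (suc b) true true e with trans (ℕ.+-comm 1 b) (ℕ.suc-injective e)
  ... | ()

flow⇒path : ∀ l {a} (h : ℕ → ℕ) (V T : Config) → h 0 ≡ a →
  (∀ c → h (suc c) + ⟦ V c ⟧ ≡ h c + ⟦ T c ⟧) → (∀ c → l ≤ c → h c ≡ 0) →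
  ∃[ p ] (∀ c → hgt {a} {l} p c ≡ h c) × (∀ c → 0 < h c + h (suc c) → V c ≡ bots p c)
flow⇒path zero h V T h0 st z with trans (sym h0) (z 0 z≤n)
... | refl = [] , (λ c → sym (z c z≤n))
  , λ c p → contradiction (cong₂ _+_ (z c z≤n) (z (suc c) z≤n)) (ℕ.m<n⇒n≢0 p)
flow⇒path (suc l) h V T refl st z with stepOf (h 0) (h 1) (V 0) (T 0) (st 0)
  | flow⇒path l (h ∘ suc) (V ∘ suc) (T ∘ suc) refl (st ∘ suc) (λ c b → z (suc c) (s≤s b))
... | s , v | p , e , f = s ∷ₚ p , (λ { zero → refl ; (suc c) → e c }) , λ
    { zero pos → [ (λ x → x) , (λ (x , y) → contradiction (cong₂ _+_ x y) (ℕ.m<n⇒n≢0 pos)) ]′ v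
    ; (suc c) → f c }

step-unique : ∀ {a b} (s t : Step a b) → (0 < a → bot s ≡ bot t) → s ≡ t
step-unique up up e = refl
step-unique down down e = refl
step-unique lo lo e = refl
step-unique lo hi e = case e (s≤s z≤n) of λ ()
step-unique hi lo e = case e (s≤s z≤n) of λ ()
step-unique hi hi e = refl

path-unique : ∀ {a l} (p q : Path a l) → (∀ c → hgt p c ≡ hgt q c) →
  (∀ c → 0 < hgt p c → bots p c ≡ bots q c) → p ≡ q
path-unique [] [] e f = refl
path-unique {a} {suc l} (_∷ₚ_ {b = b} s p) (_∷ₚ_ {b = b′} t q) e f =
  go (trans (sym (hgt-start p)) (trans (e 1) (hgt-start q))) s t p q e f
  where
  go : ∀ {b b′} → b ≡ b′ → (s : Step a b) (t : Step a b′) (p : Path b l) (q : Path b′ l) →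
    (∀ c → hgt (s ∷ₚ p) c ≡ hgt (t ∷ₚ q) c) →
    (∀ c → 0 < hgt (s ∷ₚ p) c → bots (s ∷ₚ p) c ≡ bots (t ∷ₚ q) c) → s ∷ₚ p ≡ t ∷ₚ q
  go refl s t p q e f = cong₂ _∷ₚ_ (step-unique s t (f 0)) (path-unique p q (e ∘ suc) (f ∘ suc))

-- The correspondence between 321-avoiding permutations and paths

record Model {n} (π : Perm n) (P : Path 0 (suc n)) : Set where
  field
    word       : Word n
    represents : eval word ≈ π
    run        : Run (bots P) word
    counts     : ∀ c → cnt c word ≡ hgt P c

module _ {n} {π : Perm n} {P : Path 0 (suc n)} (M : Model π P) where
  open Model M

  -- A word of minimal length runs wherever `word` does, and conservation then fixes its counts.
  -- This is how the reduced words occurring in the hypotheses are brought under control.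
  model-word : ∀ {𝕨} → IsReducedFor π 𝕨 → Run (bots P) 𝕨 × (∀ c → cnt c 𝕨 ≡ hgt P c)
  model-word {𝕨} red = r , λ c → trans (sym (cnt-determined word 𝕨 run r same (λ _ → refl) c)) (counts c)
    where
    open IsReducedFor red renaming (represents to rep)
    same : 𝕨 ≗ᵉ word
    same = ≈⇒≗ᵉ {u = 𝕨} {word} (λ x → trans (rep x) (sym (represents x)))
    r = Run-transfer word 𝕨 run same (minimal word represents)

  model-reduced : IsReducedFor π word
  model-reduced = record
    { represents = represents
    ; minimal = λ 𝕧 e → Run-shortest word 𝕧 run (≈⇒≗ᵉ {u = 𝕧} {word} (λ x → trans (e x) (sym (represents x)))) }

  -- Two of three values have the same content, and values of the same content are never inverted.
  model⇒avoids : Avoids321 π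
  model⇒avoids i j k i<j j<k (q , r) = case repeat (bots P (at i)) (bots P (at j)) (bots P (at k)) of λ
    { (inj₁ e) → clash i<j q e ; (inj₂ (inj₁ e)) → clash j<k r e
    ; (inj₂ (inj₂ e)) → clash (ℕ.<-trans i<j j<k) (ℕ.<-trans r q) e }
    where
    at : Fin (suc n) → ℕ
    at x = ev word (toℕ x)
    value : ∀ x → toℕ (π ⟨$⟩ʳ x) ≡ at x
    value x = trans (cong toℕ (sym (represents x))) (toℕ-eval word x)
    clash : ∀ {x y} → toℕ x < toℕ y → toℕ (π ⟨$⟩ʳ y) < toℕ (π ⟨$⟩ʳ x) → bots P (at x) ≡ bots P (at y) → ⊥
    clash p q e = ℕ.<-asym (Run-monotone word run p e) (subst₂ _<_ (value _) (value _) q)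
    repeat : ∀ (x y z : Bool) → x ≡ y ⊎ y ≡ z ⊎ x ≡ z
    repeat false false z = inj₁ refl
    repeat true true z = inj₁ refl
    repeat false true false = inj₂ (inj₂ refl)
    repeat false true true = inj₂ (inj₁ refl)
    repeat true false false = inj₂ (inj₁ refl)
    repeat true false true = inj₂ (inj₂ refl)

run⇒model : ∀ {n} {π : Perm n} {V} w → Run V w → eval w ≈ π → ∃ (Model π)
run⇒model {n} {π} {V} w r e = proj₁ flow , record
  { word = w
  ; represents = e
  ; run = Run-cong w (proj₂ (proj₂ flow)) r
  ; counts = sym ∘ proj₁ (proj₂ flow) }
  where
  flow = flow⇒path (suc n) (λ c → cnt c w) V (V ∘ ev w) (cnt-0 w)
    (λ c → trans (ℕ.+-comm _ ⟦ V c ⟧) (trans (sym (conservation w r c)) (ℕ.+-comm _ (cnt c w))))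
    (λ c → cnt-outside c w)

avoids⇒model : ∀ {n} (π : Perm n) → Avoids321 π → ∃ (Model π)
avoids⇒model π av with avoids⇒run π av
... | V , w , r , e = run⇒model w r λ x → Fin.toℕ-injective (trans (toℕ-eval w x) (sym (e x)))

path-model : ∀ {n} (P : Path 0 (suc n)) → ∃[ π ] Model π P
path-model {n} P with realise n (path-flow P)
... | w , r , e = eval w , record { word = w ; represents = λ _ → refl ; run = r ; counts = e }

model-unique : ∀ {n} {π ρ : Perm n} {P} → Model π P → Model ρ P → π ≈ ρ
model-unique M N x = trans (sym (represents M x)) (trans
  (≗ᵉ⇒≈ {u = word M} {word N} (Run-determined (word M) (word N) (run M) (run N)
    (λ c → trans (counts M c) (sym (counts N c)))) x) (represents N x))
  where open Model

Run-bots : ∀ {n} {V V′} (w : Word n) → Run V w → Run V′ w → ∀ c → 0 < cnt c w → V c ≡ V′ c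
Run-bots {V = V} {V′} (i ∷ w) ((p , q) , r) ((p′ , q′) , r′) c pos with position (toℕ i) c
... | left = trans p (sym p′)
... | right = trans q (sym q′)
... | other x y = subst (λ z → V z ≡ V′ z) (sw-other (toℕ i) c x y)
  (Run-bots w r r′ c (subst (λ z → 0 < z + cnt c w) (hit-other y) pos))

model-path-unique : ∀ {n} {π ρ : Perm n} {P Q} → Model π P → Model ρ Q → π ≈ ρ → P ≡ Q
model-path-unique {P = P} {Q} M N e = path-unique P Q
  (λ c → trans (sym (proj₂ red c)) (counts N c))
  (λ c pos → Run-bots (word N) (proj₁ red) (run N) c (subst (0 <_) (sym (proj₂ red c)) pos))
  where
  open Model
  red = model-word M record
    { represents = λ x → trans (represents N x) (sym (e x))
    ; minimal = λ 𝕧 e′ → IsReducedFor.minimal (model-reduced N) 𝕧 (λ x → trans (e′ x) (e x)) }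

count-paths : ∀ {n N} {S : Perm n → Set} {S′ : Path 0 (suc n) → Set} (S′? : ∀ p → Dec (S′ p)) →
  (∀ {π} → S π → Avoids321 π) → (∀ {π P} → Model π P → S π ⇔ S′ P) →
  ∣ S ∣≡ N → N ≡ total 0 (suc n) (χ ∘ S′?)
count-paths {n} {N} {S} {S′} S′? av equiv bij = total-unique S′? path index′ path-in path-inj index-inj
  where
  module B = Inverse bij
  perm : Fin N → Perm n
  perm i = proj₁ (B.to i)
  modelled : ∀ i → ∃ (Model (perm i))
  modelled i = avoids⇒model (perm i) (av (proj₂ (B.to i)))
  path : Fin N → Path 0 (suc n)
  path i = proj₁ (modelled i)
  path-in : ∀ i → S′ (path i)
  path-in i = to (equiv (proj₂ (modelled i))) (proj₂ (B.to i))
  path-inj : ∀ {i j} → path i ≡ path j → i ≡ j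
  path-inj {i} {j} e = trans (sym (B.inverseʳ {x = i} {y = B.to i} (λ x → refl))) (B.inverseʳ {x = j} {y = B.to i}
    (model-unique (subst (Model (perm i)) e (proj₂ (modelled i))) (proj₂ (modelled j))))
  index′ : ∀ p → S′ p → Fin N
  index′ p x = B.from (proj₁ (path-model p) , from (equiv (proj₂ (path-model p))) x)
  index-inj : ∀ {p q} (x : S′ p) (y : S′ q) → index′ p x ≡ index′ q y → p ≡ q
  index-inj {p} {q} x y e = model-path-unique (proj₂ (path-model p)) (proj₂ (path-model q))
    (λ z → trans (sym (B.inverseˡ refl z)) (B.inverseˡ e z))

private
  cnt-member : ∀ {n} {i : Fin n} {w} → i ∈ w → 0 < cnt (suc (toℕ i)) w
  cnt-member {i = i} (here refl) = ≡≤ (sym (hit-self (toℕ i))) (ℕ.m≤m+n _ _)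
  cnt-member (there m) = ℕ.≤-trans (cnt-member m) (ℕ.m≤n+m _ _)

  member-cnt : ∀ {n} {i : Fin n} w → 0 < cnt (suc (toℕ i)) w → i ∈ w
  member-cnt {i = i} (j ∷ w) p with i Fin.≟ j
  ... | yes refl = here refl
  ... | no ne = there (member-cnt w (subst (λ z → 0 < z + cnt (suc (toℕ i)) w)
    (hit-other λ e → ne (Fin.toℕ-injective (ℕ.suc-injective e))) p))

positive⇒hgt : ∀ {a l} (p : Path a l) → Positive p → ∀ c → c < l → 0 < hgt p c
positive⇒hgt (s ∷ₚ p) (x , y) zero b = x
positive⇒hgt (s ∷ₚ p) (x , y) (suc c) (s≤s b) = positive⇒hgt p y c b

hgt⇒positive : ∀ {a l} (p : Path a l) → (∀ c → c < l → 0 < hgt p c) → Positive p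
hgt⇒positive [] f = tt
hgt⇒positive (s ∷ₚ p) f = f 0 (s≤s z≤n) , hgt⇒positive p (λ c b → f (suc c) (s≤s b))

model-connected : ∀ {n} {π : Perm n} {P} → Model π P → Connected π ⇔ ConnectedPath P
model-connected {n} {π} {s ∷ₚ p} M = mk⇔
  (λ (1≤n , supp) → 1≤n , hgt⇒positive p λ c c<n → case supp (fromℕ< c<n) of λ
    { (𝕨 , red , m) → subst (λ z → 0 < hgt p z) (Fin.toℕ-fromℕ< c<n)
        (subst (0 <_) (proj₂ (model-word M red) _) (cnt-member m)) })
  (λ (1≤n , pos) → 1≤n , λ i → word M , model-reduced M
    , member-cnt (word M) (subst (0 <_) (sym (counts M (suc (toℕ i)))) (positive⇒hgt p pos (toℕ i) (Fin.toℕ<n i))))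
  where open Model

-- Heaps in coordinates

sw-commute : ∀ i j x → i ≢ suc j → j ≢ suc i → sw i (sw j x) ≡ sw j (sw i x)
sw-commute zero zero x p q = refl
sw-commute zero (suc zero) x p q = contradiction refl q
sw-commute zero (suc (suc j)) zero p q = refl
sw-commute zero (suc (suc j)) (suc zero) p q = refl
sw-commute zero (suc (suc j)) (suc (suc x)) p q = refl
sw-commute (suc zero) zero x p q = contradiction refl p
sw-commute (suc (suc i)) zero zero p q = refl
sw-commute (suc (suc i)) zero (suc zero) p q = refl
sw-commute (suc (suc i)) zero (suc (suc x)) p q = refl
sw-commute (suc i) (suc j) zero p q = refl
sw-commute (suc i) (suc j) (suc x) p q = cong suc (sw-commute i j x (p ∘ cong suc) (q ∘ cong suc))

sw-braid : ∀ i x → sw i (sw (suc i) (sw i x)) ≡ sw (suc i) (sw i (sw (suc i) x))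
sw-braid zero zero = refl
sw-braid zero (suc zero) = refl
sw-braid zero (suc (suc zero)) = refl
sw-braid zero (suc (suc (suc x))) = refl
sw-braid (suc i) zero = refl
sw-braid (suc i) (suc x) = cong suc (sw-braid i x)

Adjacent : ℕ → ℕ → Set
Adjacent i j = i ≡ suc j ⊎ j ≡ suc i

adjacent? : ∀ i j → Dec (Adjacent i j)
adjacent? i j = (i ℕ.≟ suc j) ⊎-dec (j ℕ.≟ suc i)

private
  same-eval : ∀ {n} (u w : Word n) → eval u ≈ eval w → u ≗ᵉ w
  same-eval u w = ≈⇒≗ᵉ {u = u} {w}

commute⇔ : ∀ {n} (i j : Fin n) → (s i · s j ≈ s j · s i) ⇔ (¬ Adjacent (toℕ i) (toℕ j))
commute⇔ i j = mk⇔
  (λ e → [ clash j i (λ x → sym (e x)) , clash i j e ]′)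
  (λ na → ≗ᵉ⇒≈ {u = i ∷ j ∷ []} {j ∷ i ∷ []} λ x →
    sw-commute (toℕ i) (toℕ j) x (na ∘ inj₁) (na ∘ inj₂))
  where
  clash : ∀ {n} (i j : Fin n) → s i · s j ≈ s j · s i → toℕ j ≢ suc (toℕ i)
  clash i j e q = ℕ.1+n≢n (sym (trans (sym lhs) (trans (same-eval (i ∷ j ∷ []) (j ∷ i ∷ []) e (2 + a)) rhs)))
    where
    a = toℕ i
    lhs : sw a (sw (toℕ j) (2 + a)) ≡ a
    lhs = trans (cong (λ z → sw a (sw z (2 + a))) q) (trans (cong (sw a) (sw-right (suc a))) (sw-right a))
    rhs : sw (toℕ j) (sw a (2 + a)) ≡ suc a
    rhs = trans (cong₂ sw q (sw-other a (2 + a) (ℕ.<⇒≢ (ℕ.m≤n+m (suc a) 1) ∘ sym) (ℕ.1+n≢n ∘ ℕ.suc-injective))) (sw-right (suc a))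

-- An entry is located by its column `lab` and its rank `idx` there. In these coordinates the order
-- of entries in neighbouring columns depends only on the content of the site between them.
lab : ∀ {n} (w : Word n) → Entry w → ℕ
lab w x = suc (toℕ (lookup w x))

before : ∀ {n} → ℕ → (w : Word n) → Entry w → ℕ
before c (i ∷ w) zero = 0
before c (i ∷ w) (suc x) = hit c (toℕ i) + before c w x

idx : ∀ {n} (w : Word n) → Entry w → ℕ
idx w x = before (lab w x) w x

before-cnt : ∀ {n} c (w : Word n) x → before c w x ≤ cnt c w
before-cnt c (i ∷ w) zero = z≤n
before-cnt c (i ∷ w) (suc x) = ℕ.+-monoʳ-≤ (hit c (toℕ i)) (before-cnt c w x)

idx-cnt : ∀ {n} (w : Word n) x → idx w x < cnt (lab w x) w
idx-cnt (i ∷ w) zero = ≡≤ (sym (hit-self (toℕ i))) (ℕ.m≤m+n _ _)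
idx-cnt (i ∷ w) (suc x) = subst (_≤ hit (lab w x) (toℕ i) + cnt (lab w x) w) (ℕ.+-suc (hit (lab w x) (toℕ i)) _)
  (ℕ.+-monoʳ-≤ (hit (lab w x) (toℕ i)) (idx-cnt w x))

before-mono : ∀ {n} c (w : Word n) x y → toℕ x ≤ toℕ y → before c w x ≤ before c w y
before-mono c (i ∷ w) zero y p = z≤n
before-mono c (i ∷ w) (suc x) (suc y) (s≤s p) = ℕ.+-monoʳ-≤ (hit c (toℕ i)) (before-mono c w x y p)

idx-before : ∀ {n} (w : Word n) x y → toℕ x < toℕ y → idx w x < before (lab w x) w y
idx-before (i ∷ w) zero (suc y) p = ≡≤ (sym (hit-self (toℕ i))) (ℕ.m≤m+n _ _)
idx-before (i ∷ w) (suc x) (suc y) (s≤s p) = subst (_≤ hit (lab w x) (toℕ i) + before (lab w x) w y)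
  (ℕ.+-suc (hit (lab w x) (toℕ i)) _)
  (ℕ.+-monoʳ-≤ (hit (lab w x) (toℕ i)) (idx-before w x y p))

before⇒< : ∀ {n} (w : Word n) x y → idx w x < before (lab w x) w y → toℕ x < toℕ y
before⇒< w x y p = ℕ.≰⇒> λ q → ℕ.<⇒≱ p (before-mono (lab w x) w y x q)

idx-< : ∀ {n} (w : Word n) x y → lab w x ≡ lab w y → idx w x < idx w y → toℕ x < toℕ y
idx-< w x y e p = before⇒< w x y (subst (λ c → idx w x < before c w y) (sym e) p)

<-idx : ∀ {n} (w : Word n) x y → lab w x ≡ lab w y → toℕ x < toℕ y → idx w x < idx w y
<-idx w x y e p = subst (λ c → idx w x < before c w y) e (idx-before w x y p)

idx-injective : ∀ {n} (w : Word n) x y → lab w x ≡ lab w y → idx w x ≡ idx w y → x ≡ y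
idx-injective w x y e p with ℕ.<-cmp (toℕ x) (toℕ y)
... | tri< q _ _ = contradiction (<-idx w x y e q) (ℕ.<-irrefl p)
... | tri≈ _ q _ = Fin.toℕ-injective q
... | tri> _ _ q = contradiction (<-idx w y x (sym e) q) (ℕ.<-irrefl (sym p))

entry : ∀ {n} (w : Word n) c j → j < cnt c w → ∃[ x ] lab w x ≡ c × idx w x ≡ j
entry (i ∷ w) c j p with c ℕ.≟ suc (toℕ i)
entry (i ∷ w) c zero p | yes refl = zero , refl , refl
entry (i ∷ w) c (suc j) p | yes refl with entry w c j (s≤s⁻¹ (subst (λ z → suc j < z + cnt c w) (hit-self (toℕ i)) p))
... | x , e , q = suc x , e , cong₂ _+_ (trans (cong (λ z → hit z (toℕ i)) e) (hit-self (toℕ i))) q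
entry (i ∷ w) c j p | no ne with entry w c j (subst (λ z → j < z + cnt c w) (hit-other ne) p)
... | x , e , q = suc x , e , cong₂ _+_ (trans (cong (λ z → hit z (toℕ i)) e) (hit-other ne)) q

-- At the site `c` letters labelled `c`, which take a particle away, alternate with letters labelled
-- `c` + 1, which bring one. The former have a head start of one precisely if the site is occupied
-- initially.
before-left : ∀ {n} {V : Config} (w : Word n) → Run V w → ∀ x → let c = toℕ (lookup w x) in
  before c w x ≡ ⟦ V c ⟧ + idx w x
before-left (i ∷ w) ((p , q) , r) zero = cong (λ b → ⟦ b ⟧ + 0) (sym p)
before-left {V = V} (i ∷ w) ((p , q) , r) (suc x) = trans (cong (λ z → hit c j + z) (before-left w r x))
  (trans (lemma (hit c j) ⟦ V (sw j c) ⟧ _) (trans (cong (_+ idx w x) (hop {V} j p q c))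
    (ℕ.+-assoc ⟦ V c ⟧ _ _)))
  where
  c = toℕ (lookup w x)
  j = toℕ i
  lemma : ∀ a b d → a + (b + d) ≡ (b + a) + d
  lemma = ℕR.solve-∀

before-right : ∀ {n} {V : Config} (w : Word n) → Run V w → ∀ x → let c = lab w x in
  ⟦ V c ⟧ + before (suc c) w x ≡ suc (idx w x)
before-right (i ∷ w) ((p , q) , r) zero = cong (λ b → ⟦ b ⟧ + 0) q
before-right {V = V} (i ∷ w) ((p , q) , r) (suc x) = trans (sym (ℕ.+-assoc ⟦ V c ⟧ _ _))
  (trans (cong (_+ before (suc c) w x) (sym (hop {V} j p q c)))
  (trans (lemma ⟦ V (sw j c) ⟧ (hit c j) _) (trans (cong (λ z → hit c j + z) (before-right w r x))
    (ℕ.+-suc (hit c j) _))))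
  where
  c = lab w x
  j = toℕ i
  lemma : ∀ b a d → (b + a) + d ≡ a + (b + d)
  lemma = ℕR.solve-∀

before-left′ : ∀ {n} {V : Config} (w : Word n) → Run V w → ∀ x {c} → lab w x ≡ suc c →
  before c w x ≡ ⟦ V c ⟧ + idx w x
before-left′ w r x refl = before-left w r x

module _ {n : ℕ} {V : Config} (w : Word n) (r : Run V w) where

  private
    between : ∀ x y c → lab w x ≢ c → before c w x < before c w y →
      ∃[ z ] lab w z ≡ c × toℕ x < toℕ z × toℕ z < toℕ y
    between x y c ne more with entry w c (before c w x) (ℕ.<-≤-trans more (before-cnt c w y))
    ... | z , e , q = z , e
      , ℕ.≤∧≢⇒< (ℕ.≮⇒≥ λ b → ℕ.<-irrefl q (subst (λ c → idx w z < before c w x) e (idx-before w z x b)))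
          (λ b → ne (trans (cong (lab w) (Fin.toℕ-injective b)) e))
      , before⇒< w z y (subst₂ (λ i c → i < before c w y) (sym q) (sym e) more)

  between-left : ∀ x y c → lab w x ≡ suc c → lab w y ≡ suc c → toℕ x < toℕ y →
    ∃[ z ] lab w z ≡ c × toℕ x < toℕ z × toℕ z < toℕ y
  between-left x y c ex ey p = between x y c (λ e → ℕ.1+n≢n (trans (sym ex) e))
    (subst₂ _<_ (sym (before-left′ w r x ex)) (sym (before-left′ w r y ey))
      (ℕ.+-monoʳ-< ⟦ V c ⟧ (<-idx w x y (trans ex (sym ey)) p)))

  between-right : ∀ x y → lab w x ≡ lab w y → toℕ x < toℕ y →
    ∃[ z ] lab w z ≡ suc (lab w x) × toℕ x < toℕ z × toℕ z < toℕ y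
  between-right x y e p = between x y (suc c) (ℕ.1+n≢n ∘ sym)
    (ℕ.+-cancelˡ-< ⟦ V c ⟧ _ _ (subst₂ _<_ (sym (before-right w r x))
      (sym (subst (λ c → ⟦ V c ⟧ + before (suc c) w y ≡ suc (idx w y)) (sym e) (before-right w r y)))
      (s≤s (<-idx w x y e p))))
    where c = lab w x

  order⇒idx : ∀ x y c → lab w x ≡ c → lab w y ≡ suc c → toℕ x < toℕ y → idx w x < ⟦ V c ⟧ + idx w y
  order⇒idx x y c refl ey p = subst (idx w x <_) (before-left′ w r y ey) (idx-before w x y p)

  idx⇒order : ∀ x y c → lab w x ≡ c → lab w y ≡ suc c → idx w x < ⟦ V c ⟧ + idx w y → toℕ x < toℕ y
  idx⇒order x y c refl ey p = before⇒< w x y (subst (idx w x <_) (sym (before-left′ w r y ey)) p)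

precedes⇔ : ∀ {n} (w : Word n) x y →
  Precedes w x y ⇔ (toℕ x < toℕ y × Adjacent (lab w x) (lab w y))
precedes⇔ w x y = mk⇔
  (λ (p , nc) → p , (case adjacent? (lab w x) (lab w y) of λ
    { (yes a) → a ; (no na) → contradiction (from (commute⇔ (lookup w x) (lookup w y)) (na ∘ lift)) nc }))
  (λ (p , a) → p , λ e → to (commute⇔ (lookup w x) (lookup w y)) e (unlift a))
  where
  lift : ∀ {i j} → Adjacent i j → Adjacent (suc i) (suc j)
  lift = [ inj₁ ∘ cong suc , inj₂ ∘ cong suc ]′
  unlift : ∀ {i j} → Adjacent (suc i) (suc j) → Adjacent i j
  unlift = [ inj₁ ∘ ℕ.suc-injective , inj₂ ∘ ℕ.suc-injective ]′

heap⇒< : ∀ {n} (w : Word n) {x y} → Heap w x y → toℕ x < toℕ y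
heap⇒< w [ p , _ ] = p
heap⇒< w ((p , _) ∷ h) = ℕ.<-trans p (heap⇒< w h)

adjacent-heap : ∀ {n} (w : Word n) x y → Adjacent (lab w x) (lab w y) → toℕ x < toℕ y → Heap w x y
adjacent-heap w x y a p = [ from (precedes⇔ w x y) (p , a) ]

column-heap : ∀ {n V} (w : Word n) → Run V w → ∀ x y → lab w x ≡ lab w y → toℕ x < toℕ y → Heap w x y
column-heap w r x y e p with between-right w r x y e p
... | z , ez , x<z , z<y = from (precedes⇔ w x z) (x<z , inj₂ ez)
  ∷ adjacent-heap w z y (inj₁ (trans ez (cong suc e))) z<y

-- Heap containment and occurrences of paths

pow2⇔ : ∀ {n} (i j : Fin n) → (pow (s i · s j) 2 ≈ Perm.id) ⇔ (¬ Adjacent (toℕ i) (toℕ j))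
pow2⇔ i j = mk⇔
  (λ e → to (commute⇔ i j) (≗ᵉ⇒≈ {u = i ∷ j ∷ []} {j ∷ i ∷ []} λ x →
    let e′ = ≈⇒≗ᵉ {u = i ∷ j ∷ i ∷ j ∷ []} {[]} e in
    trans (cong (I′ ∘ J′) (sym (trans (cong I′ (sw-involutive (toℕ j) _)) (sw-involutive (toℕ i) x)))) (e′ (J′ (I′ x)))))
  (λ na → ≗ᵉ⇒≈ {u = i ∷ j ∷ i ∷ j ∷ []} {[]} λ x →
    let c = ≈⇒≗ᵉ {u = i ∷ j ∷ []} {j ∷ i ∷ []} (from (commute⇔ i j) na) in
    trans (cong (I′ ∘ J′) (c x)) (trans (cong I′ (sw-involutive (toℕ j) _)) (sw-involutive (toℕ i) x)))
  where
  I′ = sw (toℕ i)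
  J′ = sw (toℕ j)

sw-unequal : ∀ i j → (∀ x → sw i x ≡ sw j x) → i ≡ j
sw-unequal i j e with position j i | trans (sym (sw-left i)) (e i)
... | left | _ = refl
... | right | q = contradiction (trans q (sw-right j)) (ℕ.<⇒≢ (ℕ.m≤n+m (suc j) 1) ∘ sym)
... | other x y | q = contradiction (trans q (sw-other j i x y)) ℕ.1+n≢n

pow3⇔ : ∀ {n} (i j : Fin n) → (pow (s i · s j) 3 ≈ Perm.id) ⇔ (i ≡ j ⊎ Adjacent (toℕ i) (toℕ j))
pow3⇔ {n} i j = mk⇔
  (λ e → case adjacent? (toℕ i) (toℕ j) of λ
    { (yes a) → inj₂ a
    ; (no na) → inj₁ (Fin.toℕ-injective (sw-unequal (toℕ i) (toℕ j) λ x →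
        let e′ = ≈⇒≗ᵉ {u = i ∷ j ∷ i ∷ j ∷ i ∷ j ∷ []} {[]} e
            c = ≈⇒≗ᵉ {u = i ∷ j ∷ i ∷ j ∷ []} {[]} (from (pow2⇔ i j) na) in
        trans (cong I′ (sym (sw-involutive (toℕ j) x))) (trans (sym (c (I′ (J′ (J′ x))))) (e′ (J′ x))))) })
  (λ { (inj₁ refl) → ≗ᵉ⇒≈ {u = i ∷ i ∷ i ∷ i ∷ i ∷ i ∷ []} {[]} λ x →
         trans (sw-involutive (toℕ i) _) (trans (sw-involutive (toℕ i) _) (sw-involutive (toℕ i) x))
     ; (inj₂ (inj₁ a)) → ≗ᵉ⇒≈ {u = i ∷ j ∷ i ∷ j ∷ i ∷ j ∷ []} {[]} λ x →
         trans (cong (I′ ∘ J′ ∘ I′) (sym (braid a x))) (collapse j i x)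
     ; (inj₂ (inj₂ a)) → ≗ᵉ⇒≈ {u = i ∷ j ∷ i ∷ j ∷ i ∷ j ∷ []} {[]} λ x →
         trans (cong (I′ ∘ J′ ∘ I′) (sym (sym (braid a x)))) (collapse j i x) })
  where
  I′ = sw (toℕ i)
  J′ = sw (toℕ j)
  braid : ∀ {a b} → a ≡ suc b → ∀ x → sw a (sw b (sw a x)) ≡ sw b (sw a (sw b x))
  braid refl x = sym (sw-braid _ x)
  collapse : ∀ (j i : Fin n) x → sw (toℕ i) (sw (toℕ j) (sw (toℕ i) (sw (toℕ i) (sw (toℕ j) (sw (toℕ i) x))))) ≡ x
  collapse j i x = trans (cong (sw (toℕ i) ∘ sw (toℕ j)) (sw-involutive (toℕ i) _))
    (trans (cong (sw (toℕ i)) (sw-involutive (toℕ j) _)) (sw-involutive (toℕ i) x))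

Shift : ∀ {k n} → ℕ → (Fin k → Fin n) → Set
Shift d f = ∀ i → toℕ (f i) ≡ d + toℕ i

shift-embedding : ∀ {k n d} {f : Fin k → Fin n} → Shift d f → IsCoxeterEmbedding f
shift-embedding {d = d} {f} sh = record
  { injective = inj
  ; order2 = λ i j → mk⇔
      (λ e → from (pow2⇔ (f i) (f j)) (to (pow2⇔ i j) e ∘ unadj))
      (λ e → from (pow2⇔ i j) (to (pow2⇔ (f i) (f j)) e ∘ adj))
  ; order3 = λ i j → mk⇔
      (λ e → from (pow3⇔ (f i) (f j)) ([ inj₁ ∘ cong f , inj₂ ∘ adj ]′ (to (pow3⇔ i j) e)))
      (λ e → from (pow3⇔ i j) ([ inj₁ ∘ inj , inj₂ ∘ unadj ]′ (to (pow3⇔ (f i) (f j)) e)))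
  ; increasing = λ i j p → subst₂ _<_ (sym (sh i)) (sym (sh j)) (ℕ.+-monoʳ-< d p) }
  where
  inj : ∀ {i j} → f i ≡ f j → i ≡ j
  inj {i} {j} e = Fin.toℕ-injective (ℕ.+-cancelˡ-≡ d _ _ (trans (sym (sh i)) (trans (cong toℕ e) (sh j))))
  adj₁ : ∀ {i j} → toℕ i ≡ suc (toℕ j) → toℕ (f i) ≡ suc (toℕ (f j))
  adj₁ {i} {j} a = trans (sh i) (trans (cong (λ z → d + z) a) (trans (ℕ.+-suc d _) (cong suc (sym (sh j)))))
  unadj₁ : ∀ {i j} → toℕ (f i) ≡ suc (toℕ (f j)) → toℕ i ≡ suc (toℕ j)
  unadj₁ {i} {j} a = ℕ.+-cancelˡ-≡ d _ _ (trans (sym (sh i)) (trans a (trans (cong suc (sh j)) (sym (ℕ.+-suc d _)))))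
  adj : ∀ {i j} → Adjacent (toℕ i) (toℕ j) → Adjacent (toℕ (f i)) (toℕ (f j))
  adj = [ inj₁ ∘ adj₁ , inj₂ ∘ adj₁ ]′
  unadj : ∀ {i j} → Adjacent (toℕ (f i)) (toℕ (f j)) → Adjacent (toℕ i) (toℕ j)
  unadj = [ inj₁ ∘ unadj₁ , inj₂ ∘ unadj₁ ]′

-- By `pow3⇔` neighbouring generators go to equal or neighbouring ones, and since `f` increases, to
-- consecutive ones.
embedding-shift : ∀ {k n} {f : Fin (suc k) → Fin n} → IsCoxeterEmbedding f → Shift (toℕ (f zero)) f
embedding-shift {k} {n} {f} emb = <-weakInduction (λ i → toℕ (f i) ≡ toℕ (f zero) + toℕ i)
  (sym (ℕ.+-identityʳ _))
  (λ i e → trans (next i) (trans (cong suc (trans e (cong (λ z → toℕ (f zero) + z) (Fin.toℕ-inject₁ i)))) (sym (ℕ.+-suc _ _))))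
  where
  open IsCoxeterEmbedding emb
  next : ∀ i → toℕ (f (suc i)) ≡ suc (toℕ (f (inject₁ i)))
  next i with to (pow3⇔ (f (inject₁ i)) (f (suc i))) (to (order3 (inject₁ i) (suc i))
      (from (pow3⇔ (inject₁ i) (suc i)) (inj₂ (inj₂ (cong suc (sym (Fin.toℕ-inject₁ i)))))))
    | increasing (inject₁ i) (suc i) (s≤s (ℕ.≤-reflexive (Fin.toℕ-inject₁ i)))
  ... | inj₁ e | p = contradiction p (ℕ.<-irrefl (cong toℕ e))
  ... | inj₂ (inj₁ e) | p = contradiction (ℕ.≤-reflexive (sym e)) (ℕ.<-asym p)
  ... | inj₂ (inj₂ e) | p = e

sw-shift : ∀ d i c → sw (d + i) (d + c) ≡ d + sw i c
sw-shift zero i c = refl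
sw-shift (suc d) i c = cong suc (sw-shift d i c)

module _ {k n d} {f : Fin k → Fin n} (sh : Shift d f) where

  hit-shift : ∀ c i → hit (d + c) (toℕ (f i)) ≡ hit c (toℕ i)
  hit-shift c i with c ℕ.≟ suc (toℕ i)
  ... | yes refl = trans (cong₂ hit (ℕ.+-suc d (toℕ i)) (sh i)) (trans (hit-self (d + toℕ i)) (sym (hit-self (toℕ i))))
  ... | no ne = trans (hit-other λ e → ne (ℕ.+-cancelˡ-≡ d _ _ (trans e (trans (cong suc (sh i)) (sym (ℕ.+-suc d _))))))
    (sym (hit-other ne))

  cnt-shift : ∀ c w → cnt (d + c) (map f w) ≡ cnt c w
  cnt-shift c [] = refl
  cnt-shift c (i ∷ w) = cong₂ _+_ (hit-shift c i) (cnt-shift c w)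

  cnt-shift-< : ∀ c w → c < d → cnt c (map f w) ≡ 0
  cnt-shift-< c [] p = refl
  cnt-shift-< c (i ∷ w) p = cong₂ _+_
    (hit-other λ e → ℕ.<-asym p (subst (d <_) (sym e) (s≤s (subst (d ≤_) (sym (sh i)) (ℕ.m≤m+n d _)))))
    (cnt-shift-< c w p)

  Run-shift : ∀ {V : Config} w → Run V (map f w) ⇔ Run (λ c → V (d + c)) w
  Run-shift [] = mk⇔ (λ _ → tt) (λ _ → tt)
  Run-shift {V} (i ∷ w) = mk⇔
    (λ ((p , q) , r) → (trans (cong V (sym (sh i))) p , trans (cong V (trans (ℕ.+-suc d _) (cong suc (sym (sh i))))) q)
      , Run-≗ w shifted (to (Run-shift w) r))
    (λ ((p , q) , r) → (trans (cong V (sh i)) p , trans (cong V (trans (cong suc (sh i)) (sym (ℕ.+-suc d _)))) q)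
      , from (Run-shift w) (Run-≗ w (sym ∘ shifted) r))
    where
    shifted : ∀ v → V (sw (toℕ (f i)) (d + v)) ≡ V (d + sw (toℕ i) v)
    shifted v = cong V (trans (cong (λ z → sw z (d + v)) (sh i)) (sw-shift d (toℕ i) v))

-- The lower boundary of an occurrence of q in p extends to a path below the
-- whole of p.

record Lower {b m} (p : Path b m) (D : ℕ) : Set where
  field
    A     : ℕ → ℕ
    S     : Config
    start : A 0 ≡ D
    step  : ∀ c → A (suc c) + ⟦ bots p c ⟧ ≡ A c + ⟦ S c ⟧
    below : ∀ c → A c ≤ hgt p c

private
  cons : {X : Set} → X → (ℕ → X) → ℕ → X
  cons x f zero = x
  cons x f (suc c) = f c

  -- The offset is kept unless the column is too low for it. In that case it has just the height
  -- needed for a boundary that descends by one along with the column.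
  left-end : ∀ {b c} (s : Step b c) D′ → D′ ≤ c → ∃[ D ] ∃[ t ] D ≤ b × D′ + ⟦ bot s ⟧ ≡ D + ⟦ t ⟧
  left-end {b} up D′ p with D′ ℕ.≤? b
  ... | yes q = D′ , false , q , refl
  ... | no q with ℕ.≤-antisym p (ℕ.≰⇒> q)
  ...   | refl = b , true , ℕ.≤-refl , trans (ℕ.+-identityʳ _) (ℕ.+-comm 1 b)
  left-end down D′ p = D′ , true , ℕ.≤-trans p (ℕ.n≤1+n _) , refl
  left-end lo D′ p = D′ , false , p , refl
  left-end hi D′ p = D′ , true , p , refl

  right-end : ∀ {b c} (s : Step b c) D → D ≤ b → ∃[ D′ ] ∃[ t ] D′ ≤ c × D′ + ⟦ bot s ⟧ ≡ D + ⟦ t ⟧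
  right-end up D p = D , false , ℕ.≤-trans p (ℕ.n≤1+n _) , refl
  right-end {suc c} down D p with D ℕ.≤? c
  ... | yes q = D , true , q , refl
  ... | no q with ℕ.≤-antisym p (ℕ.≰⇒> q)
  ...   | refl = c , false , ℕ.≤-refl , trans (ℕ.+-comm c 1) (sym (ℕ.+-identityʳ _))
  right-end lo D p = D , false , p , refl
  right-end hi D p = D , true , p , refl

  extend : ∀ {b c m} (s : Step b c) {p : Path c m} {D D′ t} → D ≤ b → D′ + ⟦ bot s ⟧ ≡ D + ⟦ t ⟧ →
    Lower p D′ → Lower (s ∷ₚ p) D
  extend s {p} {D} {D′} {t} le e L = record
    { A = cons D A ; S = cons t S ; start = refl
    ; step = λ { zero → trans (cong (_+ ⟦ bot s ⟧) start) e ; (suc c) → step c }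
    ; below = λ { zero → le ; (suc c) → below c } }
    where open Lower L

  lower-right : ∀ {b m} (p : Path b m) D → D ≤ b → Lower p D
  lower-right [] D p = record { A = λ _ → 0 ; S = λ _ → false ; start = sym (ℕ.n≤0⇒n≡0 p) ; step = λ _ → refl ; below = λ _ → z≤n }
  lower-right (s ∷ₚ p) D b with right-end s D b
  ... | D′ , t , b′ , e = extend s b e (lower-right p D′ b′)

Around : ∀ {a b l m} (q : Path a l) (p : Path b m) (d : ℕ) {D : ℕ} → Lower p D → Set
Around {l = l} q p d L = (∀ c → A (d + c) + hgt q c ≤ hgt p (d + c)) × (∀ c → c < l → S (d + c) ≡ bots q c)
  where open Lower L

match⇒lower : ∀ {a b l m} D (q : Path a l) (p : Path b m) → Match D q p → Σ (Lower p D) (Around q p 0)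
match⇒lower {b = b} D [] p m = L
  , (λ c → ≡≤ (ℕ.+-identityʳ _) (Lower.below L c)) , λ c ()
  where L = lower-right p D m
match⇒lower {a} {b} D (t ∷ₚ q) (s ∷ₚ p) (d , D′ , e , m) with match⇒lower D′ q p m
... | L , fits , agree = extend s (ℕ.≤-trans (ℕ.m≤m+n D a) d) e L
  , (λ { zero → d ; (suc c) → fits c })
  , (λ { zero _ → refl ; (suc c) (s≤s b) → agree c b })

match-length : ∀ {a b l m} D (q : Path a l) (p : Path b m) → Match D q p → l ≤ m
match-length D [] p m = z≤n
match-length D (_ ∷ₚ q) (_ ∷ₚ p) (_ , D′ , _ , m) = s≤s (match-length D′ q p m)

occurs⇒lower : ∀ {a b l m} (q : Path a l) (p : Path b m) → Occurs q p →
  ∃[ d ] d + l ≤ m × ∃[ D ] D ≤ b × Σ (Lower p D) (Around q p d)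
occurs⇒lower {a} q [] (D , m) = 0 , match-length D q [] m , D , ℕ.≤-trans (ℕ.m≤m+n D a) (Match-bound D q [] m) , match⇒lower D q [] m
occurs⇒lower {a} q (s ∷ₚ p) (inj₁ (D , m)) = 0 , match-length D q (s ∷ₚ p) m , D
  , ℕ.≤-trans (ℕ.m≤m+n D a) (Match-bound D q (s ∷ₚ p) m) , match⇒lower D q (s ∷ₚ p) m
occurs⇒lower q (s ∷ₚ p) (inj₂ o) with occurs⇒lower q p o
... | d , len , D′ , b′ , L , fits , agree with left-end s D′ b′
...   | D , t , b , e = suc d , s≤s len , D , b , extend s b e L , fits , agree

-- Contiguous factors as convex subheaps

embed : ∀ {n} (a u b : Word n) → Entry u → Entry (a ++ u ++ b)
embed [] (i ∷ u) b zero = zero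
embed [] (i ∷ u) b (suc x) = suc (embed [] u b x)
embed (i ∷ a) u b x = suc (embed a u b x)

module _ {n} (a u b : Word n) where

  private
    w = a ++ u ++ b
    ι = embed a u b

  toℕ-embed : ∀ x → toℕ (ι x) ≡ length a + toℕ x
  toℕ-embed = go a u
    where
    go : ∀ a u x → toℕ (embed a u b x) ≡ length a + toℕ x
    go [] (i ∷ u) zero = refl
    go [] (i ∷ u) (suc x) = cong suc (go [] u x)
    go (i ∷ a) u x = cong suc (go a u x)

  column-embed : ∀ x → lookup w (ι x) ≡ lookup u x
  column-embed = go a u
    where
    go : ∀ a u x → lookup (a ++ u ++ b) (embed a u b x) ≡ lookup u x
    go [] (i ∷ u) zero = refl
    go [] (i ∷ u) (suc x) = go [] u x
    go (i ∷ a) u x = go a u x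

  private
    surj : ∀ y → length a ≤ toℕ y → toℕ y < length a + length u → ∃[ x ] ι x ≡ y
    surj = go a u
      where
      go : ∀ a u (y : Entry (a ++ u ++ b)) → length a ≤ toℕ y → toℕ y < length a + length u → ∃[ x ] embed a u b x ≡ y
      go [] (i ∷ u) zero p q = zero , refl
      go [] (i ∷ u) (suc y) p (s≤s q) with go [] u y z≤n q
      ... | x , e = suc x , cong suc e
      go (i ∷ a) u (suc y) (s≤s p) (s≤s q) with go a u y p q
      ... | x , e = x , cong suc e

    middle : ∀ x y z → toℕ (ι x) < toℕ y → toℕ y < toℕ (ι z) → ∃[ c ] ι c ≡ y
    middle x y z p q = surj y
      (ℕ.≤-trans (ℕ.m≤m+n _ _) (≡≤ (sym (toℕ-embed x)) (ℕ.<⇒≤ p)))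
      (ℕ.<-trans q (ℕ.≤-<-trans (ℕ.≤-reflexive (toℕ-embed z)) (ℕ.+-monoʳ-< (length a) (Fin.toℕ<n z))))

    prec : ∀ x y → Precedes u x y ⇔ Precedes w (ι x) (ι y)
    prec x y = mk⇔
      (λ (p , nc) → subst₂ _<_ (sym (toℕ-embed x)) (sym (toℕ-embed y)) (ℕ.+-monoʳ-< (length a) p)
        , subst₂ (λ i j → ¬ (s i · s j ≈ s j · s i)) (sym (column-embed x)) (sym (column-embed y)) nc)
      (λ (p , nc) → ℕ.+-cancelˡ-< (length a) _ _ (subst₂ _<_ (toℕ-embed x) (toℕ-embed y) p)
        , subst₂ (λ i j → ¬ (s i · s j ≈ s j · s i)) (column-embed x) (column-embed y) nc)

    pull : ∀ x y → Heap w (ι x) (ι y) → Heap u x y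
    pull x y h = go x h refl
      where
      go : ∀ x {z} → Heap w (ι x) z → z ≡ ι y → Heap u x y
      go x [ p ] refl = [ from (prec x y) p ]
      go x (p ∷ h) refl with middle x _ y (proj₁ p) (heap⇒< w h)
      ... | c , refl = from (prec x c) p ∷ go c h refl

    push : ∀ {x y} → Heap u x y → Heap w (ι x) (ι y)
    push [ p ] = [ to (prec _ _) p ]
    push (p ∷ h) = to (prec _ _) p ∷ push h

  embed-convex : IsConvexSubheap u w ι
  embed-convex = record
    { injective = λ {x} {y} e → Fin.toℕ-injective (ℕ.+-cancelˡ-≡ (length a) _ _
        (trans (sym (toℕ-embed x)) (trans (cong toℕ e) (toℕ-embed y))))
    ; columns = column-embed
    ; order = λ x y → mk⇔ push (pull x y)
    ; convex = λ x y z p q → middle x y z (heap⇒< w p) (heap⇒< w q) }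

flow-config : ∀ {n V T h} (w : Word n) → Flow n V T h → Run V w → (∀ c → cnt c w ≡ h c) → ∀ c → V (ev w c) ≡ T c
flow-config {V = V} {T} {h} w (step , _) r e c = ⟦⟧-injective (ℕ.+-cancelʳ-≡ (h c) _ _ (begin
  ⟦ V (ev w c) ⟧ + h c ≡⟨ cong (λ z → ⟦ V (ev w c) ⟧ + z) (e c) ⟨
  ⟦ V (ev w c) ⟧ + cnt c w ≡⟨ conservation w r c ⟩
  ⟦ V c ⟧ + cnt (suc c) w ≡⟨ cong (λ z → ⟦ V c ⟧ + z) (e (suc c)) ⟩
  ⟦ V c ⟧ + h (suc c) ≡⟨ ℕ.+-comm ⟦ V c ⟧ _ ⟩
  h (suc c) + ⟦ V c ⟧ ≡⟨ step c ⟩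
  h c + ⟦ T c ⟧ ≡⟨ ℕ.+-comm (h c) _ ⟩
  ⟦ T c ⟧ + h c ∎))
  where open ≡-Reasoning

model-of-word : ∀ {n} {π : Perm n} {P} → Model π P → (w : Word n) → Run (bots P) w → (∀ c → cnt c w ≡ hgt P c) → Model π P
model-of-word M w r e = record { word = w ; run = r ; counts = e ; represents = λ x → trans
    (≗ᵉ⇒≈ {u = w} {word} (Run-determined w word r run (λ c → trans (e c) (sym (counts c)))) x) (represents x) }
  where open Model M

-- A reduced word of `π` is assembled in three layers: `a` fills the heap up to the lower boundary
-- of the occurrence, `u` is the shifted pattern, and `b` supplies the rest. Convexity is automatic,
-- because `u` is a contiguous factor.
occurs⇒contains : ∀ {k n} {π : Perm n} {ρ : Perm k} {P Q} → Model π P → Model ρ Q → Occurs Q P → HeapContains π ρ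
occurs⇒contains {k} {n} {π} {ρ} {P} {Q} M N o with occurs⇒lower Q P o
... | d , len , D , D≤0 , L , fits , agree = record
  { 𝕨 = a ++ u ++ b ; 𝕢 = 𝕢
  ; 𝕨-reduced = model-reduced M′
  ; 𝕢-reduced = model-reduced N
  ; f = f
  ; f-embedding = shift-embedding sh
  ; ι = embed a u b
  ; ι-convex = embed-convex a u b }
  where
  open Lower L
  𝕢 = Model.word N
  bound : ∀ (i : Fin k) → d + toℕ i < n
  bound i = s≤s⁻¹ (ℕ.≤-trans (≡≤ (sym (trans (ℕ.+-suc d _) (cong suc (ℕ.+-suc d _))))
    (ℕ.+-monoʳ-≤ d (s≤s (Fin.toℕ<n i)))) len)
  f : Fin k → Fin n
  f i = fromℕ< (bound i)
  sh : Shift d f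
  sh i = Fin.toℕ-fromℕ< (bound i)
  u = map f 𝕢
  V = bots P
  flow-a : Flow n V S A
  flow-a = step , trans start (ℕ.n≤0⇒n≡0 D≤0) , λ c p → ℕ.n≤0⇒n≡0 (ℕ.≤-trans (below c) (ℕ.≤-reflexive (hgt-outside P c p)))
  real-a = realise n flow-a
  a = proj₁ real-a
  run-a = proj₁ (proj₂ real-a)
  cnt-a = proj₂ (proj₂ real-a)
  run-u : Run S u
  run-u = from (Run-shift sh {S} 𝕢) (Run-cong 𝕢 (λ v p → sym (agree v (touched v p))) (Model.run N))
    where
    touched : ∀ v → 0 < cnt v 𝕢 + cnt (suc v) 𝕢 → v < suc k
    touched v p = ℕ.≰⇒> λ q → contradiction (cong₂ _+_ (cnt-outside v 𝕢 q) (cnt-outside (suc v) 𝕢 (ℕ.m≤n⇒m≤1+n q))) (ℕ.m<n⇒n≢0 p)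
  cnt-u : ∀ c → cnt (d + c) u ≡ hgt Q c
  cnt-u c = trans (cnt-shift sh c 𝕢) (Model.counts N c)
  stacked : ∀ c → A c + cnt c u ≤ hgt P c
  stacked c with d ℕ.≤? c
  ... | yes p = subst (λ c → A c + cnt c u ≤ hgt P c) (ℕ.m+[n∸m]≡n p)
    (subst (λ z → A (d + (c ∸ d)) + z ≤ hgt P (d + (c ∸ d))) (sym (cnt-u (c ∸ d))) (fits (c ∸ d)))
  ... | no p = subst (λ z → A c + z ≤ hgt P c) (sym (cnt-shift-< sh c 𝕢 (ℕ.≰⇒> p)))
    (≡≤ (ℕ.+-identityʳ _) (below c))
  -- What is left above the pattern; by `stacked` the subtraction is not cut off.
  h : ℕ → ℕ
  h c = hgt P c ∸ (A c + cnt c u)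
  h-total : ∀ c → A c + cnt c u + h c ≡ hgt P c
  h-total c = ℕ.m+[n∸m]≡n (stacked c)
  flow-b : Flow n (S ∘ ev u) (tops P) h
  flow-b = (λ c → ℕ.+-cancelˡ-≡ ((A (suc c) + cnt (suc c) u) + (⟦ S c ⟧ + ⟦ V c ⟧)) _ _ (step-b c))
    , trans (cong (_∸ (A 0 + cnt 0 u)) (hgt-start P)) (ℕ.0∸n≡0 (A 0 + cnt 0 u))
    , (λ c p → trans (cong (_∸ (A c + cnt c u)) (hgt-outside P c p)) (ℕ.0∸n≡0 (A c + cnt c u)))
    where
    open ≡-Reasoning
    step-b : ∀ c → ((A (suc c) + cnt (suc c) u) + (⟦ S c ⟧ + ⟦ V c ⟧)) + (h (suc c) + ⟦ S (ev u c) ⟧) ≡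
                   ((A (suc c) + cnt (suc c) u) + (⟦ S c ⟧ + ⟦ V c ⟧)) + (h c + ⟦ tops P c ⟧)
    step-b c = begin
      ((A′ + U′) + (S₀ + V₀)) + (h (suc c) + E)
        ≡⟨ lemma₁ A′ U′ S₀ V₀ (h (suc c)) E ⟩
      ((A′ + U′ + h (suc c)) + V₀) + (S₀ + E)
        ≡⟨ cong (λ z → (z + V₀) + (S₀ + E)) (h-total (suc c)) ⟩
      (hgt P (suc c) + V₀) + (S₀ + E)
        ≡⟨ cong (_+ (S₀ + E)) (path-step P c) ⟩
      (hgt P c + T₀) + (S₀ + E)
        ≡⟨ cong (λ z → (z + T₀) + (S₀ + E)) (h-total c) ⟨
      ((A c + cnt c u + h c) + T₀) + (S₀ + E)
        ≡⟨ lemma₂ (A c) (cnt c u) (h c) T₀ S₀ E ⟩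
      (A c + S₀) + (E + cnt c u) + (h c + T₀)
        ≡⟨ cong (_+ (h c + T₀)) (cong₂ _+_ (sym (step c)) (conservation u run-u c)) ⟩
      (A′ + V₀) + (S₀ + U′) + (h c + T₀)
        ≡⟨ lemma₃ A′ V₀ S₀ U′ (h c + T₀) ⟩
      ((A′ + U′) + (S₀ + V₀)) + (h c + T₀) ∎
      where
      A′ = A (suc c)
      U′ = cnt (suc c) u
      S₀ = ⟦ S c ⟧
      V₀ = ⟦ V c ⟧
      T₀ = ⟦ tops P c ⟧
      E = ⟦ S (ev u c) ⟧
      lemma₁ : ∀ a u s v h e → ((a + u) + (s + v)) + (h + e) ≡ ((a + u + h) + v) + (s + e)
      lemma₁ = ℕR.solve-∀
      lemma₂ : ∀ a u h t s e → ((a + u + h) + t) + (s + e) ≡ (a + s) + (e + u) + (h + t)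
      lemma₂ = ℕR.solve-∀
      lemma₃ : ∀ a v s u x → (a + v) + (s + u) + x ≡ ((a + u) + (s + v)) + x
      lemma₃ = ℕR.solve-∀
  real-b = realise n flow-b
  b = proj₁ real-b
  V∘a : ∀ c → S c ≡ V (ev a c)
  V∘a c = sym (flow-config a flow-a run-a cnt-a c)
  M′ : Model π P
  M′ = model-of-word M (a ++ u ++ b)
    (Run-++ a (u ++ b) run-a (Run-≗ (u ++ b) V∘a (Run-++ u b run-u (proj₁ (proj₂ real-b)))))
    (λ c → begin
      cnt c (a ++ u ++ b) ≡⟨ cnt-++ c a (u ++ b) ⟩
      cnt c a + cnt c (u ++ b) ≡⟨ cong₂ _+_ (cnt-a c) (cnt-++ c u b) ⟩
      A c + (cnt c u + cnt c b) ≡⟨ ℕ.+-assoc (A c) (cnt c u) (cnt c b) ⟨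
      A c + cnt c u + cnt c b ≡⟨ cong (λ z → A c + cnt c u + z) (proj₂ (proj₂ real-b) c) ⟩
      A c + cnt c u + h c ≡⟨ h-total c ⟩
      hgt P c ∎)
    where open ≡-Reasoning

-- From convex subheaps to occurrences

steps⇒match : ∀ {a b l m} (q : Path a (suc l)) (p : Path b m) → Positive q → suc l ≤ m → (D : ℕ → ℕ) →
  (∀ c → c ≤ l → D c + hgt q c ≤ hgt p c) →
  (∀ c → c < l → D (suc c) + ⟦ bots p c ⟧ ≡ D c + ⟦ bots q c ⟧) → Match (D 0) q p
steps⇒match (down ∷ₚ []) (s ∷ₚ p) pos _ D fits eqs = Match-final (D 0) s p (≡≤ (ℕ.+-comm 1 (D 0)) (fits 0 z≤n))
steps⇒match (t ∷ₚ q@(_ ∷ₚ _)) (s ∷ₚ p) (_ , pos) (s≤s le) D fits eqs = fits 0 z≤n , D 1 , eqs 0 (s≤s z≤n)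
  , steps⇒match q p pos le (D ∘ suc) (λ c c≤ → fits (suc c) (s≤s c≤)) (λ c c< → eqs (suc c) (s≤s c<))

steps⇒occurs : ∀ {a b l m} d (q : Path a (suc l)) (p : Path b m) → Positive q → d + suc l ≤ m → (D : ℕ → ℕ) →
  (∀ c → c ≤ l → D c + hgt q c ≤ hgt p (d + c)) →
  (∀ c → c < l → D (suc c) + ⟦ bots p (d + c) ⟧ ≡ D c + ⟦ bots q c ⟧) → Occurs q p
steps⇒occurs zero q (s ∷ₚ p) pos le D fits eqs = inj₁ (D 0 , steps⇒match q (s ∷ₚ p) pos le D fits eqs)
steps⇒occurs (suc d) q (s ∷ₚ p) pos (s≤s le) D fits eqs = inj₂ (steps⇒occurs d q p pos le D fits eqs)

-- An interleaving of two columns with a and b entries that matches the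
-- interleaving of entries D, D + 1, … and D′, D′ + 1, … of two columns of a
-- larger heap is shifted by the same amount on both sides, provided that no
-- further entry lies between the matched ones.

private
  offset-relation : ∀ (U T V : Bool) {D D′ a b} → suc a + ⟦ T ⟧ ≡ suc b + ⟦ U ⟧ →
    ⟦ V ⟧ + D′ + b ≤ D + suc a → D + a < ⟦ V ⟧ + D′ + suc b →
    (∀ i j → i ≤ a → j ≤ b → i < ⟦ U ⟧ + j ⇔ D + i < ⟦ V ⟧ + D′ + j) →
    ⟦ V ⟧ + D′ ≡ D + ⟦ U ⟧
  offset-relation U T V {D} {D′} = go U T (⟦ V ⟧ + D′)
    where
    drop : ∀ {x y} c → x + c ≤ y + c → x ≤ y
    drop c p = ℕ.+-cancelʳ-≤ c _ _ p
    drop-suc : ∀ {x y} c → suc (x + c) ≤ y + suc c → x ≤ y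
    drop-suc {x} {y} c p = drop c (s≤s⁻¹ (subst (suc (x + c) ≤_) (ℕ.+-suc y c) p))
    go : ∀ U T E {a b} → suc a + ⟦ T ⟧ ≡ suc b + ⟦ U ⟧ → E + b ≤ D + suc a → D + a < E + suc b →
      (∀ i j → i ≤ a → j ≤ b → i < ⟦ U ⟧ + j ⇔ D + i < E + j) → E ≡ D + ⟦ U ⟧
    -- The bits `U` and `T` tell which column is first and which is last. In each of the four cases
    -- one bound on `E` comes from a matched pair at an end of the columns, the other from the
    -- absence of further entries.
    go false false E {a} {b} e c₁ c₂ iso with ℕ.+-cancelʳ-≡ 0 a b (ℕ.suc-injective e)
    ... | refl = trans (ℕ.≤-antisym
        (drop 0 (ℕ.≮⇒≥ λ p → ℕ.<-irrefl refl (from (iso 0 0 z≤n z≤n) p))) (drop-suc a c₂)) (sym (ℕ.+-identityʳ D))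
    go true true E {a} {b} e c₁ c₂ iso with ℕ.+-cancelʳ-≡ 1 a b (ℕ.suc-injective e)
    ... | refl = ℕ.≤-antisym (drop a (ℕ.≤-trans c₁ (ℕ.≤-reflexive (sym (ℕ.+-assoc D 1 a)))))
        (≡≤ (trans (ℕ.+-comm D 1) (cong suc (sym (ℕ.+-identityʳ D))))
          (ℕ.≤-trans (to (iso 0 0 z≤n z≤n) (s≤s z≤n)) (ℕ.≤-reflexive (ℕ.+-identityʳ E))))
    go false true E {a} {b} e c₁ c₂ iso with trans (ℕ.+-comm 1 a) (trans (ℕ.suc-injective e) (ℕ.+-identityʳ b))
    ... | refl = trans (ℕ.≤-antisym (drop (suc a) c₁)
        (drop-suc a (to (iso a (suc a) ℕ.≤-refl ℕ.≤-refl) ℕ.≤-refl))) (sym (ℕ.+-identityʳ D))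
    go true false E {a} {b} e c₁ c₂ iso with trans (sym (ℕ.+-identityʳ a)) (trans (ℕ.suc-injective e) (ℕ.+-comm b 1))
    ... | refl = ℕ.≤-antisym
        (drop b (ℕ.≤-trans (ℕ.≮⇒≥ λ p → ℕ.<-irrefl refl (from (iso (suc b) b ℕ.≤-refl ℕ.≤-refl) p))
          (ℕ.≤-reflexive (sym (ℕ.+-assoc D 1 b)))))
        (≡≤ (ℕ.+-comm D 1) (drop (suc b) c₂))

module Subheap {n} {U V : Config} (u w : Word n) (run-u : Run U u) (run-w : Run V w)
  (ι : Entry u → Entry w) (sub : IsConvexSubheap u w ι) where
  open IsConvexSubheap sub

  private
    lab-ι : ∀ x → lab w (ι x) ≡ lab u x
    lab-ι x = cong (suc ∘ toℕ) (columns x)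

    column-mono : ∀ x y → lab u x ≡ lab u y → toℕ x < toℕ y → toℕ (ι x) < toℕ (ι y)
    column-mono x y e p = heap⇒< w (to (order x y) (column-heap u run-u x y e p))

    -- By convexity an entry strictly between the two images would come from an entry of `u`
    -- strictly between two consecutive ones. Every column is therefore embedded by a translation.
    consecutive : ∀ x y → lab u x ≡ lab u y → idx u y ≡ suc (idx u x) → idx w (ι y) ≡ suc (idx w (ι x))
    consecutive x y e s = sym (ℕ.≤-antisym lower (ℕ.≮⇒≥ gap))
      where
      e′ : lab w (ι x) ≡ lab w (ι y)
      e′ = trans (lab-ι x) (trans e (sym (lab-ι y)))
      lower : suc (idx w (ι x)) ≤ idx w (ι y)
      lower = <-idx w (ι x) (ι y) e′ (column-mono x y e (idx-< u x y e (ℕ.≤-reflexive (sym s))))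
      gap : ¬ suc (idx w (ι x)) < idx w (ι y)
      gap p with entry w (lab w (ι y)) (suc (idx w (ι x))) (ℕ.<-trans p (idx-cnt w (ι y)))
      ... | z , ez , iz with convex x z y
              (column-heap w run-w (ι x) z (trans e′ (sym ez)) (idx-< w (ι x) z (trans e′ (sym ez)) (ℕ.≤-reflexive (sym iz))))
              (column-heap w run-w z (ι y) ez (idx-< w z (ι y) ez (subst (_< idx w (ι y)) (sym iz) p)))
      ...   | c , refl = ℕ.<-irrefl refl (ℕ.<-≤-trans (idx⇒ c y c≡y (from (order c y) (column-heap w run-w (ι c) (ι y) ez
                (idx-< w (ι c) (ι y) ez (subst (_< idx w (ι y)) (sym iz) p)))))
              (≡≤ s (idx⇒ x c (trans e (sym c≡y)) (from (order x c) (column-heap w run-w (ι x) (ι c) (trans e′ (sym ez))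
                (idx-< w (ι x) (ι c) (trans e′ (sym ez)) (ℕ.≤-reflexive (sym iz))))))))
        where
        c≡y : lab u c ≡ lab u y
        c≡y = trans (sym (lab-ι c)) (trans ez (lab-ι y))
        idx⇒ : ∀ x y → lab u x ≡ lab u y → Heap u x y → idx u x < idx u y
        idx⇒ x y e h = <-idx u x y e (heap⇒< u h)

  offset : ∀ c → ∃[ D ] ∀ x → lab u x ≡ c → idx w (ι x) ≡ D + idx u x
  offset c with 0 ℕ.<? cnt c u
  ... | no p = 0 , λ x e → contradiction (ℕ.≤-<-trans z≤n (subst (λ c → idx u x < cnt c u) e (idx-cnt u x))) p
  ... | yes p with entry u c 0 p
  ...   | x₀ , e₀ , i₀ = idx w (ι x₀) , λ x e → go (idx u x) x e refl
    where
    go : ∀ j x → lab u x ≡ c → idx u x ≡ j → idx w (ι x) ≡ idx w (ι x₀) + idx u x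
    go zero x e i = trans (cong (idx w ∘ ι) (idx-injective u x x₀ (trans e (sym e₀)) (trans i (sym i₀))))
      (sym (trans (cong (λ z → idx w (ι x₀) + z) i) (ℕ.+-identityʳ _)))
    go (suc j) x e i with entry u c j (ℕ.<-trans (ℕ.n<1+n j) (subst₂ (λ j c → j < cnt c u) i e (idx-cnt u x)))
    ... | y , ey , iy = trans (consecutive y x (trans ey (sym e)) (trans i (cong suc (sym iy))))
      (trans (cong suc (go j y ey iy)) (trans (sym (ℕ.+-suc _ _)) (cong (λ z → idx w (ι x₀) + z) (trans (cong suc iy) (sym i)))))

  D : ℕ → ℕ
  D c = proj₁ (offset c)

  D-idx : ∀ {c} x → lab u x ≡ c → idx w (ι x) ≡ D c + idx u x
  D-idx {c} = proj₂ (offset c)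

  D-bound : ∀ c → 0 < cnt c u → D c + cnt c u ≤ cnt c w
  D-bound c p = go (cnt c u) refl p
    where
    go : ∀ a → cnt c u ≡ a → 0 < a → D c + a ≤ cnt c w
    go (suc a) eq _ with entry u c a (ℕ.≤-reflexive (sym eq))
    ... | x , e , i = ≡≤ (trans (ℕ.+-suc (D c) a) (cong suc (trans (cong (λ z → D c + z) (sym i)) (sym (D-idx x e)))))
          (subst (λ c → idx w (ι x) < cnt c w) (trans (lab-ι x) e) (idx-cnt w (ι x)))

  private
    module _ (c : ℕ) {a b} (cnt-c : cnt c u ≡ suc a) (cnt-c′ : cnt (suc c) u ≡ suc b) where

      entryX : ∀ i → i ≤ a → ∃[ x ] lab u x ≡ c × idx u x ≡ i
      entryX i p = entry u c i (subst (i <_) (sym cnt-c) (s≤s p))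

      entryY : ∀ j → j ≤ b → ∃[ y ] lab u y ≡ suc c × idx u y ≡ j
      entryY j p = entry u (suc c) j (subst (j <_) (sym cnt-c′) (s≤s p))

      idx-X : ∀ i (p : i ≤ a) → idx w (ι (proj₁ (entryX i p))) ≡ D c + i
      idx-X i p = trans (D-idx (proj₁ (entryX i p)) (proj₁ (proj₂ (entryX i p)))) (cong (λ z → D c + z) (proj₂ (proj₂ (entryX i p))))

      idx-Y : ∀ j (p : j ≤ b) → idx w (ι (proj₁ (entryY j p))) ≡ D (suc c) + j
      idx-Y j p = trans (D-idx (proj₁ (entryY j p)) (proj₁ (proj₂ (entryY j p)))) (cong (λ z → D (suc c) + z) (proj₂ (proj₂ (entryY j p))))

      lab-X : ∀ i (p : i ≤ a) → lab w (ι (proj₁ (entryX i p))) ≡ c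
      lab-X i p = trans (lab-ι _) (proj₁ (proj₂ (entryX i p)))

      lab-Y : ∀ j (p : j ≤ b) → lab w (ι (proj₁ (entryY j p))) ≡ suc c
      lab-Y j p = trans (lab-ι _) (proj₁ (proj₂ (entryY j p)))

      iso : ∀ i j → i ≤ a → j ≤ b → i < ⟦ U c ⟧ + j ⇔ D c + i < ⟦ V c ⟧ + D (suc c) + j
      iso i j p q = mk⇔
        (λ r → subst₂ _<_ (idx-X i p) (trans (cong (λ z → ⟦ V c ⟧ + z) (idx-Y j q)) (sym (ℕ.+-assoc ⟦ V c ⟧ _ _)))
          (order⇒idx w run-w (ι x) (ι y) c (lab-X i p) (lab-Y j q)
            (heap⇒< w (to (order x y) (adjacent-heap u x y adj
              (idx⇒order u run-u x y c ex ey (subst₂ (λ i j → i < ⟦ U c ⟧ + j) (sym ix) (sym iy) r)))))))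
        (λ r → subst₂ (λ i j → i < ⟦ U c ⟧ + j) ix iy (order⇒idx u run-u x y c ex ey
          (heap⇒< u (from (order x y) (adjacent-heap w (ι x) (ι y) adj′
            (idx⇒order w run-w (ι x) (ι y) c (lab-X i p) (lab-Y j q)
              (subst₂ _<_ (sym (idx-X i p)) (trans (ℕ.+-assoc ⟦ V c ⟧ _ _) (cong (λ z → ⟦ V c ⟧ + z) (sym (idx-Y j q)))) r)))))))
        where
        x = proj₁ (entryX i p)
        y = proj₁ (entryY j q)
        ex = proj₁ (proj₂ (entryX i p))
        ey = proj₁ (proj₂ (entryY j q))
        ix = proj₂ (proj₂ (entryX i p))
        iy = proj₂ (proj₂ (entryY j q))
        adj : Adjacent (lab u x) (lab u y)
        adj = inj₂ (trans ey (cong suc (sym ex)))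
        adj′ : Adjacent (lab w (ι x)) (lab w (ι y))
        adj′ = inj₂ (trans (lab-Y j q) (cong suc (sym (lab-X i p))))

      -- Otherwise the entry D + suc a of column c would lie between two matched
      -- entries.

      no-extra-left : ⟦ V c ⟧ + D (suc c) + b ≤ D c + suc a
      no-extra-left = ℕ.≮⇒≥ λ p → absurd (subst (D c + suc a <_) (trans (ℕ.+-assoc ⟦ V c ⟧ _ _)
            (trans (cong (λ z → ⟦ V c ⟧ + z) (sym (idx-Y b ℕ.≤-refl))) (sym (before-left′ w run-w (ι y) (lab-Y b ℕ.≤-refl))))) p)
        where
        x = proj₁ (entryX a ℕ.≤-refl)
        y = proj₁ (entryY b ℕ.≤-refl)
        absurd : ¬ (D c + suc a < before c w (ι y))
        absurd p with entry w c (D c + suc a) (ℕ.<-≤-trans p (before-cnt c w (ι y)))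
        ... | z , ez , iz with convex x z y
                (column-heap w run-w (ι x) z (trans (lab-X a ℕ.≤-refl) (sym ez)) (idx-< w (ι x) z (trans (lab-X a ℕ.≤-refl) (sym ez))
                  (subst₂ _<_ (sym (idx-X a ℕ.≤-refl)) (sym iz) (ℕ.+-monoʳ-< (D c) (ℕ.n<1+n a)))))
                (adjacent-heap w z (ι y) (inj₂ (trans (lab-Y b ℕ.≤-refl) (cong suc (sym ez))))
                  (before⇒< w z (ι y) (subst₂ (λ i c → i < before c w (ι y)) (sym iz) (sym ez) p)))
        ...   | v , refl = ℕ.<-irrefl (trans (sym (D-idx v ev′)) iz)
                  (ℕ.+-monoʳ-< (D c) (subst (idx u v <_) cnt-c (subst (λ c → idx u v < cnt c u) ev′ (idx-cnt u v))))
          where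
          ev′ : lab u v ≡ c
          ev′ = trans (sym (lab-ι v)) ez

      no-extra-right : D c + a < ⟦ V c ⟧ + D (suc c) + suc b
      no-extra-right = ℕ.≰⇒> λ p → absurd (ℕ.+-cancelˡ-≤ ⟦ V c ⟧ _ _ (begin
          ⟦ V c ⟧ + suc (D (suc c) + suc b) ≡⟨ ℕ.+-suc ⟦ V c ⟧ _ ⟩
          suc (⟦ V c ⟧ + (D (suc c) + suc b)) ≡⟨ cong suc (ℕ.+-assoc ⟦ V c ⟧ _ _) ⟨
          suc (⟦ V c ⟧ + D (suc c) + suc b) ≤⟨ s≤s p ⟩
          suc (D c + a) ≡⟨ cong suc (idx-X a ℕ.≤-refl) ⟨
          suc (idx w (ι x)) ≡⟨ subst (λ c → ⟦ V c ⟧ + before (suc c) w (ι x) ≡ suc (idx w (ι x))) (lab-X a ℕ.≤-refl) (before-right w run-w (ι x)) ⟨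
          ⟦ V c ⟧ + before (suc c) w (ι x) ∎))
        where
        open ℕ.≤-Reasoning
        x = proj₁ (entryX a ℕ.≤-refl)
        y = proj₁ (entryY b ℕ.≤-refl)
        absurd : ¬ (D (suc c) + suc b < before (suc c) w (ι x))
        absurd p with entry w (suc c) (D (suc c) + suc b) (ℕ.<-≤-trans p (before-cnt (suc c) w (ι x)))
        ... | z , ez , iz with convex y z x
                (column-heap w run-w (ι y) z (trans (lab-Y b ℕ.≤-refl) (sym ez)) (idx-< w (ι y) z (trans (lab-Y b ℕ.≤-refl) (sym ez))
                  (subst₂ _<_ (sym (idx-Y b ℕ.≤-refl)) (sym iz) (ℕ.+-monoʳ-< (D (suc c)) (ℕ.n<1+n b)))))
                (adjacent-heap w z (ι x) (inj₁ (trans ez (cong suc (sym (lab-X a ℕ.≤-refl)))))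
                  (before⇒< w z (ι x) (subst₂ (λ i c → i < before c w (ι x)) (sym iz) (sym ez) p)))
        ...   | v , refl = ℕ.<-irrefl (trans (sym (D-idx v ev′)) iz)
                  (ℕ.+-monoʳ-< (D (suc c)) (subst (idx u v <_) cnt-c′ (subst (λ c → idx u v < cnt c u) ev′ (idx-cnt u v))))
          where
          ev′ : lab u v ≡ suc c
          ev′ = trans (sym (lab-ι v)) ez

      D-step′ : ⟦ V c ⟧ + D (suc c) ≡ D c + ⟦ U c ⟧
      D-step′ = offset-relation (U c) (U (ev u c)) (V c)
        (trans (ℕ.+-comm (suc a) _) (trans (cong (λ z → ⟦ U (ev u c) ⟧ + z) (sym cnt-c))
          (trans (conservation u run-u c) (trans (cong (λ z → ⟦ U c ⟧ + z) cnt-c′) (ℕ.+-comm ⟦ U c ⟧ (suc b))))))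
        no-extra-left no-extra-right iso

  D-step : ∀ c → 0 < cnt c u → 0 < cnt (suc c) u → D (suc c) + ⟦ V c ⟧ ≡ D c + ⟦ U c ⟧
  D-step c p q = go (cnt c u) (cnt (suc c) u) refl refl p q
    where
    go : ∀ a b → cnt c u ≡ a → cnt (suc c) u ≡ b → 0 < a → 0 < b → D (suc c) + ⟦ V c ⟧ ≡ D c + ⟦ U c ⟧
    go (suc a) (suc b) e e′ _ _ = trans (ℕ.+-comm _ ⟦ V c ⟧) (D-step′ c e e′)

-- The column before the initial `up` is empty and has no entries that could fix an offset, so
-- `Occurs-up` disposes of this step first; all other columns of the pattern are occupied.
contains⇒occurs : ∀ {k n} {π : Perm n} {ρ : Perm (suc k)} {P} {q : Path 1 (suc k)} → Positive q →
  Model π P → Model ρ (up ∷ₚ q) → HeapContains π ρ → Occurs (up ∷ₚ q) P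
contains⇒occurs {k} {n} {P = s ∷ₚ p} {q} pos M N hc = from (Occurs-up q s p)
  (steps⇒occurs d q p pos (≡≤ (ℕ.+-suc d k) last-column) (λ c → D (suc (d + c)))
    (λ c c≤k → subst₂ (λ x y → D (suc (d + c)) + x ≤ y) (cnt-u c) (proj₂ red-w (suc (d + c)))
      (D-bound (suc (d + c)) (occupied c c≤k)))
    (λ c c<k → subst₂ (λ x y → D x + ⟦ bots p (d + c) ⟧ ≡ D (suc (d + c)) + ⟦ y ⟧)
      (cong suc (sym (ℕ.+-suc d c))) (U-shift c)
      (D-step (suc (d + c)) (occupied c (ℕ.<⇒≤ c<k)) (subst (λ z → 0 < cnt (suc z) u) (ℕ.+-suc d c) (occupied (suc c) c<k)))))
  where
  open HeapContains hc
  d = toℕ (f zero)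
  sh : Shift d f
  sh = embedding-shift f-embedding
  u = map f 𝕢
  Q = up ∷ₚ q
  red-w = model-word M 𝕨-reduced
  red-q = model-word N 𝕢-reduced
  U : Config
  -- The values below `d` are arbitrary: the letters of `u` touch only sites from `d` on.
  U v = bots Q (v ∸ d)
  run-u : Run U u
  run-u = from (Run-shift sh {U} 𝕢) (Run-≗ 𝕢 (λ v → cong (bots Q) (sym (ℕ.m+n∸m≡n d v))) (proj₁ red-q))
  open Subheap u 𝕨 run-u (proj₁ red-w) ι ι-convex
  cnt-u : ∀ c → cnt (suc (d + c)) u ≡ hgt q c
  cnt-u c = trans (cong (λ z → cnt z u) (sym (ℕ.+-suc d c))) (trans (cnt-shift sh (suc c) 𝕢) (proj₂ red-q (suc c)))
  occupied : ∀ c → c ≤ k → 0 < cnt (suc (d + c)) u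
  occupied c p = subst (0 <_) (sym (cnt-u c)) (positive⇒hgt q pos c (s≤s p))
  U-shift : ∀ c → U (suc (d + c)) ≡ bots q c
  U-shift c = cong (bots Q) (trans (cong (_∸ d) (sym (ℕ.+-suc d c))) (ℕ.m+n∸m≡n d (suc c)))
  last-column : d + k < n
  last-column = subst (_< n) (trans (sh (fromℕ k)) (cong (λ z → d + z) (Fin.toℕ-fromℕ k))) (Fin.toℕ<n (f (fromℕ k)))

-- Fully commutative permutations are 321-avoiding

-- All that is retained of full commutativity: a braid move would change two counts, commutations
-- change none.
Tight : ∀ {n} → Word n → Set
Tight {n} w = ∀ (u : Word n) → u ≗ᵉ w → length u ≤ length w → ∀ c → cnt c u ≡ cnt c w

infix 9 _[_≔_]
abstract
  _[_≔_] : Config → ℕ → Bool → Config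
  (V [ v ≔ β ]) x with x ℕ.≟ v
  ... | yes _ = β
  ... | no _ = V x

  ≔-self : ∀ V v β → (V [ v ≔ β ]) v ≡ β
  ≔-self V v β with v ℕ.≟ v
  ... | yes _ = refl
  ... | no ne = contradiction refl ne

  ≔-other : ∀ V v β {x} → x ≢ v → (V [ v ≔ β ]) x ≡ V x
  ≔-other V v β {x} p with x ℕ.≟ v
  ... | yes e = contradiction e p
  ... | no _ = refl

≔-trivial : ∀ V v β → V v ≡ β → ∀ x → V x ≡ (V [ v ≔ β ]) x
≔-trivial V v β e x with x ℕ.≟ v
... | yes refl = trans e (sym (≔-self V v β))
... | no ne = sym (≔-other V v β ne)

-- If the letters of a tight word u all move particles, then so do those of
-- i ∷ u, provided that the initial content of both sites of i may be
-- prescribed.  A site v of i resists only if, among the letters that touch it,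
-- the first one in u is i itself; but then commutations and at most one braid
-- move lower the number of letters i.  At the site v the neighbours of i are of
-- the kind Same if they need the content β of v, otherwise they touch the other
-- site v′ of i and leave the content β there.

module _ {n} (i : Fin n) where
  private
    j = toℕ i

    Far : Fin n → Set
    Far l = ¬ Adjacent j (toℕ l) × toℕ l ≢ j

    away : ∀ {l v} → v ≡ j ⊎ v ≡ suc j → Far l → v ≢ toℕ l × v ≢ suc (toℕ l)
    away (inj₁ refl) (na , ne) = (λ e → ne (sym e)) , (λ e → na (inj₁ e))
    away (inj₂ refl) (na , ne) = (λ e → na (inj₂ (sym e))) , (λ e → ne (sym (ℕ.suc-injective e)))

    far-commute : ∀ {l} → Far l → ∀ x → sw (toℕ l) (sw j x) ≡ sw j (sw (toℕ l) x)
    far-commute {l} (na , _) x = sw-commute (toℕ l) j x (na ∘ inj₂) (na ∘ inj₁)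

  Fewer : Word n → Set
  Fewer w = ∃[ u ] u ≗ᵉ w × length u ≤ length w × cnt (suc j) u < cnt (suc j) w

  Pull : Word n → Set
  Pull w = ∃[ u ] (i ∷ u) ≗ᵉ w × suc (length u) ≡ length w × suc (cnt (suc j) u) ≡ cnt (suc j) w

  module Side (v v′ : ℕ) (β : Bool) (v-at : v ≡ j ⊎ v ≡ suc j) (v′-at : v′ ≡ j ⊎ v′ ≡ suc j)
    (Same Opposite : Fin n → Set)
    (classify : ∀ l → l ≡ i ⊎ Same l ⊎ Opposite l ⊎ Far l)
    (same-bit : ∀ V l u → Same l → Run V (l ∷ u) → V v ≡ β)
    (opposite-bit : ∀ V l u → Opposite l → Run V (l ∷ u) → V v′ ≡ not β × V (sw (toℕ l) v′) ≡ β)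
    (opposite-adjacent : ∀ {l} → Opposite l → Adjacent j (toℕ l))
    (opposite-away : ∀ {l} → Opposite l → v ≢ toℕ l × v ≢ suc (toℕ l))
    where

    private
      away-step : ∀ {V} {l : Fin n} {u} → v ≢ toℕ l × v ≢ suc (toℕ l) → Run V (l ∷ u) →
        Run ((V ∘ sw (toℕ l)) [ v ≔ β ]) u → Run (V [ v ≔ β ]) (l ∷ u)
      away-step {V} {l} {u} (a , b) ((p , q) , _) r =
        (trans (≔-other V v β (a ∘ sym)) p , trans (≔-other V v β (b ∘ sym)) q)
        , Run-≗ u pointwise r
        where
        fx : sw (toℕ l) v ≡ v
        fx = sw-other (toℕ l) v a b
        pointwise : ∀ x → ((V ∘ sw (toℕ l)) [ v ≔ β ]) x ≡ (V [ v ≔ β ]) (sw (toℕ l) x)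
        pointwise x with x ℕ.≟ v
        ... | yes refl = trans (≔-self _ v β) (sym (trans (cong (V [ v ≔ β ]) fx) (≔-self V v β)))
        ... | no ne = trans (≔-other _ v β ne) (sym (≔-other V v β λ e → ne
          (trans (sym (sw-involutive (toℕ l) x)) (trans (cong (sw (toℕ l)) e) fx))))

      pull : ∀ {V} u → V v′ ≡ β → Run V u → Pull u ⊎ Run (V [ v ≔ β ]) u
      pull [] _ _ = inj₂ tt
      pull {V} (l ∷ u) b r with classify l
      ... | inj₁ refl = inj₁ (u , (λ _ → refl) , refl , sym (cong (_+ cnt (suc j) u) (hit-self j)))
      ... | inj₂ (inj₁ same) = inj₂ (Run-≗ (l ∷ u) (≔-trivial V v β (same-bit V l u same r)) r)
      -- An `Opposite` letter needs `not β` at `v′`, but the one already passed has left `β` there.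
      ... | inj₂ (inj₂ (inj₁ opp)) = contradiction (trans (sym b) (proj₁ (opposite-bit V l u opp r))) (distinct β)
        where
        distinct : ∀ b → b ≢ not b
        distinct false ()
        distinct true ()
      ... | inj₂ (inj₂ (inj₂ far)) with pull u (trans (cong V (let a , b = away v′-at far in sw-other (toℕ l) v′ a b)) b) (proj₂ r)
      ...   | inj₂ r′ = inj₂ (away-step (away v-at far) r r′)
      ...   | inj₁ (w , e , len , c) = inj₁ (l ∷ w
        , (λ x → trans (sym (far-commute far (ev w x))) (cong (sw (toℕ l)) (e x)))
        , cong suc len
        , trans (sym (ℕ.+-suc (hit (suc j) (toℕ l)) _)) (cong (λ z → hit (suc j) (toℕ l) + z) c))

      braid : ∀ {a b} → Adjacent a b → ∀ x → sw b (sw a (sw b x)) ≡ sw a (sw b (sw a x))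
      braid (inj₁ refl) x = sw-braid _ x
      braid (inj₂ refl) x = sym (sw-braid _ x)

    prescribe : ∀ {V} u → Run V u → Fewer (i ∷ u) ⊎ Run (V [ v ≔ β ]) u
    prescribe [] r = inj₂ tt
    prescribe {V} (l ∷ u) r with classify l
    -- Two letters `i` next to each other cancel.
    ... | inj₁ refl = inj₁ (u , (λ x → sym (sw-involutive j _)) , ℕ.≤-trans (ℕ.n≤1+n _) (ℕ.n≤1+n _)
      , ℕ.≤-trans (ℕ.+-monoˡ-≤ (cnt (suc j) u) (ℕ.≤-reflexive (sym (hit-self j)))) (ℕ.m≤n+m _ (hit (suc j) j)))
    ... | inj₂ (inj₁ same) = inj₂ (Run-≗ (l ∷ u) (≔-trivial V v β (same-bit V l u same r)) r)
    ... | inj₂ (inj₂ (inj₂ far)) with prescribe u (proj₂ r)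
    ...   | inj₂ r′ = inj₂ (away-step (away v-at far) r r′)
    ...   | inj₁ (w , e , len , c) = inj₁ (l ∷ w
      , (λ x → trans (cong (sw (toℕ l)) (e x)) (far-commute far (ev u x)))
      , s≤s len
      , subst (λ z → hit (suc j) (toℕ l) + cnt (suc j) w < z) (lemma (hit (suc j) (toℕ l)) (hit (suc j) j) (cnt (suc j) u))
          (ℕ.+-monoʳ-< (hit (suc j) (toℕ l)) c))
      where
      lemma : ∀ a b c → a + (b + c) ≡ b + (a + c)
      lemma = ℕR.solve-∀
    prescribe {V} (l ∷ u) r | inj₂ (inj₂ (inj₁ opp)) with pull u (proj₂ (opposite-bit V l u opp r)) (proj₂ r)
    -- The braid move from `i l i` to `l i l` keeps the length and loses one letter `i`.
    ... | inj₁ (w , e , len , c) = inj₁ (l ∷ i ∷ l ∷ w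
      , (λ x → trans (braid (opposite-adjacent opp) (ev w x)) (cong (sw j ∘ sw (toℕ l)) (e x)))
      , ℕ.≤-reflexive (cong (λ z → suc (suc z)) len)
      , less)
      where
      h-l = hit (suc j) (toℕ l)
      l≢ : suc j ≢ suc (toℕ l)
      l≢ q = case opposite-adjacent opp of λ
        { (inj₁ z) → ℕ.1+n≢n (sym (trans (sym (ℕ.suc-injective q)) z)) ; (inj₂ z) → ℕ.1+n≢n (trans (sym z) (sym (ℕ.suc-injective q))) }
      less : h-l + (hit (suc j) j + (h-l + cnt (suc j) w)) < hit (suc j) j + (h-l + cnt (suc j) u)
      less = subst₂ (λ y z → z + (y + (z + cnt (suc j) w)) < y + (z + cnt (suc j) u)) (sym (hit-self j)) (sym (hit-other l≢))
        (s≤s (ℕ.≤-reflexive c))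
    ... | inj₂ r′ = inj₂ (away-step (opposite-away opp) r r′)

  private
    classify-left : ∀ l → l ≡ i ⊎ (suc (toℕ l) ≡ j) ⊎ (toℕ l ≡ suc j) ⊎ Far l
    classify-left l with toℕ l ℕ.≟ j | suc (toℕ l) ℕ.≟ j | toℕ l ℕ.≟ suc j
    ... | yes e | _ | _ = inj₁ (Fin.toℕ-injective e)
    ... | no _ | yes e | _ = inj₂ (inj₁ e)
    ... | no _ | no _ | yes e = inj₂ (inj₂ (inj₁ e))
    ... | no p | no q | no r = inj₂ (inj₂ (inj₂ ([ q ∘ sym , r ]′ , p)))

    classify-right : ∀ l → l ≡ i ⊎ (toℕ l ≡ suc j) ⊎ (suc (toℕ l) ≡ j) ⊎ Far l
    classify-right l with classify-left l
    ... | inj₁ e = inj₁ e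
    ... | inj₂ (inj₁ e) = inj₂ (inj₂ (inj₁ e))
    ... | inj₂ (inj₂ (inj₁ e)) = inj₂ (inj₁ e)
    ... | inj₂ (inj₂ (inj₂ f)) = inj₂ (inj₂ (inj₂ f))

    left-same-bit : ∀ V l u → suc (toℕ l) ≡ j → Run {n} V (l ∷ u) → V j ≡ true
    left-same-bit V l u e r = trans (cong V (sym e)) (proj₂ (proj₁ r))

    left-opposite-bit : ∀ V l u → toℕ l ≡ suc j → Run {n} V (l ∷ u) →
      V (suc j) ≡ not true × V (sw (toℕ l) (suc j)) ≡ true
    left-opposite-bit V l u e r = trans (cong V (sym e)) (proj₁ (proj₁ r))
      , trans (cong V (trans (cong (sw (toℕ l)) (sym e)) (sw-left (toℕ l)))) (proj₂ (proj₁ r))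

    left-opposite-away : ∀ {l : Fin n} → toℕ l ≡ suc j → j ≢ toℕ l × j ≢ suc (toℕ l)
    left-opposite-away e = (λ e′ → ℕ.1+n≢n (sym (trans e′ e))) , λ e′ → ℕ.<⇒≢ (ℕ.m≤n+m (suc j) 1) (trans e′ (cong suc e))

    right-same-bit : ∀ V l u → toℕ l ≡ suc j → Run {n} V (l ∷ u) → V (suc j) ≡ false
    right-same-bit V l u e r = trans (cong V (sym e)) (proj₁ (proj₁ r))

    right-opposite-bit : ∀ V l u → suc (toℕ l) ≡ j → Run {n} V (l ∷ u) →
      V j ≡ not false × V (sw (toℕ l) j) ≡ false
    right-opposite-bit V l u e r = trans (cong V (sym e)) (proj₂ (proj₁ r))
      , trans (cong V (trans (cong (sw (toℕ l)) (sym e)) (sw-right (toℕ l)))) (proj₁ (proj₁ r))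

    right-opposite-away : ∀ {l : Fin n} → suc (toℕ l) ≡ j → suc j ≢ toℕ l × suc j ≢ suc (toℕ l)
    right-opposite-away e = (λ e′ → ℕ.<⇒≢ (ℕ.m≤n+m (suc j) 1) (sym (trans (cong suc e′) e))) , λ e′ → ℕ.1+n≢n (trans e′ e)

    right-opposite-adjacent : ∀ {l : Fin n} → suc (toℕ l) ≡ j → Adjacent j (toℕ l)
    right-opposite-adjacent e = inj₁ (sym e)

    module Left = Side j (suc j) true (inj₁ refl) (inj₂ refl)
      (λ l → suc (toℕ l) ≡ j) (λ l → toℕ l ≡ suc j) classify-left
      left-same-bit left-opposite-bit inj₂ left-opposite-away

    module Right = Side (suc j) j false (inj₂ refl) (inj₁ refl)
      (λ l → toℕ l ≡ suc j) (λ l → suc (toℕ l) ≡ j) classify-right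
      right-same-bit right-opposite-bit right-opposite-adjacent right-opposite-away

  run-cons : ∀ {V} u → Tight (i ∷ u) → Run V u → ∃[ V′ ] Run V′ (i ∷ u)
  run-cons {V} u tight r with Left.prescribe u r
  ... | inj₁ (w , e , len , c) = contradiction c (ℕ.<-irrefl (tight w e len (suc j)))
  ... | inj₂ r₁ with Right.prescribe u r₁
  ...   | inj₁ (w , e , len , c) = contradiction c (ℕ.<-irrefl (tight w e len (suc j)))
  -- `V₂` is the configuration just after the hop, with the particle at `j` and the hole at `j` + 1;
  -- undoing the hop gives the initial one.
  ...   | inj₂ r₂ = V₂ ∘ sw j
    , (trans (cong V₂ (sw-left j)) (≔-self _ (suc j) false)
      , trans (cong V₂ (sw-right j)) (trans (≔-other _ (suc j) false (ℕ.1+n≢n ∘ sym)) (≔-self V j true)))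
    , Run-≗ u (λ v → cong V₂ (sym (sw-involutive j v))) r₂
    where V₂ = (V [ j ≔ true ]) [ suc j ≔ false ]

tight⇒run : ∀ {n} (w : Word n) → Tight w → ∃[ V ] Run V w
tight⇒run [] t = (λ _ → false) , tt
tight⇒run (i ∷ w) t = run-cons i w t (proj₂ (tight⇒run w λ u e len c →
  ℕ.+-cancelˡ-≡ (hit c (toℕ i)) _ _ (t (i ∷ u) (λ x → cong (sw (toℕ i)) (e x)) (s≤s len) c)))

cnt-∼ : ∀ {n} {u w : Word n} → u ∼ w → ∀ c → cnt c u ≡ cnt c w
cnt-∼ ε c = refl
cnt-∼ (swap a b i j _ ◅ m) c = trans (trans (cnt-++ c a (i ∷ j ∷ b))
  (trans (cong (λ z → cnt c a + z) (lemma (hit c (toℕ i)) (hit c (toℕ j)) (cnt c b))) (sym (cnt-++ c a (j ∷ i ∷ b)))))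
  (cnt-∼ m c)
  where
  lemma : ∀ a b c → a + (b + c) ≡ b + (a + c)
  lemma = ℕR.solve-∀

fullyCommutative⇒tight : ∀ {n} {π : Perm n} {𝕨} → FullyCommutative π → IsReducedFor π 𝕨 → Tight 𝕨
fullyCommutative⇒tight {𝕨 = 𝕨} (𝕧 , _ , unique) red u e len c =
  trans (sym (cnt-∼ (unique u red-u) c)) (cnt-∼ (unique 𝕨 red) c)
  where
  open IsReducedFor red
  red-u = record { represents = λ x → trans (≗ᵉ⇒≈ {u = u} {𝕨} e x) (represents x)
                 ; minimal = λ 𝕧 q → ℕ.≤-trans len (minimal 𝕧 q) }

fullyCommutative⇒model : ∀ {n} {π : Perm n} → FullyCommutative π → ∃ (Model π)
fullyCommutative⇒model fc@(𝕨 , red , _) = run⇒model 𝕨 (proj₂ (tight⇒run 𝕨 (fullyCommutative⇒tight fc red)))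
  (IsReducedFor.represents red)

-- Diamond reduction

-- Converse of `before-left` and `before-right`: for the first letter the two equations give the
-- contents of its sites, and `hop` passes them on to the rest of the word.
idx⇒Run : ∀ {n} {V : Config} (w : Word n) →
  (∀ x → before (toℕ (lookup w x)) w x ≡ ⟦ V (toℕ (lookup w x)) ⟧ + idx w x) →
  (∀ x → ⟦ V (lab w x) ⟧ + before (suc (lab w x)) w x ≡ suc (idx w x)) → Run V w
idx⇒Run [] l r = tt
idx⇒Run {V = V} (i ∷ w) l r = (p , q) , idx⇒Run w
  (λ x → ℕ.+-cancelˡ-≡ (hit (toℕ (lookup w x)) j) _ _ (trans (l (suc x)) (left′ (toℕ (lookup w x)) (idx w x))))
  (λ x → ℕ.+-cancelˡ-≡ (hit (lab w x) j) _ _ (trans (right′ (lab w x) (before (suc (lab w x)) w x)) (trans (r (suc x)) (sym (ℕ.+-suc (hit (lab w x) j) _)))))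
  where
  j = toℕ i
  ⟦⟧-0 : ∀ {b} → 0 ≡ ⟦ b ⟧ + 0 → b ≡ false
  ⟦⟧-0 {false} _ = refl
  ⟦⟧-1 : ∀ {b} → ⟦ b ⟧ + 0 ≡ 1 → b ≡ true
  ⟦⟧-1 {true} _ = refl
  p : V j ≡ false
  p = ⟦⟧-0 (l zero)
  q : V (suc j) ≡ true
  q = ⟦⟧-1 (r zero)
  left′ : ∀ c x → ⟦ V c ⟧ + (hit (suc c) j + x) ≡ hit c j + (⟦ V (sw j c) ⟧ + x)
  left′ c x = trans (sym (ℕ.+-assoc ⟦ V c ⟧ _ x)) (trans (cong (_+ x) (sym (hop {V} j p q c)))
    (trans (cong (_+ x) (ℕ.+-comm ⟦ V (sw j c) ⟧ _)) (ℕ.+-assoc (hit c j) _ x)))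
  right′ : ∀ c x → hit c j + (⟦ V (sw j c) ⟧ + x) ≡ ⟦ V c ⟧ + (hit (suc c) j + x)
  right′ c x = sym (left′ c x)

idx-unique : ∀ {n} (w : Word n) (φ : Entry w → ℕ) →
  (∀ a b → lab w a ≡ lab w b → toℕ a < toℕ b → φ a < φ b) →
  (∀ a b → lab w a ≡ lab w b → φ a < φ b → toℕ a < toℕ b) →
  (∀ a j → j < φ a → ∃[ b ] lab w b ≡ lab w a × φ b ≡ j) → ∀ a → φ a ≡ idx w a
idx-unique w φ mono mono⁻ closed a = sym (go (φ a) a refl)
  where
  go : ∀ j a → φ a ≡ j → idx w a ≡ j
  go zero a p = ℕ.n≤0⇒n≡0 (ℕ.≮⇒≥ λ q → let b , e , r = entry w (lab w a) 0 (ℕ.<-trans q (idx-cnt w a)) in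
    contradiction (subst (φ b <_) p (mono b a e (idx-< w b a e (subst (_< idx w a) (sym r) q)))) λ ())
  go (suc j) a p with closed a j (ℕ.≤-reflexive (sym p))
  ... | b , e , r = sym (ℕ.≤-antisym b<a (ℕ.≮⇒≥ gap))
    where
    at-j : idx w b ≡ j
    at-j = go j b r
    b<a : suc j ≤ idx w a
    b<a = subst (_< idx w a) at-j (<-idx w b a e (mono⁻ b a e (subst₂ _<_ (sym r) (sym p) (ℕ.n<1+n j))))
    gap : ¬ suc j < idx w a
    gap q with entry w (lab w a) (suc j) (ℕ.<-trans q (idx-cnt w a))
    ... | c , e′ , r′ = ℕ.<⇒≱
      (mono c a e′ (idx-< w c a e′ (subst (_< idx w a) (sym r′) q)))
      (≡≤ (trans p (cong suc (sym r))) (mono b c (trans e (sym e′))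
        (idx-< w b c (trans e (sym e′)) (subst₂ _<_ (sym at-j) (sym r′) (ℕ.n<1+n j)))))

cnt-by-entries : ∀ {n m} (w : Word n) c → 0 < m →
  (∀ j → suc j < m → ∃[ x ] lab w x ≡ c × idx w x ≡ j) →
  (∀ x → lab w x ≡ c → suc (idx w x) < m) → m ≡ suc (cnt c w)
cnt-by-entries {m = suc m} w c _ there-is bound = cong suc (ℕ.≤-antisym
  (ℕ.≮⇒≥ λ p → let x , e , i = there-is (cnt c w) (s≤s p) in
    ℕ.<-irrefl i (subst (λ c → idx w x < cnt c w) e (idx-cnt w x)))
  (ℕ.≮⇒≥ λ p → let x , e , i = entry w c m p in ℕ.<-irrefl (cong suc i) (bound x e)))

before-unique : ∀ {n t} (w : Word n) a c → t ≤ cnt c w →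
  (∀ x → lab w x ≡ c → toℕ x < toℕ a ⇔ idx w x < t) → t ≡ before c w a
before-unique {t = t} w a c bound eq = ℕ.≤-antisym
  (ℕ.≮⇒≥ λ p → let x , e , i = entry w c (before c w a) (ℕ.<-≤-trans p bound) in
    ℕ.<-irrefl i (subst (λ c → idx w x < before c w a) e (idx-before w x a (from (eq x e) (subst (_< t) (sym i) p)))))
  (ℕ.≮⇒≥ λ p → let x , e , i = entry w c t (ℕ.<-≤-trans p (before-cnt c w a)) in
    ℕ.<-irrefl i (to (eq x e) (before⇒< w x a (subst₂ (λ i c → i < before c w a) (sym i) (sym e) p))))

module Diamonds {k} {h : Perm (2 + k)} {g : Perm k} (red : IsDiamondReduction h g) {V : Config}
  (run : Run V (IsDiamondReduction.𝕙 red))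
  (cnt-first : cnt 1 (IsDiamondReduction.𝕙 red) ≡ 1)
  (cnt-last : cnt (2 + k) (IsDiamondReduction.𝕙 red) ≡ 1)
  (occupied : ∀ c → 1 ≤ c → c ≤ k → 0 < cnt (suc c) (IsDiamondReduction.𝕙 red))
  where
  open IsDiamondReduction red
  open Quadruple renaming (top to summit; left to west; right to east)

  private
    bt tp : Entry 𝕘 → Entry 𝕙
    bt a = bottom (◇ a)
    tp a = summit (◇ a)

    lab-bt : ∀ a → lab 𝕙 (bt a) ≡ suc (lab 𝕘 a)
    lab-bt a = cong suc (trans (cong toℕ (columns a)) (cong suc (Fin.toℕ-inject₁ (lookup 𝕘 a))))

    column≡ : ∀ {x y} → lab 𝕙 x ≡ lab 𝕙 y → column 𝕙 x ≡ column 𝕙 y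
    column≡ e = Fin.toℕ-injective (ℕ.suc-injective e)

    module D a = IsMinimalDiamond (isDiamond a)

    lab-top : ∀ {d} → IsMinimalDiamond 𝕙 d → lab 𝕙 (bottom d) ≡ lab 𝕙 (summit d)
    lab-top D = cong (suc ∘ toℕ) (proj₁ (IsMinimalDiamond.minimalPair D))

    bottom<top : ∀ {d} → IsMinimalDiamond 𝕙 d → toℕ (bottom d) < toℕ (summit d)
    bottom<top D = heap⇒< 𝕙 (proj₁ (proj₂ (IsMinimalDiamond.minimalPair D)))

    idx-top : ∀ {d} → IsMinimalDiamond 𝕙 d → idx 𝕙 (summit d) ≡ suc (idx 𝕙 (bottom d))
    idx-top {d} D = sym (ℕ.≤-antisym (<-idx 𝕙 _ _ (lab-top D) (bottom<top D)) (ℕ.≮⇒≥ gap))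
      where
      gap : ¬ suc (idx 𝕙 (bottom d)) < idx 𝕙 (summit d)
      gap p with entry 𝕙 (lab 𝕙 (summit d)) (suc (idx 𝕙 (bottom d))) (ℕ.<-trans p (idx-cnt 𝕙 (summit d)))
      ... | z , e , q = proj₂ (proj₂ (IsMinimalDiamond.minimalPair D)) z (column≡ (trans e (sym (lab-top D))))
        ( column-heap 𝕙 run _ z (trans (lab-top D) (sym e)) (idx-< 𝕙 _ z (trans (lab-top D) (sym e)) (ℕ.≤-reflexive (sym q)))
        , column-heap 𝕙 run z _ e (idx-< 𝕙 z _ e (subst (_< idx 𝕙 (summit d)) (sym q) p)))

    -- In the columns next to a diamond, the entry between bottom and top is the
    -- first one after the bottom.

    idx-between : ∀ {d z} c → IsMinimalDiamond 𝕙 d → lab 𝕙 z ≡ c → Adjacent (lab 𝕙 (bottom d)) c →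
      toℕ (bottom d) < toℕ z → toℕ z < toℕ (summit d) → idx 𝕙 z ≡ before c 𝕙 (bottom d)
    idx-between {d} {z} c D refl adj p q = ℕ.≤-antisym
      (s≤s⁻¹ (ℕ.≤-trans (idx-before 𝕙 z (summit d) q) (ℕ.≤-reflexive (go adj))))
      (before-mono (lab 𝕙 z) 𝕙 (bottom d) z (ℕ.<⇒≤ p))
      where
      b = bottom d
      t = summit d
      go : Adjacent (lab 𝕙 b) (lab 𝕙 z) → before (lab 𝕙 z) 𝕙 t ≡ suc (before (lab 𝕙 z) 𝕙 b)
      go (inj₁ e) = begin
        before c 𝕙 t ≡⟨ before-left′ 𝕙 run t (trans (sym (lab-top D)) e) ⟩
        ⟦ V c ⟧ + idx 𝕙 t ≡⟨ cong (λ z → ⟦ V c ⟧ + z) (idx-top D) ⟩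
        ⟦ V c ⟧ + suc (idx 𝕙 b) ≡⟨ ℕ.+-suc ⟦ V c ⟧ _ ⟩
        suc (⟦ V c ⟧ + idx 𝕙 b) ≡⟨ cong suc (before-left′ 𝕙 run b e) ⟨
        suc (before c 𝕙 b) ∎
        where
        open ≡-Reasoning
      go (inj₂ e) = ℕ.+-cancelˡ-≡ ⟦ V (lab 𝕙 b) ⟧ _ _ (begin
        ⟦ V (lab 𝕙 b) ⟧ + before c 𝕙 t ≡⟨ at-right t (sym (lab-top D)) ⟩
        suc (idx 𝕙 t) ≡⟨ cong suc (idx-top D) ⟩
        suc (suc (idx 𝕙 b)) ≡⟨ cong suc (at-right b refl) ⟨
        suc (⟦ V (lab 𝕙 b) ⟧ + before c 𝕙 b) ≡⟨ ℕ.+-suc ⟦ V (lab 𝕙 b) ⟧ _ ⟨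
        ⟦ V (lab 𝕙 b) ⟧ + suc (before c 𝕙 b) ∎)
        where
        open ≡-Reasoning
        at-right : ∀ x → lab 𝕙 x ≡ lab 𝕙 b → ⟦ V (lab 𝕙 b) ⟧ + before c 𝕙 x ≡ suc (idx 𝕙 x)
        at-right x q = subst₂ (λ a c → ⟦ V a ⟧ + before c 𝕙 x ≡ suc (idx 𝕙 x)) q (trans (cong suc q) (sym e)) (before-right 𝕙 run x)

    module Sides {d} (D : IsMinimalDiamond 𝕙 d) where
      open IsMinimalDiamond D
      lab-left : lab 𝕙 (bottom d) ≡ suc (lab 𝕙 (west d))
      lab-left = cong suc (sym leftColumn)
      lab-right : lab 𝕙 (east d) ≡ suc (lab 𝕙 (bottom d))
      lab-right = cong suc rightColumn
      idx-left : idx 𝕙 (west d) ≡ before (lab 𝕙 (west d)) 𝕙 (bottom d)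
      idx-left = idx-between (lab 𝕙 (west d)) D refl (inj₁ lab-left) (heap⇒< 𝕙 (proj₁ leftBetween)) (heap⇒< 𝕙 (proj₂ leftBetween))
      idx-right : idx 𝕙 (east d) ≡ before (lab 𝕙 (east d)) 𝕙 (bottom d)
      idx-right = idx-between (lab 𝕙 (east d)) D refl (inj₂ lab-right) (heap⇒< 𝕙 (proj₁ rightBetween)) (heap⇒< 𝕙 (proj₂ rightBetween))

    quadruple-≡ : {d e : Quadruple 𝕙} → bottom d ≡ bottom e → summit d ≡ summit e → west d ≡ west e → east d ≡ east e → d ≡ e
    quadruple-≡ refl refl refl refl = refl

    diamond-determined : ∀ {d e} → IsMinimalDiamond 𝕙 d → IsMinimalDiamond 𝕙 e → bottom d ≡ bottom e → d ≡ e
    diamond-determined {d} {e} D E q = quadruple-≡ q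
      (idx-injective 𝕙 (summit d) (summit e) (trans (sym (lab-top D)) (trans lab-q (lab-top E)))
        (trans (idx-top D) (trans (cong (suc ∘ idx 𝕙) q) (sym (idx-top E)))))
      (idx-injective 𝕙 (west d) (west e) ll
        (trans (Sides.idx-left D) (trans (cong₂ (λ c b → before c 𝕙 b) ll q) (sym (Sides.idx-left E)))))
      (idx-injective 𝕙 (east d) (east e) rr
        (trans (Sides.idx-right D) (trans (cong₂ (λ c b → before c 𝕙 b) rr q) (sym (Sides.idx-right E)))))
      where
      lab-q : lab 𝕙 (bottom d) ≡ lab 𝕙 (bottom e)
      lab-q = cong (lab 𝕙) q
      ll : lab 𝕙 (west d) ≡ lab 𝕙 (west e)
      ll = ℕ.suc-injective (trans (sym (Sides.lab-left D)) (trans lab-q (Sides.lab-left E)))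
      rr : lab 𝕙 (east d) ≡ lab 𝕙 (east e)
      rr = trans (Sides.lab-right D) (trans (cong suc lab-q) (sym (Sides.lab-right E)))

    φ : Entry 𝕘 → ℕ
    φ a = idx 𝕙 (bt a)

    φ-bound : ∀ a → suc (φ a) < cnt (suc (lab 𝕘 a)) 𝕙
    φ-bound a = subst₂ (λ i c → i < cnt c 𝕙) (idx-top (isDiamond a))
      (trans (sym (lab-top (isDiamond a))) (lab-bt a)) (idx-cnt 𝕙 (tp a))

    φ-injective : ∀ a b → lab 𝕘 a ≡ lab 𝕘 b → φ a ≡ φ b → a ≡ b
    φ-injective a b e p = injective (diamond-determined (isDiamond a) (isDiamond b)
      (idx-injective 𝕙 _ _ (trans (lab-bt a) (trans (cong suc e) (sym (lab-bt b)))) p))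

    φ-surjective : ∀ c j → 1 ≤ c → suc j < cnt (suc c) 𝕙 → ∃[ a ] lab 𝕘 a ≡ c × φ a ≡ j
    φ-surjective c j 1≤c p with entry 𝕙 (suc c) j (ℕ.<-trans (ℕ.n<1+n j) p) | entry 𝕙 (suc c) (suc j) p
    ... | b , eb , ib | t , et , it
      with between-left 𝕙 run b t c eb et (idx-< 𝕙 b t (trans eb (sym et)) (subst₂ _<_ (sym ib) (sym it) (ℕ.n<1+n j)))
         | between-right 𝕙 run b t (trans eb (sym et)) (idx-< 𝕙 b t (trans eb (sym et)) (subst₂ _<_ (sym ib) (sym it) (ℕ.n<1+n j)))
    ... | l , el , b<l , l<t | r , er , b<r , r<t with surjective (quadruple b t l r) diamond
      where
      b≡t = trans eb (sym et)
      b<t = ℕ.<-trans b<l l<t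
      diamond : IsMinimalDiamond 𝕙 (quadruple b t l r)
      diamond = record
        { minimalPair = column≡ b≡t , column-heap 𝕙 run b t b≡t b<t , λ z e (m , m′) →
            let lab-z = trans (cong (suc ∘ toℕ) e) eb in
            ℕ.<⇒≱ (<-idx 𝕙 z t (trans lab-z (sym et)) (heap⇒< 𝕙 m′))
              (≡≤ (trans it (cong suc (sym ib))) (<-idx 𝕙 b z (trans eb (sym lab-z)) (heap⇒< 𝕙 m)))
        ; leftColumn = trans el (ℕ.suc-injective (sym eb))
        ; rightColumn = ℕ.suc-injective er
        ; leftBetween = adjacent-heap 𝕙 b l (inj₁ (trans eb (cong suc (sym el)))) b<l
                      , adjacent-heap 𝕙 l t (inj₂ (trans et (cong suc (sym el)))) l<t
        ; rightBetween = adjacent-heap 𝕙 b r (inj₂ er) b<r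
                       , adjacent-heap 𝕙 r t (inj₁ (trans er (cong suc b≡t))) r<t }
    ... | a , e = a , ℕ.suc-injective (trans (sym (lab-bt a)) (trans (cong (lab 𝕙 ∘ bottom) e) eb))
      , trans (cong (idx 𝕙 ∘ bottom) e) ib

    diamondHeap⇒< : ∀ {d e} → DiamondHeap 𝕙 d e → toℕ (bottom d) < toℕ (bottom e)
    diamondHeap⇒< [ _ , _ , _ , m ] = heap⇒< 𝕙 m
    diamondHeap⇒< ((_ , _ , _ , m) ∷ ms) = ℕ.<-trans (heap⇒< 𝕙 m) (diamondHeap⇒< ms)

    adjacent-mono : ∀ a b → Adjacent (lab 𝕘 a) (lab 𝕘 b) → toℕ a < toℕ b → toℕ (bt a) < toℕ (bt b)
    adjacent-mono a b adj p = diamondHeap⇒< (to (order a b) (adjacent-heap 𝕘 a b adj p))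

    adjacent-mono⁻ : ∀ a b → Adjacent (lab 𝕘 a) (lab 𝕘 b) → toℕ (bt a) < toℕ (bt b) → toℕ a < toℕ b
    adjacent-mono⁻ a b adj p with ℕ.<-cmp (toℕ a) (toℕ b)
    ... | tri< q _ _ = q
    ... | tri≈ _ q _ = contradiction p (ℕ.<-irrefl (cong (toℕ ∘ bt) (Fin.toℕ-injective q)))
    ... | tri> _ _ q = contradiction p (ℕ.<-asym (adjacent-mono b a ([ inj₂ , inj₁ ]′ adj) q))

    -- The order within a column is detected by a diamond of the next column.

    φ-mono⁻ : ∀ a b → lab 𝕘 a ≡ lab 𝕘 b → φ a < φ b → toℕ a < toℕ b
    φ-mono⁻ a b e p = go
      (between-right 𝕙 run (bt a) (bt b) e′ (idx-< 𝕙 (bt a) (bt b) e′ p))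
      (between-right 𝕙 run (bt b) (tp b) (lab-top (isDiamond b)) (bottom<top (isDiamond b)))
      where
      e′ : lab 𝕙 (bt a) ≡ lab 𝕙 (bt b)
      e′ = trans (lab-bt a) (trans (cong suc e) (sym (lab-bt b)))
      go : ∃[ x ] lab 𝕙 x ≡ suc (lab 𝕙 (bt a)) × toℕ (bt a) < toℕ x × toℕ x < toℕ (bt b) →
           ∃[ y ] lab 𝕙 y ≡ suc (lab 𝕙 (bt b)) × toℕ (bt b) < toℕ y × toℕ y < toℕ (tp b) → toℕ a < toℕ b
      go (x , ex , a<x , x<b) (y , ey , b<y , _) = finish (φ-surjective (suc (lab 𝕘 a)) (idx 𝕙 x) (s≤s z≤n)
          (subst (suc (idx 𝕙 x) <_) (cong (λ c → cnt c 𝕙) lab-y)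
            (ℕ.≤-<-trans (<-idx 𝕙 x y x≡y (ℕ.<-trans x<b b<y)) (idx-cnt 𝕙 y))))
        where
        lab-y : lab 𝕙 y ≡ 2 + lab 𝕘 a
        lab-y = trans ey (cong suc (trans (lab-bt b) (cong suc (sym e))))
        x≡y : lab 𝕙 x ≡ lab 𝕙 y
        x≡y = trans ex (trans (cong suc (lab-bt a)) (sym lab-y))
        finish : ∃[ z ] lab 𝕘 z ≡ suc (lab 𝕘 a) × φ z ≡ idx 𝕙 x → toℕ a < toℕ b
        finish (z , ez , iz) = ℕ.<-trans
          (adjacent-mono⁻ a z (inj₂ ez) (subst (toℕ (bt a) <_) (sym bz) a<x))
          (adjacent-mono⁻ z b (inj₁ (trans ez (cong suc e))) (subst (_< toℕ (bt b)) (sym bz) x<b))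
          where
          bz : toℕ (bt z) ≡ toℕ x
          bz = cong toℕ (idx-injective 𝕙 (bt z) x
            (trans (lab-bt z) (trans (cong suc ez) (sym (trans ex (cong suc (lab-bt a)))))) iz)

    φ-mono : ∀ a b → lab 𝕘 a ≡ lab 𝕘 b → toℕ a < toℕ b → φ a < φ b
    φ-mono a b e p with ℕ.<-cmp (φ a) (φ b)
    ... | tri< q _ _ = q
    ... | tri≈ _ q _ = contradiction p (ℕ.<-irrefl (cong toℕ (φ-injective a b e q)))
    ... | tri> _ _ q = contradiction p (ℕ.<-asym (φ-mono⁻ b a (sym e) q))

    φ≡idx : ∀ a → φ a ≡ idx 𝕘 a
    φ≡idx = idx-unique 𝕘 φ φ-mono φ-mono⁻ λ a j p → φ-surjective (lab 𝕘 a) j (s≤s z≤n)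
      (ℕ.<-trans (s≤s p) (φ-bound a))

  -- A column has one minimal pair fewer than entries. The outer columns of `𝕙` have a single entry,
  -- and they correspond to the labels 0 and `k` + 1, which no letter of `𝕘` carries.
  cnt-reduction : ∀ c → c ≤ suc k → cnt (suc c) 𝕙 ≡ suc (cnt c 𝕘)
  cnt-reduction zero _ = trans cnt-first (cong suc (sym (cnt-0 𝕘)))
  cnt-reduction (suc c) p = [ (λ q → inner (s≤s⁻¹ q)) , (λ q → last (ℕ.suc-injective q)) ]′ (ℕ.m≤n⇒m<n∨m≡n p)
    where
    last : c ≡ k → cnt (2 + c) 𝕙 ≡ suc (cnt (suc c) 𝕘)
    last refl = trans cnt-last (cong suc (sym (cnt-outside (suc k) 𝕘 ℕ.≤-refl)))
    inner : suc c ≤ k → cnt (2 + c) 𝕙 ≡ suc (cnt (suc c) 𝕘)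
    inner q = cnt-by-entries 𝕘 (suc c) (occupied (suc c) (s≤s z≤n) q)
      (λ j r → let a , e , i = φ-surjective (suc c) j (s≤s z≤n) r in a , e , trans (sym (φ≡idx a)) i)
      (λ a e → subst₂ (λ i c → suc i < cnt (suc c) 𝕙) (φ≡idx a) e (φ-bound a))

  private
    -- The side entry `z` comes after the bottom of its diamond, so the entries of that column
    -- before the bottom do not include the last one. All of them are bottoms of diamonds, and
    -- counting them in `𝕙` or in `𝕘` gives the same number.
    before-reduction : ∀ a z → Adjacent (lab 𝕙 (bt a)) (lab 𝕙 z) → toℕ (bt a) < toℕ z →
      ∀ c → lab 𝕙 z ≡ suc c → c ≤ suc k → before c 𝕘 a ≡ before (suc c) 𝕙 (bt a)
    before-reduction a z adj p c e b = sym (before-unique 𝕘 a c bound λ x ex → mk⇔ (high x ex) (low x ex))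
      where
      adj′ : ∀ {c′} → c′ ≡ c → Adjacent c′ (lab 𝕘 a)
      adj′ q = [ (λ r → inj₂ (ℕ.suc-injective (trans (sym (lab-bt a)) (trans r (cong suc (trans e (cong suc (sym q))))))))
               , (λ r → inj₁ (trans q (ℕ.suc-injective (trans (sym e) (trans r (cong suc (lab-bt a))))))) ]′ adj
      bound : before (suc c) 𝕙 (bt a) ≤ cnt c 𝕘
      bound = s≤s⁻¹ (subst (before (suc c) 𝕙 (bt a) <_) (cnt-reduction c b)
        (ℕ.≤-<-trans (ℕ.≤-trans (before-mono (suc c) 𝕙 (bt a) z (ℕ.<⇒≤ p)) (ℕ.≤-reflexive (cong (λ l → before l 𝕙 z) (sym e))))
          (subst (λ l → idx 𝕙 z < cnt l 𝕙) e (idx-cnt 𝕙 z))))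
      lab-x : ∀ x → lab 𝕘 x ≡ c → lab 𝕙 (bt x) ≡ suc c
      lab-x x ex = trans (lab-bt x) (cong suc ex)
      high : ∀ x → lab 𝕘 x ≡ c → toℕ x < toℕ a → idx 𝕘 x < before (suc c) 𝕙 (bt a)
      high x ex q = subst₂ (λ i l → i < before l 𝕙 (bt a)) (φ≡idx x) (lab-x x ex)
        (idx-before 𝕙 (bt x) (bt a) (adjacent-mono x a (adj′ ex) q))
      low : ∀ x → lab 𝕘 x ≡ c → idx 𝕘 x < before (suc c) 𝕙 (bt a) → toℕ x < toℕ a
      low x ex q = adjacent-mono⁻ x a (adj′ ex) (before⇒< 𝕙 (bt x) (bt a)
        (subst₂ (λ i l → i < before l 𝕙 (bt a)) (sym (φ≡idx x)) (sym (lab-x x ex)) q))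

  -- Neighbouring columns of diamonds interleave as their bottoms do, so the initial contents carry
  -- over, shifted by the column lost on the left.
  run-reduction : Run (V ∘ suc) 𝕘
  run-reduction = idx⇒Run 𝕘
    (λ a → let c = toℕ (lookup 𝕘 a)
               lab-l = ℕ.suc-injective (trans (sym (Sides.lab-left (isDiamond a))) (lab-bt a)) in
      trans (before-reduction a (west (◇ a)) (inj₁ (Sides.lab-left (isDiamond a)))
          (heap⇒< 𝕙 (proj₁ (D.leftBetween a))) c lab-l (ℕ.≤-trans (ℕ.<⇒≤ (Fin.toℕ<n (lookup 𝕘 a))) (ℕ.n≤1+n k)))
        (trans (before-left′ 𝕙 run (bt a) (lab-bt a)) (cong (λ z → ⟦ V (suc c) ⟧ + z) (φ≡idx a))))
    (λ a → let c = lab 𝕘 a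
               lab-r = trans (Sides.lab-right (isDiamond a)) (cong suc (lab-bt a)) in
      trans (cong (λ z → ⟦ V (suc c) ⟧ + z) (before-reduction a (east (◇ a)) (inj₂ (Sides.lab-right (isDiamond a)))
          (heap⇒< 𝕙 (proj₁ (D.rightBetween a))) (suc c) lab-r (s≤s (Fin.toℕ<n (lookup 𝕘 a)))))
        (trans (subst (λ l → ⟦ V l ⟧ + before (suc l) 𝕙 (bt a) ≡ suc (φ a)) (lab-bt a) (before-right 𝕙 run (bt a)))
          (cong suc (φ≡idx a))))

-- The path of a diamond reduction

private
  cons-subst : ∀ {a b l l′} (s : Step a b) {q : Path b l} {p : Path b l′} (e : l ≡ l′) (e′ : suc l ≡ suc l′) →
    subst (Path b) e q ≡ p → subst (Path a) e′ (s ∷ₚ q) ≡ s ∷ₚ p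
  cons-subst s refl refl refl = refl

-- From height 2 on, each of the four steps is the raise of a step one level lower. Only the last
-- column may have height 1, which leaves `down` as the last step.
unraise : ∀ {a l} (e : l + 1 ≡ suc l) (p : Path (suc a) (suc l)) →
  (∀ c → c < l → 2 ≤ hgt p c) → 0 < hgt p l →
  ∃[ q ] Positive {a} {l} q × subst (Path (suc a)) e (raised q) ≡ p ×
    (∀ c → c ≤ l → hgt p c ≡ suc (hgt q c)) × (∀ c → c < l → bots p c ≡ bots q c)
unraise {l = zero} refl (down ∷ₚ []) high pos = [] , tt , refl , (λ { zero z≤n → refl }) , λ _ ()
unraise {zero} {suc l} e (s ∷ₚ p) high pos = contradiction (high 0 (s≤s z≤n)) λ { (s≤s ()) }
unraise {suc a} {suc l} e (s ∷ₚ p) high pos = go s p (λ c q → high (suc c) (s≤s q)) pos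
  where
  Goal : ∀ {b} → Step (2 + a) b → Path b (suc l) → Set
  Goal s p = ∃[ q ] Positive {suc a} {suc l} q × subst (Path (2 + a)) e (raised q) ≡ s ∷ₚ p ×
    (∀ c → c ≤ suc l → hgt (s ∷ₚ p) c ≡ suc (hgt q c)) × (∀ c → c < suc l → bots (s ∷ₚ p) c ≡ bots q c)
  step : ∀ {b} (s : Step (suc a) b) (p : Path (suc b) (suc l)) →
    (∀ c → c < l → 2 ≤ hgt p c) → 0 < hgt p l → Goal (raise s) p
  step s p high pos with unraise (ℕ.suc-injective e) p high pos
  ... | q , pos-q , r , hs , bs = s ∷ₚ q , (s≤s z≤n , pos-q) , cons-subst (raise s) (ℕ.suc-injective e) e r
    , (λ { zero _ → refl ; (suc c) (s≤s b) → hs c b })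
    , (λ { zero _ → bot-raise s ; (suc c) (s≤s b) → bs c b })
  go : ∀ {b} (s : Step (2 + a) b) (p : Path b (suc l)) → (∀ c → c < l → 2 ≤ hgt p c) → 0 < hgt p l → Goal s p
  go up = step up
  go down = step down
  go lo = step lo
  go hi = step hi

Occurs-subst : ∀ {a b c l l′ m n} {s : Step a b} {t : Step b c} {q : Path c l} {r : Path c l′} {p : Path n m}
  (e : l ≡ l′) → subst (Path c) e q ≡ r → Occurs (s ∷ₚ t ∷ₚ r) p ⇔ Occurs (s ∷ₚ t ∷ₚ q) p
Occurs-subst refl refl = mk⇔ (λ o → o) (λ o → o)

two-entries : ∀ {n} (w : Word n) a b → a ≢ b → lab w a ≡ lab w b → 2 ≤ cnt (lab w a) w
two-entries w a b ne e with ℕ.<-cmp (idx w a) (idx w b)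
... | tri< p _ _ = ℕ.≤-trans (s≤s (ℕ.≤-<-trans z≤n p)) (subst (λ c → idx w b < cnt c w) (sym e) (idx-cnt w b))
... | tri≈ _ p _ = contradiction (idx-injective w a b e p) ne
... | tri> _ _ p = ℕ.≤-trans (s≤s (ℕ.≤-<-trans z≤n p)) (idx-cnt w a)

model-two-entries : ∀ {k} {h : Perm (2 + k)} {P} → Model h P → TwoEntriesInEachInternalColumn h →
  ∀ c → c < k → 2 ≤ hgt P (2 + c)
model-two-entries M (𝕨 , red , two) c b with two (fromℕ< b)
... | x , y , ne , ex , ey = subst (2 ≤_) (proj₂ (model-word M red) (2 + c)) (subst (λ l → 2 ≤ cnt l 𝕨)
  (cong suc (trans (cong toℕ ex) (cong suc (trans (Fin.toℕ-inject₁ _) (Fin.toℕ-fromℕ< b)))))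
  (two-entries 𝕨 x y ne (cong (suc ∘ toℕ) (trans ex (sym ey)))))

two-ups : ∀ {l} (p : Path 0 (2 + l)) → ConnectedPath p → 2 ≤ hgt p 2 →
  ∃[ r ] Positive r × p ≡ up ∷ₚ up ∷ₚ r
two-ups (up ∷ₚ up ∷ₚ r) (_ , _ , pos) high = r , pos , refl
two-ups (up ∷ₚ down ∷ₚ r) conn high = contradiction (subst (2 ≤_) (hgt-start r) high) λ ()
two-ups (up ∷ₚ lo ∷ₚ r) conn high = contradiction (subst (2 ≤_) (hgt-start r) high) λ { (s≤s ()) }
two-ups (up ∷ₚ hi ∷ₚ r) conn high = contradiction (subst (2 ≤_) (hgt-start r) high) λ { (s≤s ()) }
two-ups (lo ∷ₚ _ ∷ₚ _) (_ , () , _) high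

record Reduced {k} (h : Perm (3 + k)) (g : Perm (suc k)) : Set where
  field
    {q}      : Path 1 (suc k)
    {r}      : Path 2 (2 + k)
    pos-q    : Positive q
    pos-r    : Positive r
    model-q  : Model g (up ∷ₚ q)
    model-r  : Model h (up ∷ₚ up ∷ₚ r)
    raised≡r : subst (Path 2) (ℕ.+-comm (suc k) 1) (raised q) ≡ r

module _ {k} {h : Perm (3 + k)} {g : Perm (suc k)} (red : IsDiamondReduction h g) where

  private
    module Reduce (r : Path 2 (2 + k)) (M : Model h (up ∷ₚ up ∷ₚ r)) (pos-r : Positive r)
      (high : ∀ c → c < suc k → 2 ≤ hgt r c) where

      open IsDiamondReduction red

      unraised = unraise (ℕ.+-comm (suc k) 1) r high (positive⇒hgt r pos-r (suc k) ℕ.≤-refl)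
      q = proj₁ unraised
      pos-q = proj₁ (proj₂ unraised)
      r≡ = proj₁ (proj₂ (proj₂ unraised))
      heights = proj₁ (proj₂ (proj₂ (proj₂ unraised)))
      bottoms = proj₂ (proj₂ (proj₂ (proj₂ unraised)))
      word-h = model-word M 𝕙-reduced
      cnt-h = proj₂ word-h

      cnt-last : cnt (3 + k) 𝕙 ≡ 1
      cnt-last = trans (cnt-h (3 + k)) (trans (heights (suc k) ℕ.≤-refl) (cong suc (hgt-outside q (suc k) ℕ.≤-refl)))

      occupied : ∀ c → 1 ≤ c → c ≤ suc k → 0 < cnt (suc c) 𝕙
      occupied (suc c) _ b = subst (0 <_) (sym (cnt-h (2 + c))) (positive⇒hgt r pos-r c (s≤s (ℕ.<⇒≤ b)))

      open Diamonds red (proj₁ word-h) (cnt-h 1) cnt-last occupied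

      cnt-g : ∀ c → cnt c 𝕘 ≡ hgt (up ∷ₚ q) c
      cnt-g zero = cnt-0 𝕘
      cnt-g (suc c) = case c ℕ.≤? suc k of λ
        { (yes b) → ℕ.suc-injective (trans (sym (cnt-reduction (suc c) (s≤s b))) (trans (cnt-h (2 + c)) (heights c b)))
        ; (no b) → trans (cnt-outside (suc c) 𝕘 (ℕ.<-trans (ℕ.≰⇒> b) (ℕ.n<1+n c)))
                     (sym (hgt-outside q c (ℕ.<⇒≤ (ℕ.≰⇒> b)))) }

      agree : ∀ v → 0 < cnt v 𝕘 + cnt (suc v) 𝕘 → bots (up ∷ₚ up ∷ₚ r) (suc v) ≡ bots (up ∷ₚ q) v
      agree zero _ = refl
      agree (suc v) p = bottoms v (ℕ.≰⇒> λ b → contradiction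
        (cong₂ _+_ (cnt-outside (suc v) 𝕘 (s≤s b)) (cnt-outside (2 + v) 𝕘 (s≤s (ℕ.m≤n⇒m≤1+n b)))) (ℕ.m<n⇒n≢0 p))

      model-g : Model g (up ∷ₚ q)
      model-g = record
        { word = 𝕘
        ; represents = IsReducedFor.represents 𝕘-reduced
        ; run = Run-cong 𝕘 agree run-reduction
        ; counts = cnt-g }

      reduced : Reduced h g
      reduced = record { pos-q = pos-q ; model-q = model-g ; pos-r = pos-r ; model-r = M ; raised≡r = r≡ }

  reduction-model : Connected h → FullyCommutative h → TwoEntriesInEachInternalColumn h → Reduced h g
  reduction-model conn fc two = go (proj₁ modelled) (proj₂ modelled)
    where
    modelled : ∃ (Model h)
    modelled = fullyCommutative⇒model fc
    go : ∀ P → Model h P → Reduced h g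
    go P M = finish (two-ups P (to (model-connected M) conn) (model-two-entries M two 0 (s≤s z≤n))) M
        (model-two-entries M two)
      where
      finish : ∀ {P} → ∃[ r ] Positive r × P ≡ up ∷ₚ up ∷ₚ r → Model h P →
        (∀ c → c < suc k → 2 ≤ hgt P (2 + c)) → Reduced h g
      finish (r , pos-r , refl) M high = Reduce.reduced r M pos-r high

-- Passage from permutations to path counts

trivial-contains : (π ρ : Perm 0) → HeapContains π ρ
trivial-contains π ρ = record
  { 𝕨 = [] ; 𝕢 = []
  ; 𝕨-reduced = reduced π ; 𝕢-reduced = reduced ρ
  ; f = λ ()
  ; f-embedding = record { injective = λ { {()} } ; order2 = λ () ; order3 = λ () ; increasing = λ () }
  ; ι = λ ()
  ; ι-convex = record { injective = λ { {()} } ; columns = λ () ; order = λ () ; convex = λ () } }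
  where
  only : (x y : Fin 1) → x ≡ y
  only zero zero = refl
  reduced : (π : Perm 0) → IsReducedFor π []
  reduced π = record { represents = λ x → only _ _ ; minimal = λ _ _ → z≤n }

count-avoiding : ∀ {k} {ρ : Perm (suc k)} {q : Path 1 (suc k)} → Positive q → Model ρ (up ∷ₚ q) →
  ∀ {n N} → ∣ S₃₂₁ ρ n ∣≡ N → N ≡ total 0 (suc n) (avoiding (up ∷ₚ q))
count-avoiding {q = q} pos M = count-paths (λ P → ¬? (Occurs? (up ∷ₚ q) P)) proj₁ λ N → mk⇔
  (λ (_ , av) o → av (occurs⇒contains N M o))
  (λ ¬o → model⇒avoids N , λ hc → ¬o (contains⇒occurs pos N M hc))

count-connected : ∀ {k} {ρ : Perm (suc k)} {q : Path 1 (suc k)} → Positive q → Model ρ (up ∷ₚ q) →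
  ∀ {n N} → ∣ (λ p → S₃₂₁ ρ n p × Connected p) ∣≡ N →
  N ≡ total 0 (suc n) (λ P → χ (¬? (Occurs? (up ∷ₚ q) P) ×-dec ConnectedPath? P))
count-connected {q = q} pos M = count-paths (λ P → ¬? (Occurs? (up ∷ₚ q) P) ×-dec ConnectedPath? P) (proj₁ ∘ proj₁) λ N → mk⇔
  (λ ((_ , av) , c) → (λ o → av (occurs⇒contains N M o)) , to (model-connected N) c)
  (λ (¬o , c) → (model⇒avoids N , λ hc → ¬o (contains⇒occurs pos N M hc)) , from (model-connected N) c)

module _ {k} {h : Perm (3 + k)} {g : Perm (suc k)} (R : Reduced h g) (G Gc F : ℕ → ℕ)
  (G-count : ∀ n → ∣ S₃₂₁ g n ∣≡ G n)
  (Gc-count : ∀ n → ∣ (λ p → S₃₂₁ g n p × Connected p) ∣≡ Gc n)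
  (F-count : ∀ n → ∣ S₃₂₁ h n ∣≡ F n)
  where

  private
    open Reduced R

    same : ∀ n (p : Path 0 (suc n)) → avoiding (up ∷ₚ up ∷ₚ r) p ≡ avoiding (up ∷ₚ raised (up ∷ₚ q)) p
    same n p = χ-cong (¬? (Occurs? (up ∷ₚ up ∷ₚ r) p)) (¬? (Occurs? (up ∷ₚ raised (up ∷ₚ q)) p))
      (_∘ from e) (_∘ to e)
      where e = Occurs-subst {s = up} {t = up} {p = p} (ℕ.+-comm (suc k) 1) raised≡r

    G-total : ∀ n → G n ≡ total 0 (suc n) (avoiding (up ∷ₚ q))
    G-total n = count-avoiding pos-q model-q (G-count n)

    Gc-total : ∀ n → Gc n ≡ total 0 (suc n) (λ p → χ (¬? (Occurs? (up ∷ₚ q) p) ×-dec ConnectedPath? p))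
    Gc-total n = count-connected pos-q model-q (Gc-count n)

    F-total : ∀ n → F n ≡ total 0 (suc n) (avoiding (up ∷ₚ raised (up ∷ₚ q)))
    F-total n = trans (count-avoiding {q = up ∷ₚ r} (s≤s z≤n , pos-r) model-r (F-count n))
      (total-cong 0 (suc n) (same n))

  reduced-relations = AvoidingCounts.relations q pos-q G Gc F G-total Gc-total F-total

theorem3p6 : ∀ (k : ℕ) (h : Perm (2 + k)) (g : Perm k) →
    Connected h → FullyCommutative h → TwoEntriesInEachInternalColumn h →
    IsDiamondReduction h g →
    ∀ (G Gc F : ℕ → ℕ) →
    (∀ n → ∣ S₃₂₁ g n ∣≡ G n) →
    (∀ n → ∣ (λ p → S₃₂₁ g n p × Connected p) ∣≡ Gc n) →
    (∀ n → ∣ S₃₂₁ h n ∣≡ F n) →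
    G 0 ≡ 1 → F 0 ≡ 1 → Gc 0 ≡ 0 →
    (gf F ≐ C 1ℤ -ₛ X -ₛ X *ₛ gf Gc
    ÷ C 1ℤ -ₛ C (+ 3) *ₛ X +ₛ X *ₛ X +ₛ (X *ₛ X -ₛ X) *ₛ gf Gc)
    × (gf F ≐ C 1ℤ
    ÷ C 1ℤ -ₛ C (+ 2) *ₛ X -ₛ X *ₛ X *ₛ gf G)
-- Without internal columns `g` lies in S₁ and has an empty heap, which every permutation in S₁
-- contains. This contradicts G(0) = 1.
theorem3p6 zero h g _ _ _ _ G Gc F G-count _ _ G0 _ _ =
  contradiction (trivial-contains (proj₁ member) g) (proj₂ (proj₂ member))
  where member = Inverse.to (G-count 0) (subst Fin (sym G0) zero)
theorem3p6 (suc k) h g conn fc two red G Gc F G-count Gc-count F-count G0 F0 Gc0 =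
  reduced-relations (reduction-model red conn fc two) G Gc F G-count Gc-count F-count G0 F0 Gc0
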